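{- Let $H$ be an ordered graph with $m$ edges and no isolated vertices. Then \[ r_<(H) \leq e^{10^9 \sqrt{m} (\log \log m)^{3/2}}. \]
   Context: An ordered graph on $n$ vertices is a graph whose vertex set is $\{1,\dots,n\}$ with its natural order. An ordered graph $G$ on $[N]$ contains an ordered graph $H$ on $[n]$ if there is a map $\phi:[n]\to[N]$ with $\phi(i)<\phi(j)$ for all $1\le i<j\le n$ and $\phi(i)\phi(j)\in E(G)$ whenever $ij\in E(H)$. The ordered Ramsey number $r_<(H)$ is the minimum $N$ such that every 2-coloring of the edges of the complete ordered graph on $[N]$ contains a monochromatic (ordered) copy of $H$. All logarithms are natural. -}

module Defs where

open import Data.Bool using (Bool; true; false; if_then_else_; _∧_)
open import Data.Nat as ℕ using (ℕ; zero; suc; _<ᵇ_)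
open import Data.Fin using (Fin; toℕ) renaming (_<_ to _<ᶠ_)
open import Data.List using (List; map; allFin)
open import Data.Nat.ListAction using (sum)
open import Data.Integer using (+_)
open import Data.Rational using (ℚ; _/_; 1ℚ; _+_; _*_)
open import Data.Product using (Σ; _×_; ∃)
open import Data.Sum using (_⊎_)
open import Relation.Binary.PropositionalEquality using (_≡_)

-- Ordered graphs on [n] = Fin n (natural order of Fin n).
-- An ordered graph is given by a Boolean "upper-triangular" adjacency:
-- for i < j, the pair ij is an edge iff adj i j ≡ true.
-- (Entries adj i j with i ≥ j are ignored.)

OrdGraph : ℕ → Set
OrdGraph n = Fin n → Fin n → Bool

Edge : ∀ {n} → OrdGraph n → Fin n → Fin n → Set
Edge H i j = (i <ᶠ j) × (H i j ≡ true)

Adjacent : ∀ {n} → OrdGraph n → Fin n → Fin n → Set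
Adjacent H u v = Edge H u v ⊎ Edge H v u

NoIsolatedVertices : ∀ {n} → OrdGraph n → Set
NoIsolatedVertices {n} H = (v : Fin n) → ∃ λ u → Adjacent H u v

edgeCount : ∀ {n} → OrdGraph n → ℕ
edgeCount {n} H =
  sum (map (λ i → sum (map (λ j → if (toℕ i <ᵇ toℕ j) ∧ H i j then 1 else 0)
                           (allFin n)))
           (allFin n))

-- 2-colourings of the edges of the complete ordered graph on [N]:
-- the pair i < j gets colour c i j ∈ Bool (entries with i ≥ j ignored).

Colouring : ℕ → Set
Colouring N = Fin N → Fin N → Bool

MonoCopy : ∀ {n N} → Colouring N → Bool → OrdGraph n → Set
MonoCopy {n} {N} c b H =
  Σ (Fin n → Fin N) λ φ →
    ((i j : Fin n) → i <ᶠ j → φ i <ᶠ φ j) ×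
    ((i j : Fin n) → Edge H i j → c (φ i) (φ j) ≡ b)

-- Partial sums of the exponential series (exact, rational):
-- expPartial x j = Σ_{i ≤ j} x^i / i!.
-- For x ≥ 0 these increase to e^x, so "∃ j, y ≤ expPartial x j" means
-- y < e^x or (y ≤ e^x, attained by a partial sum).

expTerm : ℚ → ℕ → ℚ
expTerm x zero    = 1ℚ
expTerm x (suc i) = expTerm x i * x * (+ 1 / suc i)

expPartial : ℚ → ℕ → ℚ
expPartial x zero    = 1ℚ
expPartial x (suc j) = expPartial x j + expTerm x (suc j)

ℕtoℚ : ℕ → ℚ
ℕtoℚ k = + k / 1

{-# OPTIONS --safe #-}

-- Call a colour γ-sparse between vertex sets X < Y or Y < X if every vertex of X sends it to at most a
-- fraction 2^-γ of Y, and measure the loss of vertices in bits.  If H has no red copy, embedding H greedily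
-- (vertices of degree ≥ √(2m) first, so that at most √(2m) neighbours precede any vertex) gets stuck at two
-- sets between which red is γ-sparse, at a loss of about γ√m bits.
--
-- This is amplified.  If red is γ-sparse, γ = 2a + 2, between two parts of every large set, then doubling γ
-- times inside such pairs gives a blue clique of size about 2^a√m with large reserved sets between its members;
-- each doubling drops a few members of the clique, and the others are completely blue to a large set in which
-- the other half is grown.  When there is no blue copy of H, placing the vertices of degree at least √m / 2^a
-- on the clique and the other ones in the reserved sets fails, so blue is γ′-sparse somewhere.  Only
-- O(√m / 2^a) neighbours per vertex cost γ′ bits each, so γ′ may be of order 2^a, and the loss is about γ times
-- the previous one.  With L = log log m, going from γ ~ log L to γ ~ L to γ ~ log m costs O(√m L (log L)²) bits.
--
-- If red has density below 1/(2n) between X and Y, then one half of the blue target is sought in X and the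
-- other half among the at least |Y|/2 common blue neighbours of the copy found in X.  This halves the number of
-- edges of one of the two targets.  The greedy embedding of the smaller target gets cheaper on the way: after
-- O(log L) halvings one amplification suffices, and after O(L) of them none is needed.

module Submission where

-- Halving a target requires density below 1/(2n), so γ of order log m, and a direct greedy
-- embedding at that γ loses about √m log m bits. The two amplifications avoid this loss while both
-- targets are still large. The total is O(√m L (log L)³): O(log L) halvings at √m L (log L)² bits
-- each, O(L) halvings at O(√m) bits, and O(log m) halvings at O(√m / log m) bits, until some target
-- has no edge. Since (log L)³ = O(√L), this is at most the required √m L^(3/2).
--
-- Sizes are bounded below by powers of two, so that losses add up, and √m is rounded to a multiple
-- of a power of two, so that the quotients needed are exact. The exponent 3/2 is handled by
-- comparing squares. Sparse pairs are only asserted up to double negation: copies are never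
-- decided, and every argument ends in a contradiction or in the decidable inequality
-- `suc N ≤ 2 ^ E`.

module Combinatorics where

  open import Data.Bool using (Bool; true; false; not; _∧_; if_then_else_; T)
  open import Data.Bool.Properties using (T-≡; not-involutive; T?)
  open import Data.Nat
  open import Data.Nat.Properties
  open import Data.Nat.Tactic.RingSolver using (solve-∀)
  open import Data.List using (List; []; _∷_; _++_; map; length; filterᵇ; take; drop; upTo; foldr; allFin; tabulate; applyUpTo)
  open import Data.List.Properties using (length-++; length-map; length-take; length-drop; length-upTo; drop-drop; map-++; ++-identityʳ; map-tabulate; length-tabulate) renaming (++-assoc to ++-assoc′)
  open import Data.List.Membership.Propositional using (_∈_)
  open import Data.List.Membership.Propositional.Properties using (∈-filter⁻; ∈-filter⁺; ∈-++⁻; ∈-++⁺ˡ; ∈-++⁺ʳ; ∈-map⁺; ∈-map⁻; ∈-upTo⁺; ∈-upTo⁻; ∈-allFin)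
  open import Data.List.Relation.Unary.Any using (here; there)
  open import Data.List.Relation.Unary.All as All using (All; []; _∷_)
  open import Data.List.Relation.Unary.AllPairs as AllPairs using (AllPairs; []; _∷_)
  open import Data.List.Relation.Binary.Sublist.Propositional using (_⊆_; []; _∷_; _∷ʳ_; ⊆-refl; ⊆-trans; minimum) renaming (lookup to ⊆-lookup)
  open import Data.List.Relation.Binary.Sublist.Propositional.Properties using (filter-⊆; take-⊆; drop-⊆; length-mono-≤) renaming (map⁺ to ⊆-map⁺; ++⁺ to ⊆-++⁺; ++⁺ʳ to ⊆-++⁺ʳ; ++⁺ˡ to ⊆-++⁺ˡ)
  open import Data.List.Relation.Binary.Permutation.Propositional as Perm using (_↭_; ↭-sym; ↭-trans; ↭-refl)
  open import Data.List.Relation.Binary.Permutation.Propositional.Properties using (shift; ++-comm; ++⁺ʳ; ↭-length; ++-assoc; ∈-resp-↭) renaming (map⁺ to map-↭)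
  open import Data.Product using (Σ; _×_; _,_; proj₁; proj₂; ∃)
  open import Data.Sum using (_⊎_; inj₁; inj₂; [_,_]′)
  open import Data.Empty using (⊥; ⊥-elim)
  open import Function using (_∘_; Equivalence)
  open import Relation.Nullary using (Dec; ¬_; yes; no)
  open import Relation.Binary.PropositionalEquality using (_≡_; _≢_; refl; sym; cong; cong₂; subst; subst₂; module ≡-Reasoning) renaming (trans to ≡-trans)
  open import Data.List.Relation.Binary.Pointwise using (Pointwise; []; _∷_; Pointwise-length)
  open import Data.List.Relation.Unary.AllPairs.Properties using (applyUpTo⁺₁) renaming (map⁺ to AllPairs-map⁺)
  open import Data.Nat.ListAction using (sum)
  open import Data.Fin using (Fin; toℕ; fromℕ<)
  open import Data.Fin.Properties using (toℕ<n; toℕ-fromℕ<; fromℕ<-toℕ)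
  open import Relation.Binary.Definitions using (tri<; tri≈; tri>)
  import Defs as D

  private variable A : Set

  -- Counting in lists

  bit : Bool → ℕ
  bit b = if b then 1 else 0

  bit≤1 : ∀ b → bit b ≤ 1
  bit≤1 false = z≤n
  bit≤1 true  = ≤-refl

  count : (A → Bool) → List A → ℕ
  count p xs = length (filterᵇ p xs)

  count-∷ : (p : A → Bool) (x : A) (xs : List A) → count p (x ∷ xs) ≡ bit (p x) + count p xs
  count-∷ p x xs with p x
  ... | true  = refl
  ... | false = refl

  count-++ : (p : A → Bool) (xs ys : List A) → count p (xs ++ ys) ≡ count p xs + count p ys
  count-++ p []       ys = refl
  count-++ p (x ∷ xs) ys
    rewrite count-∷ p x (xs ++ ys) | count-∷ p x xs | count-++ p xs ys = sym (+-assoc (bit (p x)) _ _)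

  count≤length : (p : A → Bool) (xs : List A) → count p xs ≤ length xs
  count≤length p []       = z≤n
  count≤length p (x ∷ xs) rewrite count-∷ p x xs = +-mono-≤ (bit≤1 (p x)) (count≤length p xs)

  count-not : (p : A → Bool) (xs : List A) → count p xs + count (not ∘ p) xs ≡ length xs
  count-not p []       = refl
  count-not p (x ∷ xs) with p x
  ... | true  = cong suc (count-not p xs)
  ... | false = ≡-trans (+-suc (count p xs) _) (cong suc (count-not p xs))

  count-mono : (p q : A → Bool) (xs : List A) → (∀ {x} → x ∈ xs → p x ≡ true → q x ≡ true) →
               count p xs ≤ count q xs
  count-mono p q []       h = z≤n
  count-mono p q (x ∷ xs) h with p x in eq | q x in eq′
  ... | true  | true  = s≤s (count-mono p q xs (h ∘ there))
  ... | true  | false with () ← ≡-trans (sym eq′) (h (here refl) eq)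
  ... | false | true  = m≤n⇒m≤1+n (count-mono p q xs (h ∘ there))
  ... | false | false = count-mono p q xs (h ∘ there)

  count-none : (p : A → Bool) (xs : List A) → (∀ {x} → x ∈ xs → p x ≡ false) → count p xs ≡ 0
  count-none p []       h = refl
  count-none p (x ∷ xs) h rewrite count-∷ p x xs | h (here refl) = count-none p xs (h ∘ there)

  count-∈ : (p : A → Bool) {x : A} (xs : List A) → x ∈ xs → p x ≡ true → 1 ≤ count p xs
  count-∈ p (x ∷ xs) (here refl) e rewrite count-∷ p x xs | e = s≤s z≤n
  count-∈ p (x ∷ xs) (there i)   e rewrite count-∷ p x xs = ≤-trans (count-∈ p xs i e) (m≤n+m _ _)

  ∈-filterᵇ⁻ : (p : A → Bool) {x : A} {xs : List A} → x ∈ filterᵇ p xs → (x ∈ xs) × (p x ≡ true)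
  ∈-filterᵇ⁻ p i with ∈-filter⁻ (T? ∘ p) i
  ... | j , t = j , Equivalence.to T-≡ t

  ∈-filterᵇ⁺ : (p : A → Bool) {x : A} {xs : List A} → x ∈ xs → p x ≡ true → x ∈ filterᵇ p xs
  ∈-filterᵇ⁺ p i e = ∈-filter⁺ (T? ∘ p) i (Equivalence.from T-≡ e)

  filterᵇ-⊆ : (p : A → Bool) (xs : List A) → filterᵇ p xs ⊆ xs
  filterᵇ-⊆ p xs = filter-⊆ (T? ∘ p) xs

  ⊆-∈ : {xs ys : List A} {x : A} → xs ⊆ ys → x ∈ xs → x ∈ ys
  ⊆-∈ τ i = ⊆-lookup τ i

  count-⊆ : (p : A → Bool) {X Y : List A} → X ⊆ Y → count p X ≤ count p Y
  count-⊆ p [] = z≤n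
  count-⊆ p {X} {y ∷ Y} (y ∷ʳ τ) rewrite count-∷ p y Y = ≤-trans (count-⊆ p τ) (m≤n+m _ _)
  count-⊆ p {x ∷ X} {y ∷ Y} (refl ∷ τ) rewrite count-∷ p y Y | count-∷ p y X = +-monoʳ-≤ (bit (p y)) (count-⊆ p τ)

  count-strict : (p q : A → Bool) {x : A} (xs : List A) → (∀ y → p y ≡ true → q y ≡ true) →
                 x ∈ xs → p x ≡ false → q x ≡ true → count p xs < count q xs
  count-strict p q (x ∷ xs) h (here refl) px qx rewrite count-∷ p x xs | count-∷ q x xs | px | qx =
    s≤s (count-mono p q xs (λ {y} _ → h y))
  count-strict p q (x ∷ xs) h (there i) px qx rewrite count-∷ p x xs | count-∷ q x xs =
    +-mono-≤-< (bit-mono (h x)) (count-strict p q xs h i px qx)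
    where
    bit-mono : ∀ {a b} → (a ≡ true → b ≡ true) → bit a ≤ bit b
    bit-mono {false} _ = z≤n
    bit-mono {true}  f = ≤-reflexive (sym (cong bit (f refl)))

  nonempty : (xs : List A) → 1 ≤ length xs → ∃ λ x → x ∈ xs
  nonempty (x ∷ xs) _ = x , here refl

  AllPairs-⊆ : {R : A → A → Set} {xs ys : List A} → xs ⊆ ys → AllPairs R ys → AllPairs R xs
  AllPairs-⊆ []         []       = []
  AllPairs-⊆ (y ∷ʳ τ)   (_ ∷ ps) = AllPairs-⊆ τ ps
  AllPairs-⊆ (refl ∷ τ) (p ∷ ps) = All.tabulate (λ i → All.lookup p (⊆-∈ τ i)) ∷ AllPairs-⊆ τ ps

  AllPairs-++ : {R : A → A → Set} (xs {ys} : List A) → AllPairs R xs → AllPairs R ys →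
                (∀ {x y} → x ∈ xs → y ∈ ys → R x y) → AllPairs R (xs ++ ys)
  AllPairs-++ []       _        qs h = qs
  AllPairs-++ (x ∷ xs) (p ∷ ps) qs h =
    All.tabulate (λ i → [ All.lookup p , h (here refl) ]′ (∈-++⁻ xs i)) ∷ AllPairs-++ xs ps qs (h ∘ there)

  Σ[_] : List A → (A → ℕ) → ℕ
  Σ[ [] ]     f = 0
  Σ[ x ∷ xs ] f = f x + Σ[ xs ] f

  Σ-mono : (xs : List A) {f g : A → ℕ} → (∀ {x} → x ∈ xs → f x ≤ g x) → Σ[ xs ] f ≤ Σ[ xs ] g
  Σ-mono []       h = z≤n
  Σ-mono (x ∷ xs) h = +-mono-≤ (h (here refl)) (Σ-mono xs (h ∘ there))

  Σ-cong : (xs : List A) {f g : A → ℕ} → (∀ x → f x ≡ g x) → Σ[ xs ] f ≡ Σ[ xs ] g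
  Σ-cong []       h = refl
  Σ-cong (x ∷ xs) h = cong₂ _+_ (h x) (Σ-cong xs h)

  Σ-+ : (xs : List A) (f g : A → ℕ) → Σ[ xs ] (λ x → f x + g x) ≡ Σ[ xs ] f + Σ[ xs ] g
  Σ-+ []       f g = refl
  Σ-+ (x ∷ xs) f g rewrite Σ-+ xs f g = lem (f x) (g x) _ _
    where lem : ∀ a b c d → a + b + (c + d) ≡ a + c + (b + d)
          lem = solve-∀

  Σ-* : (k : ℕ) (xs : List A) (f : A → ℕ) → Σ[ xs ] (λ x → k * f x) ≡ k * Σ[ xs ] f
  Σ-* k []       f = sym (*-zeroʳ k)
  Σ-* k (x ∷ xs) f rewrite Σ-* k xs f = sym (*-distribˡ-+ k (f x) _)

  Σ-const : (k : ℕ) (xs : List A) → Σ[ xs ] (λ _ → k) ≡ length xs * k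
  Σ-const k []       = refl
  Σ-const k (x ∷ xs) = cong (k +_) (Σ-const k xs)

  Σ-++ : (xs ys : List A) (f : A → ℕ) → Σ[ xs ++ ys ] f ≡ Σ[ xs ] f + Σ[ ys ] f
  Σ-++ []       ys f = refl
  Σ-++ (x ∷ xs) ys f rewrite Σ-++ xs ys f = sym (+-assoc (f x) _ _)

  Σ-zero : (xs : List A) → Σ[ xs ] (λ _ → 0) ≡ 0
  Σ-zero xs = ≡-trans (Σ-const 0 xs) (*-zeroʳ (length xs))

  count-Σ : (p : A → Bool) (xs : List A) → count p xs ≡ Σ[ xs ] (bit ∘ p)
  count-Σ p []       = refl
  count-Σ p (x ∷ xs) rewrite count-∷ p x xs = cong (bit (p x) +_) (count-Σ p xs)

  double-count : {B : Set} (f : A → B → Bool) (xs : List A) (ys : List B) →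
                 Σ[ xs ] (λ x → count (f x) ys) ≡ Σ[ ys ] (λ y → count (λ x → f x y) xs)
  double-count f []       ys = sym (Σ-zero ys)
  double-count f (x ∷ xs) ys = begin
    count (f x) ys + Σ[ xs ] (λ x → count (f x) ys)
      ≡⟨ cong₂ _+_ (count-Σ (f x) ys) (double-count f xs ys) ⟩
    Σ[ ys ] (bit ∘ f x) + Σ[ ys ] (λ y → count (λ x → f x y) xs)
      ≡⟨ Σ-+ ys _ _ ⟨
    Σ[ ys ] (λ y → bit (f x y) + count (λ x → f x y) xs)
      ≡⟨ Σ-cong ys (λ y → sym (count-∷ (λ x → f x y) x xs)) ⟩
    Σ[ ys ] (λ y → count (λ x → f x y) (x ∷ xs)) ∎
    where open ≡-Reasoning

  -- Union bound, by discarding the bad elements of one `Y` at a time.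
  avoid : {B : Set} (bad : B → A → Bool) (V : List A) (Ys : List B) →
          Σ[ Ys ] (λ Y → count (bad Y) V) < length V →
          ∃ λ x → (x ∈ V) × (∀ {Y} → Y ∈ Ys → bad Y x ≡ false)
  avoid bad V [] lt with nonempty V lt
  ... | x , i = x , i , λ ()
  avoid bad V (Y ∷ Ys) lt with avoid bad V′ Ys lt′
    where
    V′ = filterᵇ (not ∘ bad Y) V
    open ≤-Reasoning
    lt′ : Σ[ Ys ] (λ Y → count (bad Y) V′) < length V′
    lt′ = +-cancelˡ-< (count (bad Y) V) _ _ (begin-strict
      count (bad Y) V + Σ[ Ys ] (λ Y → count (bad Y) V′)
        ≤⟨ +-monoʳ-≤ (count (bad Y) V) (Σ-mono Ys (λ {Y′} _ → length-mono-≤ (filt (bad Y′) V))) ⟩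
      count (bad Y) V + Σ[ Ys ] (λ Y → count (bad Y) V) <⟨ lt ⟩
      length V ≡⟨ count-not (bad Y) V ⟨
      count (bad Y) V + length V′ ∎)
      where
      filt : ∀ p xs → filterᵇ p (filterᵇ (not ∘ bad Y) xs) ⊆ filterᵇ p xs
      filt p [] = []
      filt p (x ∷ xs) with bad Y x
      ... | true  with p x
      ...   | true  = x ∷ʳ filt p xs
      ...   | false = filt p xs
      filt p (x ∷ xs) | false with p x
      ...   | true  = refl ∷ filt p xs
      ...   | false = filt p xs
  ... | x , i , h with ∈-filterᵇ⁻ (not ∘ bad Y) i
  ...   | j , e = x , j , λ { (here refl) → not-true e ; (there k) → h k }
    where not-true : ∀ {b} → not b ≡ true → b ≡ false
          not-true {false} _ = refl

  -- Intervals, short sublists and common neighbourhoods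

  Sorted : List ℕ → Set
  Sorted = AllPairs _<_

  infix 4 _≪_
  record _≪_ (X Y : List ℕ) : Set where
    constructor ≪-intro
    field below : ∀ {x y} → x ∈ X → y ∈ Y → x < y
  open _≪_ public

  Oriented : List ℕ → List ℕ → Set
  Oriented X Y = X ≪ Y ⊎ Y ≪ X

  ≪-⊆ : ∀ {X X′ Y Y′} → X′ ⊆ X → Y′ ⊆ Y → X ≪ Y → X′ ≪ Y′
  ≪-⊆ σ τ p = ≪-intro λ i j → below p (⊆-∈ σ i) (⊆-∈ τ j)

  Oriented-⊆ : ∀ {X X′ Y Y′} → X′ ⊆ X → Y′ ⊆ Y → Oriented X Y → Oriented X′ Y′
  Oriented-⊆ σ τ (inj₁ p) = inj₁ (≪-⊆ σ τ p)
  Oriented-⊆ σ τ (inj₂ p) = inj₂ (≪-⊆ τ σ p)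

  Oriented-swap : ∀ {X Y} → Oriented X Y → Oriented Y X
  Oriented-swap (inj₁ p) = inj₂ p
  Oriented-swap (inj₂ p) = inj₁ p

  piece : List ℕ → ℕ → ℕ → List ℕ
  piece Z b i = take b (drop (i * b) Z)

  piece-⊆ : ∀ Z b i → piece Z b i ⊆ Z
  piece-⊆ Z b i = ⊆-trans (take-⊆ b _) (drop-⊆ (i * b) Z)

  piece-length : ∀ Z b {i p} → i < p → p * b ≤ length Z → length (piece Z b i) ≡ b
  piece-length Z b {i} {p} i<p h = begin
    length (piece Z b i)       ≡⟨ length-take b (drop (i * b) Z) ⟩
    b ⊓ length (drop (i * b) Z) ≡⟨ cong (b ⊓_) (length-drop (i * b) Z) ⟩
    b ⊓ (length Z ∸ i * b)      ≡⟨ m≤n⇒m⊓n≡m (m+n≤o⇒m≤o∸n b (≤-trans (*-monoˡ-≤ b i<p) h)) ⟩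
    b                           ∎
    where open ≡-Reasoning

  take<drop : ∀ {Z} b k → Sorted Z → b ≤ k → take b Z ≪ drop k Z
  take<drop {Z} b k sZ le = ≪-intro (go b k sZ le)
    where
    go : ∀ {Z} b k → Sorted Z → b ≤ k → ∀ {x y} → x ∈ take b Z → y ∈ drop k Z → x < y
    go {z ∷ Z} (suc b) (suc k) (p ∷ ps) le (here refl) j = All.lookup p (⊆-∈ (drop-⊆ k Z) j)
    go {z ∷ Z} (suc b) (suc k) (p ∷ ps) le (there i)   j = go b k ps (s≤s⁻¹ le) i j

  piece-≪ : ∀ {Z} b {i j} → Sorted Z → i < j → piece Z b i ≪ piece Z b j
  piece-≪ {Z} b {i} {j} sZ i<j = ≪-intro λ x∈ y∈ →
    below (take<drop b (j * b ∸ i * b) (AllPairs-⊆ (drop-⊆ (i * b) Z) sZ)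
      (m+n≤o⇒m≤o∸n b (*-monoˡ-≤ b i<j))) x∈
      (subst (λ L → _ ∈ L) eq (⊆-∈ (take-⊆ b (drop (j * b) Z)) y∈))
    where
    eq : drop (j * b) Z ≡ drop (j * b ∸ i * b) (drop (i * b) Z)
    eq = ≡-trans (cong (λ k → drop k Z) (sym (m+[n∸m]≡n (*-monoˡ-≤ b (<⇒≤ i<j)))))
                 (sym (drop-drop (i * b) (j * b ∸ i * b) Z))

  nth : A → List A → ℕ → A
  nth d []       _       = d
  nth d (x ∷ xs) zero    = x
  nth d (x ∷ xs) (suc i) = nth d xs i

  nth-∈ : ∀ (d : A) xs {i} → i < length xs → nth d xs i ∈ xs
  nth-∈ d (x ∷ xs) {zero}  _  = here refl
  nth-∈ d (x ∷ xs) {suc i} lt = there (nth-∈ d xs (s≤s⁻¹ lt))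

  nth-pairs : ∀ {R : A → A → Set} d {xs i j} → AllPairs R xs → i < j → j < length xs →
              R (nth d xs i) (nth d xs j)
  nth-pairs d {x ∷ xs} {zero}  {suc j} (p ∷ ps) lt l = All.lookup p (nth-∈ d xs (s≤s⁻¹ l))
  nth-pairs d {x ∷ xs} {suc i} {suc j} (p ∷ ps) lt l = nth-pairs d ps (s≤s⁻¹ lt) (s≤s⁻¹ l)

  shortSublists : ℕ → List A → List (List A)
  shortSublists zero    T       = [] ∷ []
  shortSublists (suc k) []      = [] ∷ []
  shortSublists (suc k) (x ∷ T) = shortSublists (suc k) T ++ map (x ∷_) (shortSublists k T)

  shortSublists-complete : ∀ k {Q T : List A} → Q ⊆ T → length Q ≤ k → Q ∈ shortSublists k T
  shortSublists-complete zero    {[]} τ le = here refl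
  shortSublists-complete (suc k) [] le = here refl
  shortSublists-complete (suc k) {T = y ∷ T} (y ∷ʳ τ) le = ∈-++⁺ˡ (shortSublists-complete (suc k) τ le)
  shortSublists-complete (suc k) {T = y ∷ T} (refl ∷ τ) le =
    ∈-++⁺ʳ (shortSublists (suc k) T) (∈-map⁺ (y ∷_) (shortSublists-complete k τ (s≤s⁻¹ le)))

  shortSublists-sound : ∀ k {Q T : List A} → Q ∈ shortSublists k T → Q ⊆ T × length Q ≤ k
  shortSublists-sound zero    {T = T} (here refl) = minimum T , z≤n
  shortSublists-sound (suc k) {T = []} (here refl) = [] , z≤n
  shortSublists-sound (suc k) {T = x ∷ T} i with ∈-++⁻ (shortSublists (suc k) T) i
  ... | inj₁ j with shortSublists-sound (suc k) j
  ...   | τ , le = x ∷ʳ τ , le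
  shortSublists-sound (suc k) {T = x ∷ T} i | inj₂ j with ∈-map⁻ (x ∷_) j
  ... | Q , j′ , refl with shortSublists-sound k j′
  ...   | τ , le = refl ∷ τ , s≤s le

  -- This is Σ_{i≤k} C(n,i) ≤ (1 + 1/y)ⁿ (1 + y)ᵏ, with denominators cleared.
  shortSublists-count : ∀ y k (T : List A) → length (shortSublists k T) * y ^ length T ≤ suc y ^ (length T + k)
  shortSublists-count y zero T rewrite +-identityʳ (y ^ length T) | +-identityʳ (length T) =
    ^-monoˡ-≤ (length T) (n≤1+n y)
  shortSublists-count y (suc k) [] = m^n>0 (suc y) (suc k)
  shortSublists-count y (suc k) (x ∷ T) = begin
    length (shortSublists (suc k) T ++ map (x ∷_) (shortSublists k T)) * (y * y ^ t)
      ≡⟨ cong (_* (y * y ^ t)) (≡-trans (length-++ (shortSublists (suc k) T)) (cong (length (shortSublists (suc k) T) +_) (length-map _ (shortSublists k T)))) ⟩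
    (length (shortSublists (suc k) T) + length (shortSublists k T)) * (y * y ^ t)
      ≡⟨ lem₁ (length (shortSublists (suc k) T)) (length (shortSublists k T)) y (y ^ t) ⟩
    y * (length (shortSublists (suc k) T) * y ^ t) + y * (length (shortSublists k T) * y ^ t)
      ≤⟨ +-mono-≤ (*-monoʳ-≤ y (shortSublists-count y (suc k) T)) (*-monoʳ-≤ y (shortSublists-count y k T)) ⟩
    y * suc y ^ (t + suc k) + y * suc y ^ (t + k)
      ≡⟨ cong (λ z → y * suc y ^ z + y * suc y ^ (t + k)) (+-suc t k) ⟩
    y * (suc y * w) + y * w
      ≤⟨ m≤m+n _ w ⟩
    y * (suc y * w) + y * w + w
      ≡⟨ lem₂ y w ⟩
    suc y * (suc y * w)
      ≡⟨ cong (λ z → suc y * suc y ^ z) (+-suc t k) ⟨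
    suc y ^ (suc t + suc k) ∎
    where
    open ≤-Reasoning
    t = length T
    w = suc y ^ (t + k)
    lem₁ : ∀ a b y p → (a + b) * (y * p) ≡ y * (a * p) + y * (b * p)
    lem₁ = solve-∀
    lem₂ : ∀ y w → y * ((1 + y) * w) + y * w + w ≡ (1 + y) * ((1 + y) * w)
    lem₂ = solve-∀

  module Nbhd (r : A → ℕ → Bool) where

    nb : List A → List ℕ → List ℕ
    nb Q C = foldr (λ q → filterᵇ (r q)) C Q

    nb-⊆ : ∀ Q C → nb Q C ⊆ C
    nb-⊆ []      C = ⊆-refl
    nb-⊆ (q ∷ Q) C = ⊆-trans (filterᵇ-⊆ (r q) _) (nb-⊆ Q C)

    nb-∈ : ∀ {Q C q y} → y ∈ nb Q C → q ∈ Q → r q y ≡ true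
    nb-∈ {Q = q ∷ Q} {C} i (here refl) = proj₂ (∈-filterᵇ⁻ (r q) {xs = nb Q C} i)
    nb-∈ {Q = q ∷ Q} {C} i (there j)   = nb-∈ (proj₁ (∈-filterᵇ⁻ (r q) {xs = nb Q C} i)) j

    -- In the halving step every summand is a tiny fraction of `C`, so that half of `C` survives as
    -- a common neighbourhood.
    nb-union : ∀ Q C → length C ≤ length (nb Q C) + Σ[ Q ] (λ q → count (not ∘ r q) C)
    nb-union []      C = m≤m+n _ _
    nb-union (q ∷ Q) C = begin
      length C                                      ≤⟨ nb-union Q C ⟩
      length (nb Q C) + rest                        ≡⟨ cong (_+ rest) (count-not (r q) (nb Q C)) ⟨
      count (r q) (nb Q C) + count (not ∘ r q) (nb Q C) + rest
        ≤⟨ +-monoˡ-≤ rest (+-monoʳ-≤ (count (r q) (nb Q C)) (count-⊆ (not ∘ r q) (nb-⊆ Q C))) ⟩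
      count (r q) (nb Q C) + count (not ∘ r q) C + rest ≡⟨ +-assoc (count (r q) (nb Q C)) _ rest ⟩
      count (r q) (nb Q C) + (count (not ∘ r q) C + rest) ∎
      where
      open ≤-Reasoning
      rest = Σ[ Q ] (λ q → count (not ∘ r q) C)

    nb-complete : ∀ Q C → (∀ {q y} → q ∈ Q → y ∈ C → r q y ≡ true) → nb Q C ≡ C
    nb-complete []      C h = refl
    nb-complete (q ∷ Q) C h rewrite nb-complete Q C (h ∘ there) = filter-id C (h (here refl))
      where
      filter-id : ∀ {p : ℕ → Bool} C → (∀ {y} → y ∈ C → p y ≡ true) → filterᵇ p C ≡ C
      filter-id []      h = refl
      filter-id (y ∷ C) h rewrite h (here refl) = cong (y ∷_) (filter-id C (h ∘ there))

    nb-↭ : ∀ {Q Q′} C → Q ↭ Q′ → nb Q C ≡ nb Q′ C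
    nb-↭ C Perm.refl = refl
    nb-↭ C (Perm.prep q p) = cong (filterᵇ (r q)) (nb-↭ C p)
    nb-↭ C (Perm.swap {ys = Q′} q q′ p) =
      ≡-trans (cong (filterᵇ (r q) ∘ filterᵇ (r q′)) (nb-↭ C p)) (comm (r q) (r q′) (nb Q′ C))
      where
      comm : ∀ (p p′ : ℕ → Bool) X → filterᵇ p (filterᵇ p′ X) ≡ filterᵇ p′ (filterᵇ p X)
      comm p p′ [] = refl
      comm p p′ (x ∷ X) with p x in e | p′ x in e′
      ... | true  | true  rewrite e | e′ = cong (x ∷_) (comm p p′ X)
      ... | true  | false rewrite e′ = comm p p′ X
      ... | false | true  rewrite e = comm p p′ X
      ... | false | false = comm p p′ X
    nb-↭ C (Perm.trans p p′) = ≡-trans (nb-↭ C p) (nb-↭ C p′)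

  -- Needed because clique members are chosen in one order and finally listed in another, while
  -- conditions on them speak of sublists.
  ⊆-↭ : {Q T T′ : List A} → Q ⊆ T → T ↭ T′ → ∃ λ Q′ → Q′ ⊆ T′ × Q ↭ Q′
  ⊆-↭ τ Perm.refl = _ , τ , Perm.refl
  ⊆-↭ (y ∷ʳ τ) (Perm.prep y p) with ⊆-↭ τ p
  ... | Q′ , σ , π = Q′ , y ∷ʳ σ , π
  ⊆-↭ (refl ∷ τ) (Perm.prep y p) with ⊆-↭ τ p
  ... | Q′ , σ , π = y ∷ Q′ , refl ∷ σ , Perm.prep y π
  ⊆-↭ (x ∷ʳ (y ∷ʳ τ)) (Perm.swap x y p) with ⊆-↭ τ p
  ... | Q′ , σ , π = Q′ , y ∷ʳ (x ∷ʳ σ) , π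
  ⊆-↭ (x ∷ʳ (refl ∷ τ)) (Perm.swap x y p) with ⊆-↭ τ p
  ... | Q′ , σ , π = y ∷ Q′ , refl ∷ (x ∷ʳ σ) , Perm.prep y π
  ⊆-↭ (refl ∷ (y ∷ʳ τ)) (Perm.swap x y p) with ⊆-↭ τ p
  ... | Q′ , σ , π = x ∷ Q′ , y ∷ʳ (refl ∷ σ) , Perm.prep x π
  ⊆-↭ (refl ∷ (refl ∷ τ)) (Perm.swap x y p) with ⊆-↭ τ p
  ... | Q′ , σ , π = y ∷ x ∷ Q′ , refl ∷ (refl ∷ σ) , Perm.swap x y π
  ⊆-↭ τ (Perm.trans p q) with ⊆-↭ τ p
  ... | Q′ , σ , π with ⊆-↭ σ q
  ...   | Q″ , σ′ , π′ = Q″ , σ′ , Perm.trans π π′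

  ^-distribʳ-* : ∀ n a b → (a * b) ^ n ≡ a ^ n * b ^ n
  ^-distribʳ-* zero    a b = refl
  ^-distribʳ-* (suc n) a b rewrite ^-distribʳ-* n a b = lem a b (a ^ n) (b ^ n)
    where lem : ∀ a b p q → a * b * (p * q) ≡ a * p * (b * q)
          lem = solve-∀

  -- Bernoulli's inequality (1 - 1/g)^h ≥ 1 - h/g, with denominators cleared and g = y + 1.
  bernoulli : ∀ y h → suc y ^ suc h ≤ suc y * y ^ h + h * suc y ^ h
  bernoulli y zero    = ≤-reflexive (sym (+-identityʳ _))
  bernoulli y (suc h) = begin
    suc y * suc y ^ suc h ≡⟨ lem₁ y (suc y ^ h) ⟩
    y * suc y ^ suc h + suc y ^ suc h
      ≤⟨ +-monoˡ-≤ _ (*-monoʳ-≤ y (bernoulli y h)) ⟩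
    y * (suc y * y ^ h + h * suc y ^ h) + suc y ^ suc h
      ≤⟨ m≤m+n _ (h * suc y ^ h) ⟩
    y * (suc y * y ^ h + h * suc y ^ h) + suc y ^ suc h + h * suc y ^ h
      ≡⟨ lem₂ y h (y ^ h) (suc y ^ h) ⟩
    suc y * y ^ suc h + suc h * suc y ^ suc h ∎
    where
    open ≤-Reasoning
    lem₁ : ∀ y p → (1 + y) * ((1 + y) * p) ≡ y * ((1 + y) * p) + (1 + y) * p
    lem₁ = solve-∀
    lem₂ : ∀ y h p q → y * ((1 + y) * p + h * q) + (1 + y) * q + h * q ≡ (1 + y) * (y * p) + (1 + h) * ((1 + y) * q)
    lem₂ = solve-∀

  -- Bernoulli's inequality at h = g / 2 gives (1 - 1/g)^(g/2) ≥ 1/2; it is added to itself to avoid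
  -- the fraction.
  half-power : ∀ y h → suc y ≡ h + h → suc y ^ h ≤ 2 * y ^ h
  half-power y h eq = *-cancelˡ-≤ (suc y) (+-cancelʳ-≤ (suc y * p) _ _ (begin
      suc y * p + suc y * p                          ≤⟨ +-mono-≤ (bernoulli y h) (bernoulli y h) ⟩
      suc y * q + h * p + (suc y * q + h * p)        ≡⟨ lem (suc y) q h p ⟩
      suc y * (2 * q) + (h + h) * p                  ≡⟨ cong (λ z → suc y * (2 * q) + z * p) eq ⟨
      suc y * (2 * q) + suc y * p ∎))
    where
    open ≤-Reasoning
    p = suc y ^ h
    q = y ^ h
    lem : ∀ g q h p → g * q + h * p + (g * q + h * p) ≡ g * (2 * q) + (h + h) * p
    lem = solve-∀

  -- (g / (g - 1))^t ≤ 4^u for t ≤ u g.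
  power-ratio : ∀ y .{{_ : NonZero y}} h u t → suc y ≡ h + h → t ≤ u * suc y →
                suc y ^ t ≤ 2 ^ (2 * u) * y ^ t
  power-ratio y h u t eq le = *-cancelʳ-≤ _ _ (y ^ k) {{m^n≢0 y k}} (begin
    suc y ^ t * y ^ k             ≤⟨ *-monoʳ-≤ (suc y ^ t) (^-monoˡ-≤ k (n≤1+n y)) ⟩
    suc y ^ t * suc y ^ k         ≡⟨ ^-distribˡ-+-* (suc y) t k ⟨
    suc y ^ (t + k)               ≡⟨ cong (suc y ^_) tk ⟩
    suc y ^ (h * (2 * u))         ≡⟨ ^-*-assoc (suc y) h (2 * u) ⟨
    (suc y ^ h) ^ (2 * u)         ≤⟨ ^-monoˡ-≤ (2 * u) (half-power y h eq) ⟩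
    (2 * y ^ h) ^ (2 * u)         ≡⟨ ^-distribʳ-* (2 * u) 2 (y ^ h) ⟩
    2 ^ (2 * u) * (y ^ h) ^ (2 * u) ≡⟨ cong (2 ^ (2 * u) *_) (^-*-assoc y h (2 * u)) ⟩
    2 ^ (2 * u) * y ^ (h * (2 * u)) ≡⟨ cong (λ z → 2 ^ (2 * u) * y ^ z) tk ⟨
    2 ^ (2 * u) * y ^ (t + k)     ≡⟨ cong (2 ^ (2 * u) *_) (^-distribˡ-+-* y t k) ⟩
    2 ^ (2 * u) * (y ^ t * y ^ k) ≡⟨ *-assoc (2 ^ (2 * u)) _ _ ⟨
    2 ^ (2 * u) * y ^ t * y ^ k   ∎)
    where
    open ≤-Reasoning
    k = u * suc y ∸ t
    tk : t + k ≡ h * (2 * u)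
    tk = ≡-trans (m+[n∸m]≡n le) (≡-trans (cong (u *_) eq) (lem u h))
      where lem : ∀ u h → u * (h + h) ≡ h * (2 * u)
            lem = solve-∀

  markov : (B : ℕ) (f : A → ℕ) (xs : List A) → count (λ x → B ≤ᵇ f x) xs * B ≤ Σ[ xs ] f
  markov B f []       = z≤n
  markov B f (x ∷ xs) with B ≤ᵇ f x in eq
  ... | true  = +-mono-≤ (≤ᵇ⇒≤ B (f x) (Equivalence.from T-≡ eq)) (markov B f xs)
  ... | false = ≤-trans (markov B f xs) (m≤n+m _ (f x))

  ≤ᵇ-true : ∀ {m n} → (m ≤ᵇ n) ≡ true → m ≤ n
  ≤ᵇ-true {m} {n} eq = ≤ᵇ⇒≤ m n (Equivalence.from T-≡ eq)

  ≤ᵇ-false : ∀ {m n} → (m ≤ᵇ n) ≡ false → n < m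
  ≤ᵇ-false {m} {n} eq = ≰⇒> λ le → subst T eq (≤⇒≤ᵇ le)

  not-false : ∀ {b} → b ≢ true → b ≡ false
  not-false {true}  h = ⊥-elim (h refl)
  not-false {false} h = refl

  not-true⁻ : ∀ {b} → not b ≡ true → b ≡ false
  not-true⁻ {false} _ = refl

  -- Clearing a sparse bipartite relation

  module Pattern (f : A → ℕ → Bool) where

    -- With g = y + 1, `large` says that P keeps a share (1 - 1/g)^|T| / g^lost of `P₀`. Every
    -- discarded member of T is related to all of P, whence `lost≤`: the degree of any single vertex
    -- of P bounds the number of discarded members.
    record Split (y : ℕ) (T : List A) (P₀ : List ℕ) : Set where
      field
        P        : List ℕ
        T′       : List A
        lost     : ℕ
        P⊆       : P ⊆ P₀
        T′⊆      : T′ ⊆ T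
        clear    : ∀ {τ z} → τ ∈ T′ → z ∈ P → f τ z ≡ false
        balance  : length T ≡ length T′ + lost
        lost≤    : ∀ {z} → z ∈ P → lost ≤ count (λ τ → f τ z) T
        P≢[]     : 1 ≤ length P
        large    : length P₀ * y ^ length T ≤ length P * suc y ^ (length T + lost)

    -- Each member of T splits P₀ in two; the f-part is chosen only if it has relative size above 1/(y + 1).
    split : ∀ y .{{_ : NonZero y}} (T : List A) (P₀ : List ℕ) → 1 ≤ length P₀ → Split y T P₀
    split y [] P₀ ne = record
      { P = P₀ ; T′ = [] ; lost = 0 ; P⊆ = ⊆-refl ; T′⊆ = [] ; clear = λ () ; balance = refl
      ; lost≤ = λ _ → z≤n ; P≢[] = ne ; large = ≤-refl }
    split y (τ ∷ T) P₀ ne with suc y * count (f τ) P₀ ≤? length P₀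
    ... | yes small = record
      { P = S.P ; T′ = τ ∷ S.T′ ; lost = S.lost
      ; P⊆ = ⊆-trans S.P⊆ (filterᵇ-⊆ _ P₀) ; T′⊆ = refl ∷ S.T′⊆
      ; clear = λ { (here refl) j → not-true⁻ (proj₂ (∈-filterᵇ⁻ (not ∘ f τ) {xs = P₀} (⊆-∈ S.P⊆ j))) ; (there i) j → S.clear i j }
      ; balance = cong suc S.balance
      ; lost≤ = λ {z} i → ≤-trans (S.lost≤ i) (subst (count (λ τ → f τ z) T ≤_) (sym (count-∷ (λ τ → f τ z) τ T)) (m≤n+m _ _))
      ; P≢[] = S.P≢[]
      ; large = begin
          length P₀ * (y * y ^ length T)                ≡⟨ lem₁ (length P₀) y (y ^ length T) ⟩
          y * length P₀ * y ^ length T                  ≤⟨ *-monoˡ-≤ (y ^ length T) keep ⟩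
          suc y * length P₁ * y ^ length T              ≡⟨ *-assoc (suc y) (length P₁) _ ⟩
          suc y * (length P₁ * y ^ length T)            ≤⟨ *-monoʳ-≤ (suc y) S.large ⟩
          suc y * (length S.P * suc y ^ (length T + S.lost)) ≡⟨ lem₂ (suc y) (length S.P) _ ⟩
          length S.P * (suc y * suc y ^ (length T + S.lost)) ∎ }
      where
      open ≤-Reasoning
      P₁ = filterᵇ (not ∘ f τ) P₀
      lem₁ : ∀ a b c → a * (b * c) ≡ b * a * c
      lem₁ = solve-∀
      lem₂ : ∀ a b c → a * (b * c) ≡ b * (a * c)
      lem₂ = solve-∀
      keep : y * length P₀ ≤ suc y * length P₁
      keep = +-cancelˡ-≤ (length P₀) _ _ (begin
        suc y * length P₀                                ≡⟨ cong (suc y *_) (count-not (f τ) P₀) ⟨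
        suc y * (count (f τ) P₀ + length P₁)             ≡⟨ *-distribˡ-+ (suc y) (count (f τ) P₀) _ ⟩
        suc y * count (f τ) P₀ + suc y * length P₁       ≤⟨ +-monoˡ-≤ _ small ⟩
        length P₀ + suc y * length P₁ ∎)
      ne₁ : 1 ≤ length P₁
      ne₁ = n≢0⇒n>0 λ eq → <⇒≱ (*-mono-≤ (>-nonZero⁻¹ y) ne)
        (≤-trans keep (≤-reflexive (≡-trans (cong (suc y *_) eq) (*-zeroʳ (suc y)))))
      module S = Split (split y T P₁ ne₁)
    ... | no big = record
      { P = S.P ; T′ = S.T′ ; lost = suc S.lost
      ; P⊆ = ⊆-trans S.P⊆ (filterᵇ-⊆ _ P₀) ; T′⊆ = τ ∷ʳ S.T′⊆
      ; clear = S.clear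
      ; balance = ≡-trans (cong suc S.balance) (sym (+-suc (length S.T′) S.lost))
      ; lost≤ = λ {z} i → subst (suc S.lost ≤_) (sym (count-∷ (λ τ → f τ z) τ T))
          (+-mono-≤ (≤-reflexive (sym (cong bit (proj₂ (∈-filterᵇ⁻ (f τ) {xs = P₀} (⊆-∈ S.P⊆ i)))))) (S.lost≤ i))
      ; P≢[] = S.P≢[]
      ; large = begin
          length P₀ * (y * y ^ length T)                ≤⟨ *-mono-≤ (<⇒≤ (≰⇒> big)) (*-monoˡ-≤ (y ^ length T) (n≤1+n y)) ⟩
          suc y * length P₁ * (suc y * y ^ length T)    ≡⟨ lem₁ (suc y) (length P₁) (y ^ length T) ⟩
          suc y * suc y * (length P₁ * y ^ length T)    ≤⟨ *-monoʳ-≤ (suc y * suc y) S.large ⟩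
          suc y * suc y * (length S.P * suc y ^ (length T + S.lost)) ≡⟨ lem₂ (suc y) (length S.P) _ ⟩
          length S.P * (suc y * (suc y * suc y ^ (length T + S.lost))) ≡⟨ cong (λ z → length S.P * (suc y * suc y ^ z)) (+-suc (length T) S.lost) ⟨
          length S.P * (suc y * suc y ^ (length T + suc S.lost)) ∎ }
      where
      open ≤-Reasoning
      P₁ = filterᵇ (f τ) P₀
      lem₁ : ∀ a b c → a * b * (a * c) ≡ a * a * (b * c)
      lem₁ = solve-∀
      lem₂ : ∀ a b c → a * a * (b * c) ≡ b * (a * (a * c))
      lem₂ = solve-∀
      ne₁ : 1 ≤ length P₁
      ne₁ = n≢0⇒n>0 λ eq → big (≤-trans (≤-reflexive (≡-trans (cong (suc y *_) eq) (*-zeroʳ (suc y)))) z≤n)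
      module S = Split (split y T P₁ ne₁)

    record Cleared (γ u : ℕ) (T : List A) (Y : List ℕ) : Set where
      field
        P       : List ℕ
        T′      : List A
        P⊆      : P ⊆ Y
        T′⊆     : T′ ⊆ T
        clear   : ∀ {τ z} → τ ∈ T′ → z ∈ P → f τ z ≡ false
        few     : 2 ^ γ * length T ≤ 2 ^ γ * length T′ + 2 * length T
        large   : length Y ≤ 2 ^ (1 + 2 * u + 2 * u * γ) * length P

    clean : ∀ γ u (T : List A) (Y : List ℕ) → 1 ≤ γ → 1 ≤ length Y →
            (∀ {τ} → τ ∈ T → 2 ^ γ * count (f τ) Y ≤ length Y) → length T ≤ u * 2 ^ γ → Cleared γ u T Y
    clean (suc γ₁) u T Y _ ne sparse T≤ = record
      { P = S.P ; T′ = S.T′ ; P⊆ = ⊆-trans S.P⊆ (filterᵇ-⊆ _ Y) ; T′⊆ = S.T′⊆ ; clear = S.clear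
      ; few = begin
          g * length T                      ≡⟨ cong (g *_) S.balance ⟩
          g * (length S.T′ + S.lost)        ≡⟨ *-distribˡ-+ g (length S.T′) S.lost ⟩
          g * length S.T′ + g * S.lost      ≤⟨ +-monoʳ-≤ (g * length S.T′) lost₁ ⟩
          g * length S.T′ + 2 * length T    ∎
      ; large = *-cancelʳ-≤ _ _ (y ^ t) {{m^n≢0 y t}} (begin
          length Y * y ^ t                        ≤⟨ *-monoˡ-≤ (y ^ t) half ⟩
          2 * length Y₀ * y ^ t                   ≡⟨ *-assoc 2 (length Y₀) _ ⟩
          2 * (length Y₀ * y ^ t)                 ≤⟨ *-monoʳ-≤ 2 S.large ⟩
          2 * (length S.P * suc y ^ (t + S.lost)) ≡⟨ cong (λ z → 2 * (length S.P * z)) (^-distribˡ-+-* (suc y) t S.lost) ⟩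
          2 * (length S.P * (suc y ^ t * suc y ^ S.lost))
            ≤⟨ *-monoʳ-≤ 2 (*-monoʳ-≤ (length S.P) (*-mono-≤ (power-ratio y h u t yh (subst (λ z → t ≤ u * z) gy T≤)) lost₂)) ⟩
          2 * (length S.P * (2 ^ (2 * u) * y ^ t * 2 ^ (2 * u * γ)))
            ≡⟨ lem (length S.P) (2 ^ (2 * u)) (y ^ t) (2 ^ (2 * u * γ)) ⟩
          2 * (2 ^ (2 * u) * 2 ^ (2 * u * γ)) * length S.P * y ^ t
            ≡⟨ cong (λ z → 2 * z * length S.P * y ^ t) (^-distribˡ-+-* 2 (2 * u) (2 * u * γ)) ⟨
          2 ^ (1 + 2 * u + 2 * u * γ) * length S.P * y ^ t ∎) }
      where
      open ≤-Reasoning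
      γ = suc γ₁
      g = 2 ^ γ
      h = 2 ^ γ₁
      t = length T
      g≡ : g ≡ h + h
      g≡ = cong (h +_) (+-identityʳ h)
      y = pred g
      instance
        g≢0 : NonZero g
        g≢0 = m^n≢0 2 γ
      gy : g ≡ suc y
      gy = sym (suc-pred g)
      yh : suc y ≡ h + h
      yh = ≡-trans (sym gy) g≡
      instance
        y≢0 : NonZero y
        y≢0 = >-nonZero (s≤s⁻¹ (subst (2 ≤_) gy (subst (2 ≤_) (sym g≡) (+-mono-≤ (m^n>0 2 γ₁) (m^n>0 2 γ₁)))))
      w : ℕ → ℕ
      w z = g * count (λ τ → f τ z) T
      -- Markov's inequality: at most half of Y has more than twice the average degree that sparsity
      -- allows. The `suc` makes the count of bad vertices vanish when T is empty.
      Y₀ = filterᵇ (λ z → not (suc (2 * t) ≤ᵇ w z)) Y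
      bad = count (λ z → suc (2 * t) ≤ᵇ w z) Y
      total : Σ[ Y ] w ≤ t * length Y
      total = begin
        Σ[ Y ] w                                  ≡⟨ Σ-* g Y _ ⟩
        g * Σ[ Y ] (λ z → count (λ τ → f τ z) T)  ≡⟨ cong (g *_) (double-count f T Y) ⟨
        g * Σ[ T ] (λ τ → count (f τ) Y)          ≡⟨ Σ-* g T _ ⟨
        Σ[ T ] (λ τ → g * count (f τ) Y)          ≤⟨ Σ-mono T sparse ⟩
        Σ[ T ] (λ _ → length Y)                   ≡⟨ Σ-const (length Y) T ⟩
        t * length Y                              ∎
      bad₁ : ∀ t → bad * suc (2 * t) ≤ t * length Y → bad + bad ≤ length Y
      bad₁ zero    le rewrite *-identityʳ bad | n≤0⇒n≡0 le = z≤n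
      bad₁ (suc t) le = *-cancelˡ-≤ (suc t) (≤-trans (≤-trans (≤-reflexive (lem′ bad t)) (*-monoʳ-≤ bad (n≤1+n _))) le)
        where lem′ : ∀ b t → (1 + t) * (b + b) ≡ b * (2 * (1 + t))
              lem′ = solve-∀
      bad₂ : bad + bad ≤ length Y
      bad₂ = bad₁ t (≤-trans (markov (suc (2 * t)) w Y) total)
      half : length Y ≤ 2 * length Y₀
      half = +-cancelˡ-≤ (bad + bad) _ _ (begin
        bad + bad + length Y          ≤⟨ +-monoˡ-≤ (length Y) bad₂ ⟩
        length Y + length Y           ≡⟨ cong₂ _+_ cn cn ⟨
        bad + length Y₀ + (bad + length Y₀) ≡⟨ lem″ bad (length Y₀) ⟩
        bad + bad + 2 * length Y₀ ∎)
        where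
        cn = count-not (λ z → suc (2 * t) ≤ᵇ w z) Y
        lem″ : ∀ a b → a + b + (a + b) ≡ a + a + 2 * b
        lem″ = solve-∀
      ne₀ : 1 ≤ length Y₀
      ne₀ = n≢0⇒n>0 λ eq → <⇒≱ ne (≤-trans half (≤-reflexive (cong (2 *_) eq)))
      module S = Split (split y T Y₀ ne₀)
      lost₁ : g * S.lost ≤ 2 * t
      lost₁ = ≤-trans (*-monoʳ-≤ g (S.lost≤ (proj₂ witness)))
        (s≤s⁻¹ (≤ᵇ-false {suc (2 * t)} {w (proj₁ witness)}
          (not-true⁻ (proj₂ (∈-filterᵇ⁻ (λ z → not (suc (2 * t) ≤ᵇ w z)) {xs = Y} (⊆-∈ S.P⊆ (proj₂ witness)))))))
        where witness = nonempty S.P S.P≢[]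
      lost₃ : S.lost ≤ 2 * u
      lost₃ = *-cancelˡ-≤ g (≤-trans lost₁ (≤-trans (*-monoʳ-≤ 2 T≤) (≤-reflexive (lem‴ u g))))
        where lem‴ : ∀ u g → 2 * (u * g) ≡ g * (2 * u)
              lem‴ = solve-∀
      lost₂ : suc y ^ S.lost ≤ 2 ^ (2 * u * γ)
      lost₂ = begin
        suc y ^ S.lost     ≡⟨ cong (_^ S.lost) gy ⟨
        g ^ S.lost         ≤⟨ ^-monoʳ-≤ g lost₃ ⟩
        g ^ (2 * u)        ≡⟨ ^-*-assoc 2 γ (2 * u) ⟩
        2 ^ (γ * (2 * u))  ≡⟨ cong (2 ^_) (*-comm γ (2 * u)) ⟩
        2 ^ (2 * u * γ)    ∎
      lem : ∀ p a b c → 2 * (p * (a * b * c)) ≡ 2 * (a * c) * p * b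
      lem = solve-∀

  if-true : ∀ {A : Set} {b} {x y : A} → b ≡ true → (if b then x else y) ≡ x
  if-true refl = refl

  if-false : ∀ {A : Set} {b} {x y : A} → b ≡ false → (if b then x else y) ≡ y
  if-false refl = refl

  ≡ᵇ-refl : ∀ v → (v ≡ᵇ v) ≡ true
  ≡ᵇ-refl v = Equivalence.to T-≡ (≡⇒≡ᵇ v v refl)

  ≢⇒≡ᵇ : ∀ {v w} → v ≢ w → (v ≡ᵇ w) ≡ false
  ≢⇒≡ᵇ {v} {w} ne = not-false λ eq → ne (≡ᵇ⇒≡ v w (Equivalence.from T-≡ eq))

  count-≡ᵇ : ∀ k {xs} → AllPairs _<_ xs → count (k ≡ᵇ_) xs ≤ 1
  count-≡ᵇ k [] = z≤n
  count-≡ᵇ k {x ∷ xs} (p ∷ ps) rewrite count-∷ (k ≡ᵇ_) x xs with k ≡ᵇ x in eq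
  ... | false = count-≡ᵇ k ps
  ... | true  = s≤s (≤-reflexive (count-none (k ≡ᵇ_) xs λ {y} i → ≢⇒≡ᵇ λ k≡y →
    <-irrefl (≡-trans (sym (≡ᵇ⇒≡ k x (Equivalence.from T-≡ eq))) k≡y) (All.lookup p i)))

  ∧-true : ∀ {a b} → a ∧ b ≡ true → a ≡ true × b ≡ true
  ∧-true {true} {true} _ = refl , refl

  <ᵇ-true⁻ : ∀ {m n} → (m <ᵇ n) ≡ true → m < n
  <ᵇ-true⁻ {m} {n} eq = <ᵇ⇒< m n (Equivalence.from T-≡ eq)

  <ᵇ-true⁺ : ∀ {m n} → m < n → (m <ᵇ n) ≡ true
  <ᵇ-true⁺ lt = Equivalence.to T-≡ (<⇒<ᵇ lt)

  ⊆-++ʳ : ∀ {A : Set} (xs ys : List A) → xs ⊆ xs ++ ys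
  ⊆-++ʳ xs ys = ⊆-++⁺ʳ ys ⊆-refl

  ⊆-++ˡ : ∀ {A : Set} (xs ys : List A) → ys ⊆ xs ++ ys
  ⊆-++ˡ xs ys = ⊆-++⁺ˡ xs ⊆-refl

  -- Counts the neighbourhoods to be tested when a clique member is chosen. In `shortSublists-count`
  -- with y + 1 = 2 ^ γ, the factor (1 + 1/y)^|T| is at most 4^u and the other one is 2 ^ (γ * d).
  shortSublists-bound : ∀ γ₁ u d (T : List ℕ) → length T ≤ u * 2 ^ suc γ₁ → length (shortSublists d T) ≤ 2 ^ (2 * u + suc γ₁ * d)
  shortSublists-bound γ₁ u d T T≤ = *-cancelʳ-≤ _ _ (y ^ t) {{m^n≢0 y t}} (begin
    length (shortSublists d T) * y ^ t                   ≤⟨ shortSublists-count y d T ⟩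
    suc y ^ (t + d)                             ≡⟨ ^-distribˡ-+-* (suc y) t d ⟩
    suc y ^ t * suc y ^ d                       ≤⟨ *-monoˡ-≤ (suc y ^ d) (power-ratio y h u t yh (subst (λ z → t ≤ u * z) gy T≤)) ⟩
    2 ^ (2 * u) * y ^ t * suc y ^ d             ≡⟨ cong (λ z → 2 ^ (2 * u) * y ^ t * z ^ d) gy ⟨
    2 ^ (2 * u) * y ^ t * (2 ^ suc γ₁) ^ d      ≡⟨ cong (2 ^ (2 * u) * y ^ t *_) (^-*-assoc 2 (suc γ₁) d) ⟩
    2 ^ (2 * u) * y ^ t * 2 ^ (suc γ₁ * d)      ≡⟨ lem (2 ^ (2 * u)) (y ^ t) (2 ^ (suc γ₁ * d)) ⟩
    2 ^ (2 * u) * 2 ^ (suc γ₁ * d) * y ^ t      ≡⟨ cong (_* y ^ t) (^-distribˡ-+-* 2 (2 * u) (suc γ₁ * d)) ⟨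
    2 ^ (2 * u + suc γ₁ * d) * y ^ t            ∎)
    where
    open ≤-Reasoning
    t = length T
    h = 2 ^ γ₁
    g = 2 ^ suc γ₁
    y = pred g
    instance
      g≢0 : NonZero g
      g≢0 = m^n≢0 2 (suc γ₁)
    gy : g ≡ suc y
    gy = sym (suc-pred g)
    g≡ : g ≡ h + h
    g≡ = cong (h +_) (+-identityʳ h)
    yh : suc y ≡ h + h
    yh = ≡-trans (sym gy) g≡
    instance
      y≢0 : NonZero y
      y≢0 = >-nonZero (s≤s⁻¹ (subst (2 ≤_) gy (subst (2 ≤_) (sym g≡) (+-mono-≤ (m^n>0 2 γ₁) (m^n>0 2 γ₁)))))
    lem : ∀ a b c → a * b * c ≡ a * c * b
    lem = solve-∀

  -- Costs in bits and the choice of parameters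

  -- The summand `2 * ν + 1` pays for cutting a set into the parts of the first slots. The bracket
  -- is the size of one part: room for all tests, and `3 * (γ′ * δ)` for choosing a clique and
  -- embedding vertices of small degree. Each of the γ doublings pays K for a sparse pair and the
  -- rest for `clean`. Note that γ′ enters only through `γ′ * δ`.
  ampCost : (ν a δ γ′ K : ℕ) → ℕ
  ampCost ν a δ γ′ K = 2 * ν + 1 + (γ + 2 * ν + 2 * δ + γ * δ + 2 + 3 * (γ′ * δ)) + γ * (K + (1 + 2 * δ + 2 * δ * γ))
    where γ = 2 + 2 * a

  -- After γ doublings a share of at most γ / 2 ^ γ of the slots has been dropped; this makes it at
  -- most one half.
  twice-≤-power : ∀ a → 2 * (2 + 2 * a) ≤ 2 ^ (2 + 2 * a)
  twice-≤-power zero    = ≤-refl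
  twice-≤-power (suc a) = begin
    2 * (2 + 2 * suc a)             ≡⟨ lem a ⟩
    2 * (2 + 2 * a) + 4             ≤⟨ +-mono-≤ (twice-≤-power a) (^-monoʳ-≤ 2 {2} {2 + 2 * a} (m≤m+n 2 _)) ⟩
    2 ^ (2 + 2 * a) + 2 ^ (2 + 2 * a) ≤⟨ m≤m+n _ (2 ^ (2 + 2 * a) + 2 ^ (2 + 2 * a)) ⟩
    2 ^ (2 + 2 * a) + 2 ^ (2 + 2 * a) + (2 ^ (2 + 2 * a) + 2 ^ (2 + 2 * a)) ≡⟨ lem₂ (2 ^ (2 + 2 * a)) ⟩
    2 ^ (2 + (2 + 2 * a))           ≡⟨ cong (2 ^_) (lem₃ a) ⟩
    2 ^ (2 + 2 * suc a)             ∎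
    where
    open ≤-Reasoning
    lem : ∀ a → 2 * (2 + 2 * (1 + a)) ≡ 2 * (2 + 2 * a) + 4
    lem = solve-∀
    lem₂ : ∀ x → x + x + (x + x) ≡ 2 * (2 * x)
    lem₂ = solve-∀
    lem₃ : ∀ a → 2 + (2 + 2 * a) ≡ 2 + 2 * (1 + a)
    lem₃ = solve-∀

  ampCost-split : ∀ ν a δ γ′ K → let γ = 2 + 2 * a in
    ampCost ν a δ γ′ K ≡ 4 * ν + 3 + 2 * γ + 2 * δ + 3 * (γ * δ) + 3 * (γ′ * δ) + γ * K + 2 * (γ * (γ * δ))
  ampCost-split ν a δ γ′ K = lem ν (2 + 2 * a) δ (γ′ * δ) K
    where
    lem : ∀ ν γ δ x K → 2 * ν + 1 + (γ + 2 * ν + 2 * δ + γ * δ + 2 + 3 * x) + γ * (K + (1 + 2 * δ + 2 * δ * γ)) ≡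
                        4 * ν + 3 + 2 * γ + 2 * δ + 3 * (γ * δ) + 3 * x + γ * K + 2 * (γ * (γ * δ))
    lem = solve-∀

  -- This is (β + 1)² ≤ 2 ^ β for β ≥ 6. It fails at β = 5, which is the origin of the threshold
  -- between large and small m.
  square-≤-power : ∀ k → (7 + k) * (7 + k) ≤ 2 ^ (6 + k)
  square-≤-power zero    = ≤ᵇ⇒≤ 49 64 _
  square-≤-power (suc k) = begin
    (7 + suc k) * (7 + suc k)                     ≤⟨ m≤m+n _ (k * k + 12 * k + 34) ⟩
    (7 + suc k) * (7 + suc k) + (k * k + 12 * k + 34) ≡⟨ lem k ⟩
    2 * ((7 + k) * (7 + k))                       ≤⟨ *-monoʳ-≤ 2 (square-≤-power k) ⟩
    2 ^ (6 + suc k)                               ∎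
    where
    open ≤-Reasoning
    lem : ∀ k → (7 + (1 + k)) * (7 + (1 + k)) + (k * k + 12 * k + 34) ≡ 2 * ((7 + k) * (7 + k))
    lem = solve-∀

  module Numbers (α τ ρ : ℕ) (α≥3 : 3 ≤ α) (β≥6 : 6 ≤ α + τ) (β≤ : α + τ ≤ 2 ^ α) (ρ≥1 : 1 ≤ ρ) where

    -- In use m < 2 ^ λ′ with β least, 2 ^ α lies between β and 2β, and r is √(2m) rounded up to a
    -- multiple of λ′². Then `δA`, `δB`, `r₂` and `ρ` are the exact quotients of r by 2 ^ α, 2 ^ β,
    -- 4 ^ α and 4 ^ β. The sparsity exponents are γA (order log L), γB (order L) and `suc ν` (order
    -- log m). KB, K₂ and K₃ are the losses per halving with two, one and no amplifications, and E
    -- adds up all halvings.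
    β λ′ ν δB δA r r₂ γA γB K₀ KA KB K₂ K₃ E : ℕ
    β  = α + τ
    λ′ = 2 ^ β
    ν  = λ′ + 1
    δB = λ′ * ρ
    r  = λ′ * δB
    δA = 2 ^ τ * δB
    r₂ = 2 ^ τ * (2 ^ τ * ρ)
    γA = 2 + 2 * α
    γB = 2 + 2 * β
    K₀ = 2 * ν + γA * r
    KA = ampCost ν α δA γB K₀
    KB = ampCost ν β δB (suc ν) KA
    K₂ = ampCost ν β δB (suc ν) (2 * ν + γB * r₂)
    K₃ = 2 * ν + suc ν * ρ
    E  = 8 * α * suc KB + (8 * β * suc K₂ + ((2 * λ′ + 2) * suc K₃ + ν))

    open ≤-Reasoning

    λ≡ : λ′ ≡ 2 ^ α * 2 ^ τ
    λ≡ = ^-distribˡ-+-* 2 α τ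

    r≡δA : 2 ^ α * δA ≡ r
    r≡δA = ≡-trans (sym (*-assoc (2 ^ α) (2 ^ τ) δB)) (cong (_* δB) (sym λ≡))

    r≡r₂ : 2 ^ (2 * α) * r₂ ≡ r
    r≡r₂ = ≡-trans (cong (λ z → 2 ^ (α + z) * r₂) (+-identityʳ α)) (≡-trans (cong (_* r₂) (^-distribˡ-+-* 2 α α))
      (≡-trans (lem (2 ^ α) (2 ^ τ) ρ) (cong (λ z → z * (z * ρ)) (sym λ≡))))
      where lem : ∀ a t ρ → a * a * (t * (t * ρ)) ≡ a * t * (a * t * ρ)
            lem = solve-∀

    r≡ρ : 2 ^ (2 * β) * ρ ≡ r
    r≡ρ = ≡-trans (cong (λ z → 2 ^ (β + z) * ρ) (+-identityʳ β)) (≡-trans (cong (_* ρ) (^-distribˡ-+-* 2 β β)) (*-assoc λ′ λ′ ρ))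

    δB≥1 : 1 ≤ δB
    δB≥1 = *-mono-≤ (m^n>0 2 β) ρ≥1

    δA≥1 : 1 ≤ δA
    δA≥1 = *-mono-≤ (m^n>0 2 τ) δB≥1

    r₂≥1 : 1 ≤ r₂
    r₂≥1 = *-mono-≤ (m^n>0 2 τ) (*-mono-≤ (m^n>0 2 τ) ρ≥1)

    r≥1 : 1 ≤ r
    r≥1 = *-mono-≤ (m^n>0 2 β) δB≥1

    sq : suc β * suc β ≤ λ′
    sq = subst (λ b → suc b * suc b ≤ 2 ^ b) (m+[n∸m]≡n β≥6) (square-≤-power (β ∸ 6))

    2≤sβ : 2 ≤ suc β
    2≤sβ = ≤-trans (≤ᵇ⇒≤ 2 6 _) (≤-trans β≥6 (n≤1+n β))

    γB≤λ : γB ≤ λ′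
    γB≤λ = begin
      2 + 2 * β       ≡⟨ lem β ⟩
      2 * suc β       ≤⟨ *-monoˡ-≤ (suc β) 2≤sβ ⟩
      suc β * suc β   ≤⟨ sq ⟩
      λ′ ∎
      where lem : ∀ b → 2 + 2 * b ≡ 2 * (1 + b)
            lem = solve-∀

    γB²≤ : γB * γB ≤ 4 * λ′
    γB²≤ = ≤-trans (≤-reflexive (lem β)) (*-monoʳ-≤ 4 sq)
      where lem : ∀ b → (2 + 2 * b) * (2 + 2 * b) ≡ 4 * ((1 + b) * (1 + b))
            lem = solve-∀

    γA≤ : γA ≤ 3 * α
    γA≤ = ≤-trans (+-monoˡ-≤ (2 * α) (≤-trans (n≤1+n 2) α≥3)) (≤-reflexive (lem α))
      where lem : ∀ a → a + 2 * a ≡ 3 * a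
            lem = solve-∀

    γB≤ : γB ≤ 3 * β
    γB≤ = ≤-trans (+-monoˡ-≤ (2 * β) (≤-trans (≤ᵇ⇒≤ 2 6 _) β≥6)) (≤-reflexive (lem β))
      where lem : ∀ a → a + 2 * a ≡ 3 * a
            lem = solve-∀

    λ≥1 : 1 ≤ λ′
    λ≥1 = m^n>0 2 β

    λ≥4 : 4 ≤ λ′
    λ≥4 = ≤-trans (*-mono-≤ 2≤sβ 2≤sβ) sq

    λ≤δB : λ′ ≤ δB
    λ≤δB = m≤m*n λ′ ρ {{>-nonZero ρ≥1}}

    δB≤r : δB ≤ r
    δB≤r = m≤n*m δB λ′ {{>-nonZero λ≥1}}

    δA≤r : δA ≤ r
    δA≤r = ≤-trans (m≤n*m δA (2 ^ α) {{>-nonZero (m^n>0 2 α)}}) (≤-reflexive r≡δA)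

    λ²≤r : λ′ * λ′ ≤ r
    λ²≤r = *-monoʳ-≤ λ′ λ≤δB

    ν≤2λ : ν ≤ 2 * λ′
    ν≤2λ = ≤-trans (+-monoʳ-≤ λ′ λ≥1) (≤-reflexive (cong (λ′ +_) (sym (+-identityʳ λ′))))

    ν≤r : ν ≤ r
    ν≤r = ≤-trans ν≤2λ (≤-trans (*-monoˡ-≤ λ′ (≤-trans (≤ᵇ⇒≤ 2 4 _) λ≥4)) λ²≤r)

    γB≤r : γB ≤ r
    γB≤r = ≤-trans γB≤λ (≤-trans λ≤δB δB≤r)

    ×r : ∀ k → k ≤ k * r
    ×r k = m≤m*n k r {{>-nonZero r≥1}}

    -- Quadratic in γA, because each of the γA doublings repeats the greedy loss `γA * r`. Aiming at
    -- γB adds only O(r): by `β≤`, `β * δA` is at most `2 ^ α * δA`, which is r.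
    KA≤ : KA ≤ 37 * (α * α) * r
    KA≤ = begin
      KA ≡⟨ ampCost-split ν α δA γB K₀ ⟩
      4 * ν + 3 + 2 * g + 2 * δA + 3 * (g * δA) + 3 * (γB * δA) + g * K₀ + 2 * (g * (g * δA))
        ≤⟨ +-mono-≤ (+-mono-≤ (+-mono-≤ (+-mono-≤ (+-mono-≤ (+-mono-≤ (+-mono-≤ (*-monoʳ-≤ 4 ν≤r) (×r 3)) (*-monoʳ-≤ 2 (×r g))) (*-monoʳ-≤ 2 δA≤r))
             (*-monoʳ-≤ 3 (*-monoʳ-≤ g δA≤r))) (*-monoʳ-≤ 3 γBδA)) (*-monoʳ-≤ g (+-monoˡ-≤ (g * r) (*-monoʳ-≤ 2 ν≤r)))) (*-monoʳ-≤ 2 (*-monoʳ-≤ g (*-monoʳ-≤ g δA≤r))) ⟩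
      4 * r + 3 * r + 2 * (g * r) + 2 * r + 3 * (g * r) + 3 * (4 * r) + g * (2 * r + g * r) + 2 * (g * (g * r))
        ≡⟨ lem₁ g r ⟩
      (21 + 7 * g + 3 * (g * g)) * r
        ≤⟨ *-monoˡ-≤ r (+-mono-≤ (+-monoʳ-≤ 21 (*-monoʳ-≤ 7 γA≤)) (*-monoʳ-≤ 3 (*-mono-≤ γA≤ γA≤))) ⟩
      (21 + 7 * (3 * α) + 3 * (3 * α * (3 * α))) * r
        ≤⟨ *-monoˡ-≤ r small ⟩
      37 * (α * α) * r ∎
      where
      g = γA
      lem₁ : ∀ g r → 4 * r + 3 * r + 2 * (g * r) + 2 * r + 3 * (g * r) + 3 * (4 * r) + g * (2 * r + g * r) + 2 * (g * (g * r)) ≡ (21 + 7 * g + 3 * (g * g)) * r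
      lem₁ = solve-∀
      small : 21 + 7 * (3 * α) + 3 * (3 * α * (3 * α)) ≤ 37 * (α * α)
      small = begin
        21 + 7 * (3 * α) + 3 * (3 * α * (3 * α))  ≡⟨ lem₂ α ⟩
        7 * 3 + 7 * (3 * α) + 27 * (α * α)        ≤⟨ +-monoˡ-≤ (27 * (α * α)) (+-mono-≤ (*-monoʳ-≤ 7 α≥3) (*-monoʳ-≤ 7 (*-monoˡ-≤ α α≥3))) ⟩
        7 * α + 7 * (α * α) + 27 * (α * α)        ≤⟨ +-monoˡ-≤ (27 * (α * α)) (+-monoˡ-≤ (7 * (α * α)) 7α≤) ⟩
        3 * (α * α) + 7 * (α * α) + 27 * (α * α)  ≡⟨ lem₃ (α * α) ⟩
        37 * (α * α)                              ∎
        where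
        lem₂ : ∀ a → 21 + 7 * (3 * a) + 3 * (3 * a * (3 * a)) ≡ 7 * 3 + 7 * (3 * a) + 27 * (a * a)
        lem₂ = solve-∀
        lem₃ : ∀ x → 3 * x + 7 * x + 27 * x ≡ 37 * x
        lem₃ = solve-∀
        7α≤ : 7 * α ≤ 3 * (α * α)
        7α≤ = ≤-trans (*-monoˡ-≤ α (≤-trans (≤ᵇ⇒≤ 7 9 _) (*-monoʳ-≤ 3 α≥3))) (≤-reflexive (*-assoc 3 α α))
      γBδA : γB * δA ≤ 4 * r
      γBδA = begin
        (2 + 2 * β) * δA       ≡⟨ lem₄ β δA ⟩
        2 * δA + 2 * (β * δA)  ≤⟨ +-mono-≤ (*-monoʳ-≤ 2 δA≤r) (*-monoʳ-≤ 2 (≤-trans (*-monoˡ-≤ δA β≤) (≤-reflexive r≡δA))) ⟩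
        2 * r + 2 * r          ≡⟨ lem₅ r ⟩
        4 * r ∎
        where
        lem₄ : ∀ b d → (2 + 2 * b) * d ≡ 2 * d + 2 * (b * d)
        lem₄ = solve-∀
        lem₅ : ∀ r → 2 * r + 2 * r ≡ 4 * r
        lem₅ = solve-∀

    -- Both γB² and `suc ν` are O(λ′), and `λ′ * δB` is r. So everything except the loss K repeated
    -- in γB doublings is O(r).
    B-common : ∀ K → ampCost ν β δB (suc ν) K ≤ 31 * r + γB * K
    B-common K = begin
      ampCost ν β δB (suc ν) K ≡⟨ ampCost-split ν β δB (suc ν) K ⟩
      4 * ν + 3 + 2 * g + 2 * δB + 3 * (g * δB) + 3 * (suc ν * δB) + g * K + 2 * (g * (g * δB))
        ≤⟨ +-mono-≤ (+-monoˡ-≤ (g * K) (+-mono-≤ (+-mono-≤ (+-mono-≤ (+-mono-≤ (+-mono-≤ (*-monoʳ-≤ 4 ν≤r) (×r 3)) (*-monoʳ-≤ 2 γB≤r)) (*-monoʳ-≤ 2 δB≤r))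
             (*-monoʳ-≤ 3 (*-monoˡ-≤ δB γB≤λ))) (*-monoʳ-≤ 3 νδ))) (*-monoʳ-≤ 2 ggδ) ⟩
      4 * r + 3 * r + 2 * r + 2 * r + 3 * r + 3 * (3 * r) + g * K + 2 * (4 * r)
        ≡⟨ lem r (g * K) ⟩
      31 * r + g * K ∎
      where
      g = γB
      lem : ∀ r x → 4 * r + 3 * r + 2 * r + 2 * r + 3 * r + 3 * (3 * r) + x + 2 * (4 * r) ≡ 31 * r + x
      lem = solve-∀
      νδ : suc ν * δB ≤ 3 * r
      νδ = ≤-trans (*-monoˡ-≤ δB {suc ν} {3 * λ′} νs) (≤-reflexive (*-assoc 3 λ′ δB))
        where
        νs : suc ν ≤ 3 * λ′
        νs = ≤-trans (+-mono-≤ λ≥1 ν≤2λ) (≤-reflexive refl)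
      ggδ : g * (g * δB) ≤ 4 * r
      ggδ = ≤-trans (≤-reflexive (sym (*-assoc g g δB))) (≤-trans (*-monoˡ-≤ δB γB²≤) (≤-reflexive (*-assoc 4 λ′ δB)))

    α²≥9 : 9 ≤ α * α
    α²≥9 = *-mono-≤ α≥3 α≥3

    KB≤ : suc KB ≤ 113 * (β * (α * α)) * r
    KB≤ = begin
      suc KB                                        ≤⟨ s≤s (B-common KA) ⟩
      1 + (31 * r + γB * KA)                        ≤⟨ +-mono-≤ r≥1 (+-monoʳ-≤ (31 * r) (*-mono-≤ γB≤ KA≤)) ⟩
      r + (31 * r + 3 * β * (37 * (α * α) * r))     ≡⟨ lem r β (α * α) ⟩
      (32 + 111 * (β * (α * α))) * r                ≤⟨ *-monoˡ-≤ r (+-monoˡ-≤ (111 * (β * (α * α))) (≤-trans (≤ᵇ⇒≤ 32 (2 * (6 * 9)) _) (*-monoʳ-≤ 2 (*-mono-≤ β≥6 α²≥9)))) ⟩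
      (2 * (β * (α * α)) + 111 * (β * (α * α))) * r ≡⟨ cong (_* r) (lem₂ (β * (α * α))) ⟩
      113 * (β * (α * α)) * r                       ∎
      where
      lem : ∀ r b q → r + (31 * r + 3 * b * (37 * q * r)) ≡ (32 + 111 * (b * q)) * r
      lem = solve-∀
      lem₂ : ∀ x → 2 * x + 111 * x ≡ 113 * x
      lem₂ = solve-∀

    -- The greedy loss now involves `r₂`, and β² ≤ 4 ^ α compensates for the factor γB².
    K₂≤ : suc K₂ ≤ 45 * r
    K₂≤ = begin
      suc K₂                                        ≤⟨ s≤s (B-common (2 * ν + γB * r₂)) ⟩
      1 + (31 * r + γB * (2 * ν + γB * r₂))         ≡⟨ cong (λ z → 1 + (31 * r + z)) (lem₁ γB ν r₂) ⟩
      1 + (31 * r + (2 * (γB * ν) + γB * γB * r₂))  ≤⟨ +-mono-≤ r≥1 (+-monoʳ-≤ (31 * r) (+-mono-≤ (*-monoʳ-≤ 2 γν) γγr₂)) ⟩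
      r + (31 * r + (2 * (2 * r) + 9 * r))          ≡⟨ lem₂ r ⟩
      45 * r                                        ∎
      where
      lem₁ : ∀ g ν x → g * (2 * ν + g * x) ≡ 2 * (g * ν) + g * g * x
      lem₁ = solve-∀
      lem₂ : ∀ r → r + (31 * r + (2 * (2 * r) + 9 * r)) ≡ 45 * r
      lem₂ = solve-∀
      γν : γB * ν ≤ 2 * r
      γν = begin
        γB * ν            ≤⟨ *-mono-≤ γB≤λ ν≤2λ ⟩
        λ′ * (2 * λ′)     ≡⟨ lem λ′ ⟩
        2 * (λ′ * λ′)     ≤⟨ *-monoʳ-≤ 2 λ²≤r ⟩
        2 * r             ∎
        where lem : ∀ x → x * (2 * x) ≡ 2 * (x * x)
              lem = solve-∀
      γγr₂ : γB * γB * r₂ ≤ 9 * r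
      γγr₂ = begin
        γB * γB * r₂                       ≤⟨ *-monoˡ-≤ r₂ (*-mono-≤ γB≤ γB≤) ⟩
        3 * β * (3 * β) * r₂               ≤⟨ *-monoˡ-≤ r₂ (*-mono-≤ (*-monoʳ-≤ 3 β≤) (*-monoʳ-≤ 3 β≤)) ⟩
        3 * 2 ^ α * (3 * 2 ^ α) * r₂       ≡⟨ lem (2 ^ α) r₂ ⟩
        9 * (2 ^ α * 2 ^ α * r₂)           ≡⟨ cong (λ z → 9 * (z * r₂)) (^-distribˡ-+-* 2 α α) ⟨
        9 * (2 ^ (α + α) * r₂)             ≡⟨ cong (λ z → 9 * (2 ^ (α + z) * r₂)) (+-identityʳ α) ⟨
        9 * (2 ^ (2 * α) * r₂)             ≡⟨ cong (9 *_) r≡r₂ ⟩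
        9 * r                              ∎
        where lem : ∀ a x → 3 * a * (3 * a) * x ≡ 9 * (a * a * x)
              lem = solve-∀

    -- One halving costs O(`δB`), so about 2λ′ of them cost O(r).
    K₃≤ : (2 * λ′ + 2) * suc K₃ ≤ 15 * r
    K₃≤ = begin
      (2 * λ′ + 2) * suc K₃      ≤⟨ *-mono-≤ (+-monoʳ-≤ (2 * λ′) (≤-trans (≤ᵇ⇒≤ 2 4 _) λ≥4)) k ⟩
      (2 * λ′ + λ′) * (5 * δB)   ≡⟨ lem₁ λ′ δB ⟩
      15 * r                     ∎
      where
      lem₁ : ∀ l d → (2 * l + l) * (5 * d) ≡ 15 * (l * d)
      lem₁ = solve-∀
      k : suc (2 * ν + suc ν * ρ) ≤ 5 * δB
      k = begin
        suc (2 * (λ′ + 1) + suc (λ′ + 1) * ρ)       ≡⟨ lem₂ λ′ ρ ⟩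
        2 * λ′ + 3 + (λ′ * ρ + 2 * ρ)               ≤⟨ +-mono-≤ (+-mono-≤ (*-monoʳ-≤ 2 λ≤δB) (≤-trans (≤ᵇ⇒≤ 3 4 _) (≤-trans λ≥4 λ≤δB)))
                                                        (+-monoʳ-≤ δB (*-monoˡ-≤ ρ (≤-trans (≤ᵇ⇒≤ 2 4 _) λ≥4))) ⟩
        2 * δB + δB + (δB + δB)                     ≡⟨ lem₃ δB ⟩
        5 * δB                                      ∎
        where
        lem₂ : ∀ l ρ → 1 + (2 * (l + 1) + (1 + (l + 1)) * ρ) ≡ 2 * l + 3 + (l * ρ + 2 * ρ)
        lem₂ = solve-∀
        lem₃ : ∀ d → 2 * d + d + (d + d) ≡ 5 * d
        lem₃ = solve-∀

    -- The first phase dominates with 8 · 113 = 904. The second contributes 8 · 45 = 360, and the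
    -- remaining 16 r is absorbed into 36.
    E≤ : E ≤ β * (α * α * α) * r * 1300
    E≤ = begin
      8 * α * suc KB + (8 * β * suc K₂ + ((2 * λ′ + 2) * suc K₃ + ν))
        ≤⟨ +-mono-≤ (*-monoʳ-≤ (8 * α) KB≤) (+-mono-≤ (*-monoʳ-≤ (8 * β) K₂≤) (+-mono-≤ K₃≤ ν≤r)) ⟩
      8 * α * (113 * (β * (α * α)) * r) + (8 * β * (45 * r) + (15 * r + r))
        ≡⟨ lem₁ α β r ⟩
      (904 * (β * (α * α * α)) + (360 * (β * 1) + 16)) * r
        ≤⟨ *-monoˡ-≤ r (+-monoʳ-≤ (904 * (β * (α * α * α))) (+-mono-≤ (*-monoʳ-≤ 360 (*-monoʳ-≤ β 1≤α³))
             (≤-trans (≤ᵇ⇒≤ 16 (36 * (6 * 1)) _) (*-monoʳ-≤ 36 (*-mono-≤ β≥6 1≤α³))))) ⟩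
      (904 * (β * (α * α * α)) + (360 * (β * (α * α * α)) + 36 * (β * (α * α * α)))) * r
        ≡⟨ lem₂ (β * (α * α * α)) r ⟩
      β * (α * α * α) * r * 1300 ∎
      where
      1≤α : 1 ≤ α
      1≤α = ≤-trans (≤ᵇ⇒≤ 1 3 _) α≥3
      1≤α³ : 1 ≤ α * α * α
      1≤α³ = *-mono-≤ (*-mono-≤ 1≤α 1≤α) 1≤α
      lem₁ : ∀ a b r → 8 * a * (113 * (b * (a * a)) * r) + (8 * b * (45 * r) + (15 * r + r)) ≡ (904 * (b * (a * a * a)) + (360 * (b * 1) + 16)) * r
      lem₁ = solve-∀
      lem₂ : ∀ x r → (904 * x + (360 * x + 36 * x)) * r ≡ x * r * 1300
      lem₂ = solve-∀

  square-cancel : ∀ {a b} → a * a ≤ b * b → a ≤ b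
  square-cancel {a} {b} le = ≮⇒≥ λ lt → <⇒≱ (*-mono-< lt lt) le

  upTo-sorted : ∀ n → Sorted (upTo n)
  upTo-sorted n = applyUpTo⁺₁ (λ i → i) n (λ lt _ → lt)

  least : {P : ℕ → Set} → (∀ k → Dec (P k)) → ∀ k → P k → ∃ λ j → j ≤ k × P j × (∀ i → i < j → ¬ P i)
  least P? k Pk with P? 0
  ... | yes p = 0 , z≤n , p , λ _ ()
  least P? zero    Pk | no ¬p = ⊥-elim (¬p Pk)
  least P? (suc k) Pk | no ¬p with least (P? ∘ suc) k Pk
  ... | j , j≤ , Pj , min = suc j , s≤s j≤ , Pj , λ { zero _ → ¬p ; (suc i) lt → min i (s≤s⁻¹ lt) }

  n<2^n : ∀ n → n < 2 ^ n
  n<2^n zero    = s≤s z≤n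
  n<2^n (suc n) = ≤-trans (+-mono-≤ (m^n>0 2 n) (n<2^n n)) (≤-reflexive (cong (2 ^ n +_) (sym (+-identityʳ (2 ^ n)))))

  -- This turns the factor α³ of the total into O(√β). The quotient a⁶ / 2^a is largest at a = 9,
  -- where it is about 1038; from there on (10/9)³ < 7/5 and (7/5)² < 2.
  sixth-power : ∀ k → (3 + k) * (3 + k) * (3 + k) * ((3 + k) * (3 + k) * (3 + k)) ≤ 2 ^ (3 + k) * 1100
  sixth-power 0 = ≤ᵇ⇒≤ _ _ _
  sixth-power 1 = ≤ᵇ⇒≤ _ _ _
  sixth-power 2 = ≤ᵇ⇒≤ _ _ _
  sixth-power 3 = ≤ᵇ⇒≤ _ _ _
  sixth-power 4 = ≤ᵇ⇒≤ _ _ _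
  sixth-power 5 = ≤ᵇ⇒≤ _ _ _
  sixth-power (suc (suc (suc (suc (suc (suc k)))))) = go k
    where
    open ≤-Reasoning
    go : ∀ k → (9 + k) * (9 + k) * (9 + k) * ((9 + k) * (9 + k) * (9 + k)) ≤ 2 ^ (9 + k) * 1100
    go zero    = ≤ᵇ⇒≤ _ _ _
    go (suc k) = *-cancelˡ-≤ 25 (begin
      25 * (x * x)                ≡⟨ lem₁ x ⟩
      5 * x * (5 * x)             ≤⟨ *-mono-≤ cubes cubes ⟩
      7 * y * (7 * y)             ≡⟨ lem₂ y ⟩
      49 * (y * y)                ≤⟨ *-mono-≤ (n≤1+n 49) (go k) ⟩
      50 * (2 ^ (9 + k) * 1100)   ≡⟨ lem₃ (2 ^ (9 + k)) 1100 ⟩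
      25 * (2 ^ (10 + k) * 1100)  ∎)
      where
      x = (10 + k) * (10 + k) * (10 + k)
      y = (9 + k) * (9 + k) * (9 + k)
      lem₁ : ∀ x → 25 * (x * x) ≡ 5 * x * (5 * x)
      lem₁ = solve-∀
      lem₂ : ∀ y → 7 * y * (7 * y) ≡ 49 * (y * y)
      lem₂ = solve-∀
      lem₃ : ∀ p c → 50 * (p * c) ≡ 25 * (2 * p * c)
      lem₃ = solve-∀
      cubes : 5 * x ≤ 7 * y
      cubes = ≤-trans (m≤m+n (5 * x) (103 + 201 * k + 39 * (k * k) + 2 * (k * k * k))) (≤-reflexive (lem₄ k))
        where
        lem₄ : ∀ k → 5 * ((10 + k) * (10 + k) * (10 + k)) + (103 + 201 * k + 39 * (k * k) + 2 * (k * k * k)) ≡ 7 * ((9 + k) * (9 + k) * (9 + k))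
        lem₄ = solve-∀

  -- Sparse pairs and monochromatic copies

  module Colouring (χ : ℕ → ℕ → Bool) (χ-sym : ∀ x y → χ x y ≡ χ y x)
                   (e : ℕ → ℕ → Bool) (e-sym : ∀ i j → e i j ≡ e j i) (e-irr : ∀ i → e i i ≡ false) where

    rel : Bool → ℕ → ℕ → Bool
    rel c x y = if c then χ x y else not (χ x y)

    rel-sym : ∀ c x y → rel c x y ≡ rel c y x
    rel-sym true  x y = χ-sym x y
    rel-sym false x y = cong not (χ-sym x y)

    rel-not : ∀ c x y → rel (not c) x y ≡ not (rel c x y)
    rel-not true  x y = refl
    rel-not false x y = sym (not-involutive (χ x y))

    record Pair (b : Bool) (γ s : ℕ) (Z : List ℕ) : Set where
      field
        X Y    : List ℕ
        X⊆     : X ⊆ Z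
        Y⊆     : Y ⊆ Z
        X≥     : 2 ^ s ≤ length X
        Y≥     : 2 ^ s ≤ length Y
        orient : X ≪ Y ⊎ Y ≪ X
        sparse : ∀ {x} → x ∈ X → 2 ^ γ * count (rel b x) Y ≤ length Y

    -- K is the number of bits of size lost on the way to the pair.
    SparseAt : Bool → ℕ → ℕ → List ℕ → Set
    SparseAt b γ K Z₀ = ∀ s Z → Z ⊆ Z₀ → 2 ^ (K + s) ≤ length Z → ¬ ¬ Pair b γ s Z

    SparseAt-⊆ : ∀ {b γ K Z Z₀} → Z ⊆ Z₀ → SparseAt b γ K Z₀ → SparseAt b γ K Z
    SparseAt-⊆ τ h s Z′ σ = h s Z′ (⊆-trans σ τ)

    record Copy (c : Bool) (I Z : List ℕ) : Set where
      field
        φ    : ℕ → ℕ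
        φ∈   : ∀ {i} → i ∈ I → φ i ∈ Z
        mono : ∀ {i j} → i ∈ I → j ∈ I → i < j → φ i < φ j
        edge : ∀ {i j} → i ∈ I → j ∈ I → i < j → e i j ≡ true → rel c (φ i) (φ j) ≡ true

    Copy-⊆ : ∀ {c I Z Z′} → Z ⊆ Z′ → Copy c I Z → Copy c I Z′
    Copy-⊆ τ k = record { Copy k ; φ∈ = λ i → ⊆-∈ τ (Copy.φ∈ k i) }

    deg : List ℕ → ℕ → ℕ
    deg I v = count (e v) I

    -- The degree sum of the induced graph, so twice its number of edges.
    ec : List ℕ → ℕ
    ec I = Σ[ I ] (deg I)

  module Sparsity (χ : ℕ → ℕ → Bool) (χ-sym : ∀ x y → χ x y ≡ χ y x)
                 (e : ℕ → ℕ → Bool) (e-sym : ∀ i j → e i j ≡ e j i) (e-irr : ∀ i → e i i ≡ false) where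

    open Colouring χ χ-sym e e-sym e-irr

    module Host (c : Bool) (γ s : ℕ) (Z : List ℕ) (noPair : ¬ Pair c γ s Z) where

      -- For a given `Y`, the vertices of V with too few c-neighbours in it would form a sparse pair
      -- with `Y` if there were more than `2 ^ s` of them. The union bound does the rest.
      pick : ∀ V (Ys : List (List ℕ)) → V ⊆ Z →
             (∀ {Y} → Y ∈ Ys → Y ⊆ Z × 2 ^ s ≤ length Y × Oriented V Y) →
             length Ys * 2 ^ s < length V →
             ∃ λ x → x ∈ V × (∀ {Y} → Y ∈ Ys → length Y ≤ 2 ^ γ * count (rel c x) Y)
      pick V Ys V⊆ hY lt with avoid bad V Ys (≤-<-trans (Σ-mono Ys few) (≤-<-trans (≤-reflexive (Σ-const (2 ^ s) Ys)) lt))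
        where
        bad : List ℕ → ℕ → Bool
        bad Y x = not (length Y ≤ᵇ 2 ^ γ * count (rel c x) Y)
        few : ∀ {Y} → Y ∈ Ys → count (bad Y) V ≤ 2 ^ s
        few {Y} i = ≮⇒≥ λ big → noPair (record
          { X = filterᵇ (bad Y) V ; Y = Y ; X⊆ = ⊆-trans (filterᵇ-⊆ _ V) V⊆ ; Y⊆ = proj₁ (hY i)
          ; X≥ = <⇒≤ big ; Y≥ = proj₁ (proj₂ (hY i))
          ; orient = Oriented-⊆ (filterᵇ-⊆ _ V) ⊆-refl (proj₂ (proj₂ (hY i)))
          ; sparse = λ {x} x∈ → <⇒≤ (≤ᵇ-false {length Y} {2 ^ γ * count (rel c x) Y} (not-true⁻ (proj₂ (∈-filterᵇ⁻ (bad Y) {xs = V} x∈)))) })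
      ... | x , x∈ , h = x , x∈ , λ i → ≤ᵇ-true (not-false′ (h i))
        where not-false′ : ∀ {b} → not b ≡ false → b ≡ true
              not-false′ {true} _ = refl

    -- Cliques with reserved sets

    module Slots (c : Bool) (γ′ s : ℕ) (Z₀ : List ℕ) (noPair : ¬ Pair c γ′ s Z₀) (sZ₀ : Sorted Z₀) (d n : ℕ) where

      open Nbhd (rel c)

      -- A vertex for a vertex of large degree, preceded by n reserved sets for vertices of small degree.
      record Slot : Set where
        constructor slot
        field
          W : ℕ → List ℕ
          a : ℕ
      open Slot

      In : Slot → ℕ → Set
      In σ x = x ≡ a σ ⊎ ∃ λ j → j < n × x ∈ W σ j

      Before : Slot → Slot → Set
      Before σ σ′ = ∀ x y → In σ x → In σ′ y → x < y

      Linked : Slot → Slot → Set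
      Linked σ σ′ = Before σ σ′ × rel c (a σ) (a σ′) ≡ true

      sets : List Slot → List (List ℕ)
      sets []       = []
      sets (σ ∷ Sl) = map (W σ) (upTo n) ++ sets Sl

      length-sets : ∀ Sl → length (sets Sl) ≡ length Sl * n
      length-sets []       = refl
      length-sets (σ ∷ Sl) = ≡-trans (length-++ (map (W σ) (upTo n)))
        (cong₂ _+_ (≡-trans (length-map (W σ) (upTo n)) (length-upTo n)) (length-sets Sl))

      ∈-sets⁻ : ∀ {C} Sl → C ∈ sets Sl → ∃ λ σ → σ ∈ Sl × ∃ λ j → j < n × C ≡ W σ j
      ∈-sets⁻ (σ ∷ Sl) i with ∈-++⁻ (map (W σ) (upTo n)) i
      ... | inj₁ k with ∈-map⁻ (W σ) k
      ...   | j , j∈ , eq = σ , here refl , j , ∈-upTo⁻ j∈ , eq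
      ∈-sets⁻ (σ ∷ Sl) i | inj₂ k with ∈-sets⁻ Sl k
      ... | σ′ , m , r = σ′ , there m , r

      ∈-sets⁺ : ∀ {σ j} Sl → σ ∈ Sl → j < n → W σ j ∈ sets Sl
      ∈-sets⁺ (σ ∷ Sl) (here refl) lt = ∈-++⁺ˡ (∈-map⁺ (W σ) (∈-upTo⁺ lt))
      ∈-sets⁺ (σ ∷ Sl) (there i)   lt = ∈-++⁺ʳ (map (W σ) (upTo n)) (∈-sets⁺ Sl i lt)

      -- Which heavy vertex lands on which clique member is settled only after the clique is
      -- complete. Hence every set of at most d members, not just the relevant ones, must have a
      -- common neighbourhood of the expected size in every reserved set.
      Good : List ℕ → List (List ℕ) → Set
      Good T ℰ = ∀ {C Q} → C ∈ ℰ → Q ⊆ T → length Q ≤ d → length C ≤ 2 ^ (γ′ * length Q) * length (nb Q C)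

      Good-mono : ∀ {T T′ ℰ ℰ′} → T′ ⊆ T → (∀ {C} → C ∈ ℰ′ → C ∈ ℰ) → Good T ℰ → Good T′ ℰ′
      Good-mono τ h g i σ le = g (h i) (⊆-trans σ τ) le

      Good-↭ : ∀ {T T′ ℰ} → T ↭ T′ → Good T ℰ → Good T′ ℰ
      Good-↭ {ℰ = ℰ} p g {C} {Q} i τ le with ⊆-↭ τ (↭-sym p)
      ... | Q′ , σ , π = subst₂ (λ l N → length C ≤ 2 ^ (γ′ * l) * length N) (sym (↭-length π)) (sym (nb-↭ C π))
                           (g i σ (subst (_≤ d) (↭-length π) le))

      -- Reserved sets cut from a region completely joined to T lose nothing to T, so they may be
      -- added without any test.
      Good-extend : ∀ {T ℰ ℱ} → (∀ {C τ y} → C ∈ ℱ → τ ∈ T → y ∈ C → rel c τ y ≡ true) →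
                    Good T ℰ → Good T (ℱ ++ ℰ)
      Good-extend {ℱ = ℱ} h g {C} {Q} i τ le with ∈-++⁻ ℱ i
      ... | inj₁ j rewrite nb-complete Q C (λ q y → h j (⊆-∈ τ q) y) = m≤n*m (length C) (2 ^ (γ′ * length Q)) {{m^n≢0 2 (γ′ * length Q)}}
      ... | inj₂ j = g j τ le

      tests : List ℕ → List (List ℕ) → List (List ℕ)
      tests T []      = []
      tests T (C ∷ ℰ) = map (λ Q → nb Q C) (shortSublists d T) ++ tests T ℰ

      length-tests : ∀ T ℰ → length (tests T ℰ) ≡ length ℰ * length (shortSublists d T)
      length-tests T []      = refl
      length-tests T (C ∷ ℰ) = ≡-trans (length-++ (map (λ Q → nb Q C) (shortSublists d T)))
        (cong₂ _+_ (length-map _ (shortSublists d T)) (length-tests T ℰ))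

      ∈-tests⁻ : ∀ {Y T} ℰ → Y ∈ tests T ℰ → ∃ λ C → C ∈ ℰ × ∃ λ Q → Q ∈ shortSublists d T × Y ≡ nb Q C
      ∈-tests⁻ {T = T} (C ∷ ℰ) i with ∈-++⁻ (map (λ Q → nb Q C) (shortSublists d T)) i
      ... | inj₁ k with ∈-map⁻ (λ Q → nb Q C) k
      ...   | Q , Q∈ , eq = C , here refl , Q , Q∈ , eq
      ∈-tests⁻ (C ∷ ℰ) i | inj₂ k with ∈-tests⁻ ℰ k
      ... | C′ , m , r = C′ , there m , r

      ∈-tests⁺ : ∀ {C Q T} ℰ → C ∈ ℰ → Q ∈ shortSublists d T → nb Q C ∈ tests T ℰ
      ∈-tests⁺ (C ∷ ℰ) (here refl) m = ∈-++⁺ˡ (∈-map⁺ (λ Q → nb Q C) m)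
      ∈-tests⁺ {T = T} (C ∷ ℰ) (there i)   m = ∈-++⁺ʳ (map (λ Q → nb Q C) (shortSublists d T)) (∈-tests⁺ ℰ i m)

      Good-step : ∀ {T ℰ} x → (∀ {Y} → Y ∈ tests T ℰ → length Y ≤ 2 ^ γ′ * count (rel c x) Y) → Good T ℰ → Good (x ∷ T) ℰ
      Good-step x h g i (_ ∷ʳ τ) le = g i τ le
      Good-step {T} {ℰ} x h g {C} {_ ∷ Q} i (refl ∷ τ) le = begin
        length C                                           ≤⟨ g i τ (<⇒≤ le) ⟩
        2 ^ (γ′ * length Q) * length (nb Q C)              ≤⟨ *-monoʳ-≤ (2 ^ (γ′ * length Q)) (h (∈-tests⁺ ℰ i (shortSublists-complete d τ (<⇒≤ le)))) ⟩
        2 ^ (γ′ * length Q) * (2 ^ γ′ * count (rel c x) (nb Q C)) ≡⟨ *-assoc (2 ^ (γ′ * length Q)) _ _ ⟨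
        2 ^ (γ′ * length Q) * 2 ^ γ′ * count (rel c x) (nb Q C)   ≡⟨ cong (_* count (rel c x) (nb Q C)) (^-distribˡ-+-* 2 (γ′ * length Q) γ′) ⟨
        2 ^ (γ′ * length Q + γ′) * count (rel c x) (nb Q C)
          ≡⟨ cong (λ z → 2 ^ z * count (rel c x) (nb Q C)) (lem γ′ (length Q)) ⟩
        2 ^ (γ′ * suc (length Q)) * count (rel c x) (nb Q C) ∎
        where
        open ≤-Reasoning
        lem : ∀ a b → a * b + a ≡ a * (1 + b)
        lem = solve-∀

    -- κ, U, ω, v: clique size of one run, total number of vertices, and sizes (in bits) of reserved sets and pools.
    module Cliques (c : Bool) (γ′ s : ℕ) (Z₀ : List ℕ) (noPair : ¬ Pair c γ′ s Z₀) (sZ₀ : Sorted Z₀) (d n : ℕ)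
                   (κ U ω v : ℕ) (ω≥ : s + γ′ * d ≤ ω) (s≤v : s ≤ v)
                   (room : ∀ (T : List ℕ) → length T ≤ U → (κ + U * n * length (shortSublists d T)) * 2 ^ s < 2 ^ v) where

      open Host c γ′ s Z₀ noPair
      open Nbhd (rel c)
      open Slots c γ′ s Z₀ noPair sZ₀ d n
      open Slot

      -- The situation inside nested pairs: T and ℰ are the clique members and reserved sets already
      -- fixed outside Z. Because T is complete to Z, whatever is built in Z is joined to T for
      -- free; only the old sets in ℰ have to be tested against new members.
      record Context (Z T : List ℕ) (ℰ : List (List ℕ)) : Set where
        field
          Z⊆       : Z ⊆ Z₀
          complete : ∀ {τ z} → τ ∈ T → z ∈ Z → rel c τ z ≡ true
          ℰ⊆       : ∀ {C} → C ∈ ℰ → C ⊆ Z₀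
          ℰ≥       : ∀ {C} → C ∈ ℰ → 2 ^ ω ≤ length C
          orient   : ∀ {C} → C ∈ ℰ → Oriented Z C
          good     : Good T ℰ

      nb-large : ∀ {T ℰ C Q} → (∀ {C} → C ∈ ℰ → 2 ^ ω ≤ length C) → Good T ℰ → C ∈ ℰ → Q ∈ shortSublists d T → 2 ^ s ≤ length (nb Q C)
      nb-large {T} {ℰ} {C} {Q} ℰ≥ g i m = *-cancelˡ-≤ (2 ^ k) {{m^n≢0 2 k}} (begin
        2 ^ k * 2 ^ s           ≡⟨ ^-distribˡ-+-* 2 k s ⟨
        2 ^ (k + s)             ≤⟨ ^-monoʳ-≤ 2 (≤-trans (≤-reflexive (+-comm k s)) (≤-trans (+-monoʳ-≤ s (*-monoʳ-≤ γ′ (proj₂ sd))) ω≥)) ⟩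
        2 ^ ω                   ≤⟨ ℰ≥ i ⟩
        length C                ≤⟨ g i (proj₁ sd) (proj₂ sd) ⟩
        2 ^ k * length (nb Q C) ∎)
        where
        open ≤-Reasoning
        k = γ′ * length Q
        sd = shortSublists-sound d m

      record Run (Vs : List (List ℕ)) (T : List ℕ) (ℰ : List (List ℕ)) : Set where
        field
          as     : List ℕ
          as∈    : Pointwise _∈_ as Vs
          clique : AllPairs (λ x y → rel c x y ≡ true) as
          good   : Good (as ++ T) ℰ

      -- Every choice costs each later pool γ′ bits, hence the exponent `v + γ′ * length Vs`. The
      -- later pools are among the sets handed to `pick` in order to obtain a clique, and the tests
      -- in order to preserve `Good`.
      run : ∀ k Vs T ℰ → length Vs ≡ k → (∀ {V} → V ∈ Vs → V ⊆ Z₀) → AllPairs _≪_ Vs →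
            (∀ {V} → V ∈ Vs → 2 ^ (v + γ′ * length Vs) ≤ length V) →
            (∀ {V C} → V ∈ Vs → C ∈ ℰ → Oriented V C) →
            (∀ {C} → C ∈ ℰ → C ⊆ Z₀) → (∀ {C} → C ∈ ℰ → 2 ^ ω ≤ length C) →
            length Vs ≤ κ → length Vs + length T ≤ U → length ℰ ≤ U * n → Good T ℰ → Run Vs T ℰ
      run zero [] T ℰ _ _ _ _ _ _ _ _ _ _ g = record { as = [] ; as∈ = [] ; clique = [] ; good = g }
      run (suc k) (V ∷ Vs) T ℰ len V⊆ (V≪ ∷ Vs≪) V≥ or ℰ⊆ ℰ≥ ≤κ ≤U ℰ≤ g = continue (pick V Ys (V⊆ (here refl)) hY few)
        where
        open ≤-Reasoning
        Ys = Vs ++ tests T ℰ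
        hY : ∀ {Y} → Y ∈ Ys → Y ⊆ Z₀ × 2 ^ s ≤ length Y × Oriented V Y
        hY i with ∈-++⁻ Vs i
        ... | inj₁ j = V⊆ (there j) , ≤-trans (^-monoʳ-≤ 2 (≤-trans s≤v (m≤m+n v _))) (V≥ (there j)) , inj₁ (All.lookup V≪ j)
        ... | inj₂ j with ∈-tests⁻ ℰ j
        ...   | C , C∈ , Q , Q∈ , refl = ⊆-trans (nb-⊆ Q C) (ℰ⊆ C∈) , nb-large ℰ≥ g C∈ Q∈ , Oriented-⊆ ⊆-refl (nb-⊆ Q C) (or (here refl) C∈)
        few : length Ys * 2 ^ s < length V
        few = begin-strict
          length Ys * 2 ^ s ≡⟨ cong (_* 2 ^ s) (≡-trans (length-++ Vs) (cong (length Vs +_) (length-tests T ℰ))) ⟩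
          (length Vs + length ℰ * length (shortSublists d T)) * 2 ^ s
            ≤⟨ *-monoˡ-≤ (2 ^ s) (+-mono-≤ (≤-trans (n≤1+n _) ≤κ) (*-monoˡ-≤ (length (shortSublists d T)) ℰ≤)) ⟩
          (κ + U * n * length (shortSublists d T)) * 2 ^ s   <⟨ room T (≤-trans (m≤n+m _ _) ≤U) ⟩
          2 ^ v                                     ≤⟨ ^-monoʳ-≤ 2 (m≤m+n v _) ⟩
          2 ^ (v + γ′ * length (V ∷ Vs))            ≤⟨ V≥ (here refl) ⟩
          length V                                  ∎
        continue : (∃ λ x → x ∈ V × (∀ {Y} → Y ∈ Ys → length Y ≤ 2 ^ γ′ * count (rel c x) Y)) → Run (V ∷ Vs) T ℰ
        continue (x , x∈ , h) = record
          { as = x ∷ R.as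
          ; as∈ = x∈ ∷ inVs Vs R.as∈
          ; clique = All.tabulate (adj Vs R.as∈) ∷ R.clique
          ; good = Good-↭ (shift x R.as T) R.good }
          where
          f : List ℕ → List ℕ
          f = filterᵇ (rel c x)
          ∈-f : ∀ {V′} → V′ ∈ map f Vs → ∃ λ V₁ → V₁ ∈ Vs × V′ ≡ f V₁
          ∈-f = ∈-map⁻ f
          big : ∀ {V′} → V′ ∈ map f Vs → 2 ^ (v + γ′ * length (map f Vs)) ≤ length V′
          big i with ∈-f i
          ... | V₁ , j , refl = *-cancelˡ-≤ (2 ^ γ′) {{m^n≢0 2 γ′}} (begin
            2 ^ γ′ * 2 ^ (v + γ′ * length (map f Vs)) ≡⟨ ^-distribˡ-+-* 2 γ′ _ ⟨
            2 ^ (γ′ + (v + γ′ * length (map f Vs)))   ≡⟨ cong (λ l → 2 ^ (γ′ + (v + γ′ * l))) (length-map f Vs) ⟩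
            2 ^ (γ′ + (v + γ′ * length Vs))           ≡⟨ cong (2 ^_) (lem γ′ v (length Vs)) ⟩
            2 ^ (v + γ′ * suc (length Vs))            ≤⟨ V≥ (there j) ⟩
            length V₁                                 ≤⟨ h (∈-++⁺ˡ j) ⟩
            2 ^ γ′ * count (rel c x) V₁               ∎)
            where lem : ∀ a b l → a + (b + a * l) ≡ b + a * (1 + l)
                  lem = solve-∀
          f≪ : ∀ {Us} → AllPairs _≪_ Us → AllPairs _≪_ (map f Us)
          f≪ []       = []
          f≪ (p ∷ ps) = All.tabulate (λ i → go (∈-map⁻ f i)) ∷ f≪ ps
            where
            go : ∀ {V′} → (∃ λ V₁ → V₁ ∈ _ × V′ ≡ f V₁) → _ ≪ V′
            go (V₁ , j , refl) = ≪-⊆ (filterᵇ-⊆ _ _) (filterᵇ-⊆ _ V₁) (All.lookup p j)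
          lens : length (map f Vs) ≡ length Vs
          lens = length-map f Vs
          r : Run (map f Vs) (x ∷ T) ℰ
          r = run k (map f Vs) (x ∷ T) ℰ (≡-trans lens (suc-injective len))
            (λ i → sub (∈-f i)) (f≪ Vs≪) big (λ i C∈ → orf (∈-f i) C∈) ℰ⊆ ℰ≥
            (≤-trans (≤-reflexive lens) (≤-trans (n≤1+n _) ≤κ))
            (≤-trans (≤-reflexive (≡-trans (cong (_+ suc (length T)) lens) (+-suc (length Vs) (length T)))) ≤U) ℰ≤
            (Good-step x (λ i → h (∈-++⁺ʳ Vs i)) g)
            where
            sub : ∀ {V′} → (∃ λ V₁ → V₁ ∈ Vs × V′ ≡ f V₁) → V′ ⊆ Z₀
            sub (V₁ , j , refl) = ⊆-trans (filterᵇ-⊆ _ V₁) (V⊆ (there j))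
            orf : ∀ {V′ C} → (∃ λ V₁ → V₁ ∈ Vs × V′ ≡ f V₁) → C ∈ ℰ → Oriented V′ C
            orf (V₁ , j , refl) C∈ = Oriented-⊆ (filterᵇ-⊆ _ V₁) ⊆-refl (or (there j) C∈)
          module R = Run r
          inVs : ∀ Us {as} → Pointwise _∈_ as (map f Us) → Pointwise _∈_ as Us
          inVs []       []       = []
          inVs (U₁ ∷ Us) (p ∷ ps) = proj₁ (∈-filterᵇ⁻ (rel c x) {xs = U₁} p) ∷ inVs Us ps
          adj : ∀ Us {as y} → Pointwise _∈_ as (map f Us) → y ∈ as → rel c x y ≡ true
          adj (U₁ ∷ Us) (p ∷ ps) (here refl) = proj₂ (∈-filterᵇ⁻ (rel c x) {xs = U₁} p)
          adj (U₁ ∷ Us) (p ∷ ps) (there i)   = adj Us ps i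

      -- By `size≥` at most a share q / 2 ^ γ of the full `2 ^ q * κ` slots is missing: each
      -- doubling drops a share 2 / 2 ^ γ of one half, which adds 1 / 2 ^ γ of the whole.
      record Block (γ q : ℕ) (Z T : List ℕ) (ℰ : List (List ℕ)) : Set where
        field
          Sl     : List Slot
          size≤  : length Sl ≤ 2 ^ q * κ
          size≥  : 2 ^ γ * (2 ^ q * κ) ≤ 2 ^ γ * length Sl + q * (2 ^ q * κ)
          inZ    : ∀ {σ x} → σ ∈ Sl → In σ x → x ∈ Z
          W⊆     : ∀ {σ j} → σ ∈ Sl → j < n → W σ j ⊆ Z
          W≥     : ∀ {σ j} → σ ∈ Sl → j < n → 2 ^ ω ≤ length (W σ j)
          W≪     : ∀ {σ i j} → σ ∈ Sl → i < j → j < n → W σ i ≪ W σ j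
          W<a    : ∀ {σ j y} → σ ∈ Sl → j < n → y ∈ W σ j → y < a σ
          linked : AllPairs Linked Sl
          good   : Good (map a Sl ++ T) (sets Sl ++ ℰ)

    -- Doubling a clique inside sparse pairs

    module Growth (c : Bool) (γ′ s : ℕ) (Z₀ : List ℕ) (noPair : ¬ Pair c γ′ s Z₀) (sZ₀ : Sorted Z₀) (d n : ℕ)
                  (κ U ω v : ℕ) (ω≥ : s + γ′ * d ≤ ω) (s≤v : s ≤ v)
                   (room : ∀ (T : List ℕ) → length T ≤ U → (κ + U * n * length (shortSublists d T)) * 2 ^ s < 2 ^ v) where

      open Nbhd (rel c)
      open Slots c γ′ s Z₀ noPair sZ₀ d n
      open Slot
      open Cliques c γ′ s Z₀ noPair sZ₀ d n κ U ω v ω≥ s≤v room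

      module Base (Z : List ℕ) (sZ : Sorted Z) (b : ℕ) (room-Z : κ * suc n * 2 ^ b ≤ length Z)
                  (ω≤b : ω ≤ b) (v≤b : v + γ′ * κ ≤ b) where

        -- A slot owns n + 1 consecutive pieces. The last one is the pool of its clique vertex,
        -- which therefore follows all reserved sets of the slot.
        part : ℕ → ℕ → List ℕ
        part i j = piece Z (2 ^ b) (i * suc n + j)

        lex : ∀ {i i′ j j′} → i < i′ → j ≤ n → i * suc n + j < i′ * suc n + j′
        lex {i} {i′} {j} {j′} i<i′ j≤n = begin-strict
          i * suc n + j      <⟨ +-monoʳ-< (i * suc n) (s≤s j≤n) ⟩
          i * suc n + suc n  ≡⟨ +-comm (i * suc n) (suc n) ⟩
          suc i * suc n      ≤⟨ *-monoˡ-≤ (suc n) i<i′ ⟩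
          i′ * suc n         ≤⟨ m≤m+n _ j′ ⟩
          i′ * suc n + j′    ∎
          where open ≤-Reasoning

        part-length : ∀ {i j} → i < κ → j ≤ n → length (part i j) ≡ 2 ^ b
        part-length {i} {j} lt le = piece-length Z (2 ^ b) {p = κ * suc n}
          (<-≤-trans (lex {i′ = κ} {j′ = 0} lt le) (≤-reflexive (+-identityʳ _))) room-Z

        part-⊆ : ∀ i j → part i j ⊆ Z
        part-⊆ i j = piece-⊆ Z (2 ^ b) (i * suc n + j)

        part-≪ : ∀ {i i′ j j′} → i < i′ → j ≤ n → part i j ≪ part i′ j′
        part-≪ {i} {i′} {j} {j′} lt le = piece-≪ (2 ^ b) sZ (lex {i} {i′} {j} {j′} lt le)

        part-≪′ : ∀ {i j j′} → j < j′ → part i j ≪ part i j′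
        part-≪′ {i} lt = piece-≪ (2 ^ b) sZ (+-monoʳ-< (i * suc n) lt)

        pools : ℕ → ℕ → List (List ℕ)
        pools k zero    = []
        pools k (suc m) = part k n ∷ pools (suc k) m

        length-pools : ∀ k m → length (pools k m) ≡ m
        length-pools k zero    = refl
        length-pools k (suc m) = cong suc (length-pools (suc k) m)

        ∈-pools : ∀ {V} k m → V ∈ pools k m → ∃ λ i → k ≤ i × i < k + m × V ≡ part i n
        ∈-pools k (suc m) (here refl) = k , ≤-refl , m<m+n k (s≤s z≤n) , refl
        ∈-pools k (suc m) (there i) with ∈-pools (suc k) m i
        ... | i′ , k≤ , lt , eq = i′ , <⇒≤ k≤ , subst (i′ <_) (sym (+-suc k m)) lt , eq

        pools-≪ : ∀ k m → AllPairs _≪_ (pools k m)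
        pools-≪ k zero    = []
        pools-≪ k (suc m) = All.tabulate (λ i → go (∈-pools (suc k) m i)) ∷ pools-≪ (suc k) m
          where
          go : ∀ {V} → (∃ λ i → suc k ≤ i × i < suc k + m × V ≡ part i n) → part k n ≪ V
          go (i , lt , _ , refl) = part-≪ {k} {i} {n} {n} lt ≤-refl

        slots : ℕ → List ℕ → List Slot
        slots k []       = []
        slots k (x ∷ xs) = slot (part k) x ∷ slots (suc k) xs

        length-slots : ∀ k xs → length (slots k xs) ≡ length xs
        length-slots k []       = refl
        length-slots k (x ∷ xs) = cong suc (length-slots (suc k) xs)

        map-a : ∀ k xs → map a (slots k xs) ≡ xs
        map-a k []       = refl
        map-a k (x ∷ xs) = cong (x ∷_) (map-a (suc k) xs)

        sets-slots : ∀ k xs ys → length xs ≡ length ys → sets (slots k xs) ≡ sets (slots k ys)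
        sets-slots k []       []       _  = refl
        sets-slots k (x ∷ xs) (y ∷ ys) eq = cong (map (part k) (upTo n) ++_) (sets-slots (suc k) xs ys (suc-injective eq))

        ∈-slots : ∀ {σ} k xs → σ ∈ slots k xs → ∃ λ i → k ≤ i × i < k + length xs × W σ ≡ part i
        ∈-slots k (x ∷ xs) (here refl) = k , ≤-refl , m<m+n k (s≤s z≤n) , refl
        ∈-slots k (x ∷ xs) (there i) with ∈-slots (suc k) xs i
        ... | i′ , k≤ , lt , eq = i′ , <⇒≤ k≤ , subst (i′ <_) (sym (+-suc k (length xs))) lt , eq

        ∈-slots′ : ∀ {σ} k m {xs} → Pointwise _∈_ xs (pools k m) → σ ∈ slots k xs →
                   ∃ λ i → k ≤ i × i < k + m × W σ ≡ part i × a σ ∈ part i n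
        ∈-slots′ k (suc m) (p ∷ ps) (here refl) = k , ≤-refl , m<m+n k (s≤s z≤n) , refl , p
        ∈-slots′ k (suc m) (p ∷ ps) (there i) with ∈-slots′ (suc k) m ps i
        ... | i′ , k≤ , lt , eq , r = i′ , <⇒≤ k≤ , subst (i′ <_) (sym (+-suc k m)) lt , eq , r

        in-part : ∀ {σ x i} → W σ ≡ part i → a σ ∈ part i n → In σ x → ∃ λ j → j ≤ n × x ∈ part i j
        in-part refl p (inj₁ refl)         = n , ≤-refl , p
        in-part refl p (inj₂ (j , lt , q)) = j , <⇒≤ lt , q

        linked-slots : ∀ k m {xs} → Pointwise _∈_ xs (pools k m) → AllPairs (λ x y → rel c x y ≡ true) xs →
                       AllPairs Linked (slots k xs)
        linked-slots k zero    [] [] = []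
        linked-slots k (suc m) {x ∷ xs} (p ∷ ps) (q ∷ qs) =
          All.tabulate (λ i → go i (∈-slots′ (suc k) m ps i)) ∷ linked-slots (suc k) m ps qs
          where
          a-∈ : ∀ {σ} k xs → σ ∈ slots k xs → a σ ∈ xs
          a-∈ k (x ∷ xs) (here refl) = here refl
          a-∈ k (x ∷ xs) (there i)   = there (a-∈ (suc k) xs i)
          go : ∀ {σ} → σ ∈ slots (suc k) xs → (∃ λ i → suc k ≤ i × i < suc k + m × W σ ≡ part i × a σ ∈ part i n) →
               Linked (slot (part k) x) σ
          go {σ} m∈ (i , lt , _ , eq , r) = before , All.lookup q (a-∈ (suc k) xs m∈)
            where
            before : Before (slot (part k) x) σ
            before y z y∈ z∈ with in-part {slot (part k) x} {y} {k} refl p y∈ | in-part {σ} {z} {i} eq r z∈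
            ... | j , j≤ , y∈′ | j′ , _ , z∈′ = below (part-≪ {k} {i} {j} {j′} lt j≤) y∈′ z∈′

        base : ∀ {γ T ℰ} → Context Z T ℰ → κ + length T ≤ U → κ * n + length ℰ ≤ U * n → Block γ 0 Z T ℰ
        base {γ} {T} {ℰ} ctx T≤ ℰ≤ = record
          { Sl = Sl
          ; size≤ = ≤-reflexive (≡-trans lenSl (sym (+-identityʳ κ)))
          ; size≥ = ≤-reflexive (≡-trans (cong (2 ^ γ *_) (≡-trans (+-identityʳ κ) (sym lenSl))) (sym (+-identityʳ _)))
          ; inZ = λ {σ} {x} i q → inz (∈-slots′ 0 κ R.as∈ i) q
          ; W⊆ = λ {σ} {j} i _ → subst (λ f → f j ⊆ Z) (sym (eqW i)) (part-⊆ (proj₁ (∈-slots′ 0 κ R.as∈ i)) j)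
          ; W≥ = λ {σ} {j} i lt → subst (λ f → 2 ^ ω ≤ length (f j)) (sym (eqW i))
              (≤-trans (^-monoʳ-≤ 2 ω≤b) (≤-reflexive (sym (part-length (proj₁ (proj₂ (proj₂ (∈-slots′ 0 κ R.as∈ i)))) (<⇒≤ lt)))))
          ; W≪ = λ {σ} {j} {j′} i lt _ → subst (λ f → f j ≪ f j′) (sym (eqW i)) (part-≪′ {proj₁ (∈-slots′ 0 κ R.as∈ i)} lt)
          ; W<a = λ {σ} {j} {y} i lt y∈ → w<a (∈-slots′ 0 κ R.as∈ i) lt y∈
          ; linked = linked-slots 0 κ R.as∈ R.clique
          ; good = subst₂ (λ P Q → Good (P ++ T) (Q ++ ℰ)) (sym (map-a 0 R.as)) sets≡ R.good }
          where
          open Context ctx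
          -- The reserved sets must be known before the clique is chosen. They depend only on the
          -- number of slots, so placeholders stand for the clique vertices.
          dummy : List ℕ
          dummy = upTo κ
          ℱ = sets (slots 0 dummy)
          ∈-ℱ : ∀ {C} → C ∈ ℱ → ∃ λ i → i < κ × ∃ λ j → j < n × C ≡ part i j
          ∈-ℱ i with ∈-sets⁻ (slots 0 dummy) i
          ... | σ , m , j , lt , refl with ∈-slots 0 dummy m
          ...   | i′ , _ , lt′ , refl = i′ , subst (i′ <_) (length-upTo κ) lt′ , j , lt , refl
          ℱ⊆ : ∀ {C} → C ∈ ℱ → C ⊆ Z
          ℱ⊆ i with ∈-ℱ i
          ... | i′ , _ , j , _ , refl = part-⊆ i′ j
          ℱ≥ : ∀ {C} → C ∈ ℱ → 2 ^ ω ≤ length C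
          ℱ≥ i with ∈-ℱ i
          ... | i′ , lt , j , lt′ , refl = ≤-trans (^-monoʳ-≤ 2 ω≤b) (≤-reflexive (sym (part-length lt (<⇒≤ lt′))))
          pool-ℱ : ∀ {V C} → V ∈ pools 0 κ → C ∈ ℱ → Oriented V C
          pool-ℱ p q with ∈-pools 0 κ p | ∈-ℱ q
          ... | i , _ , _ , refl | i′ , _ , j , lt , refl with <-cmp i i′
          ...   | tri< l _ _    = inj₁ (part-≪ {i} {i′} {n} {j} l ≤-refl)
          ...   | tri≈ _ refl _ = inj₂ (part-≪′ {i} lt)
          ...   | tri> _ _ g    = inj₂ (part-≪ {i′} {i} {j} {n} g (<⇒≤ lt))
          pool⊆ : ∀ {V} → V ∈ pools 0 κ → V ⊆ Z
          pool⊆ p with ∈-pools 0 κ p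
          ... | i , _ , _ , refl = part-⊆ i n
          pool≥ : ∀ {V} → V ∈ pools 0 κ → 2 ^ (v + γ′ * length (pools 0 κ)) ≤ length V
          pool≥ p with ∈-pools 0 κ p
          ... | i , _ , lt , refl = ≤-trans (^-monoʳ-≤ 2 (≤-trans (≤-reflexive (cong (λ l → v + γ′ * l) (length-pools 0 κ))) v≤b))
                                      (≤-reflexive (sym (part-length lt ≤-refl)))
          both : ∀ {P : List ℕ → Set} → (∀ {C} → C ∈ ℱ → P C) → (∀ {C} → C ∈ ℰ → P C) → ∀ {C} → C ∈ ℱ ++ ℰ → P C
          both f g i = [ f , g ]′ (∈-++⁻ ℱ i)
          r : Run (pools 0 κ) T (ℱ ++ ℰ)
          r = run κ (pools 0 κ) T (ℱ ++ ℰ) (length-pools 0 κ) (λ p → ⊆-trans (pool⊆ p) Z⊆) (pools-≪ 0 κ) pool≥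
            (λ p q → [ pool-ℱ p , (λ q′ → Oriented-⊆ (pool⊆ p) ⊆-refl (orient q′)) ]′ (∈-++⁻ ℱ q))
            (both {λ C → C ⊆ Z₀} (λ i → ⊆-trans (ℱ⊆ i) Z⊆) ℰ⊆) (both {λ C → 2 ^ ω ≤ length C} ℱ≥ ℰ≥)
            (≤-reflexive (length-pools 0 κ)) (subst (λ l → l + length T ≤ U) (sym (length-pools 0 κ)) T≤)
            (≤-trans (≤-reflexive (≡-trans (length-++ ℱ) (cong (_+ length ℰ)
              (≡-trans (length-sets (slots 0 dummy)) (cong (_* n) (≡-trans (length-slots 0 dummy) (length-upTo κ))))))) ℰ≤)
            (Good-extend (λ C∈ τ∈ y∈ → complete τ∈ (⊆-∈ (ℱ⊆ C∈) y∈)) good)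
          module R = Run r
          Sl = slots 0 R.as
          len-as : length R.as ≡ κ
          len-as = ≡-trans (Pointwise-length R.as∈) (length-pools 0 κ)
          lenSl : length Sl ≡ κ
          lenSl = ≡-trans (length-slots 0 R.as) len-as
          sets≡ : ℱ ≡ sets Sl
          sets≡ = sets-slots 0 dummy R.as (≡-trans (length-upTo κ) (sym len-as))
          eqW : ∀ {σ} (i : σ ∈ Sl) → W σ ≡ part (proj₁ (∈-slots′ 0 κ R.as∈ i))
          eqW i = proj₁ (proj₂ (proj₂ (proj₂ (∈-slots′ 0 κ R.as∈ i))))
          inz : ∀ {σ x} → (∃ λ i → 0 ≤ i × i < κ × W σ ≡ part i × a σ ∈ part i n) → In σ x → x ∈ Z
          inz {σ} {x} (i , _ , _ , eq , r) q with in-part {σ} {x} {i} eq r q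
          ... | j , _ , m = ⊆-∈ (part-⊆ i j) m
          w<a : ∀ {σ j y} → (∃ λ i → 0 ≤ i × i < κ × W σ ≡ part i × a σ ∈ part i n) → j < n → y ∈ W σ j → y < a σ
          w<a {σ} {j} (i , _ , _ , refl , r) lt y∈ = below (part-≪′ {i} {j} {n} lt) y∈ r

      Context-⊆ : ∀ {X Z T ℰ} → X ⊆ Z → Context Z T ℰ → Context X T ℰ
      Context-⊆ τ ctx = record
        { Context ctx
        ; Z⊆ = ⊆-trans τ (Context.Z⊆ ctx)
        ; complete = λ i j → Context.complete ctx i (⊆-∈ τ j)
        ; orient = λ i → Oriented-⊆ τ ⊆-refl (Context.orient ctx i) }

      -- The second block grows in a part `P` of Y completely joined to the surviving slots of the
      -- first. Those slots become part of T, and their reserved sets part of ℰ, so that the second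
      -- block is tested against them while it is chosen.
      module Merge {γ q : ℕ} {Z T : List ℕ} {ℰ : List (List ℕ)} (ctx : Context Z T ℰ)
                   {X Y : List ℕ} (X⊆ : X ⊆ Z) (Y⊆ : Y ⊆ Z) (XY : Oriented X Y)
                   (BX : Block γ q X T ℰ) {P : List ℕ} {Sl : List Slot} (P⊆ : P ⊆ Y) (Sl⊆ : Sl ⊆ Block.Sl BX)
                   (clear : ∀ {σ z} → σ ∈ Sl → z ∈ P → rel (not c) (a σ) z ≡ false)
                   (few : 2 ^ γ * length (Block.Sl BX) ≤ 2 ^ γ * length Sl + 2 * length (Block.Sl BX)) where

        open Context ctx
        module BX = Block BX

        link : ∀ {σ z} → σ ∈ Sl → z ∈ P → rel c (a σ) z ≡ true
        link {σ} {z} i j = subst (λ b → b ≡ true) (not-involutive (rel c (a σ) z))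
          (cong not (≡-trans (sym (rel-not c (a σ) z)) (clear i j)))

        Sl-≤ : length Sl ≤ 2 ^ q * κ
        Sl-≤ = ≤-trans (length-mono-≤ Sl⊆) BX.size≤

        In-X : ∀ {σ x} → σ ∈ Sl → In σ x → x ∈ X
        In-X i = BX.inZ (⊆-∈ Sl⊆ i)

        T₁ : List ℕ
        T₁ = map a Sl ++ T
        ℰ₁ : List (List ℕ)
        ℰ₁ = sets Sl ++ ℰ

        sets-mono : ∀ {C} → C ∈ sets Sl → C ∈ sets BX.Sl
        sets-mono i with ∈-sets⁻ Sl i
        ... | σ , m , j , lt , refl = ∈-sets⁺ BX.Sl (⊆-∈ Sl⊆ m) lt

        context : Context P T₁ ℰ₁
        context = record
          { Z⊆ = ⊆-trans P⊆ (⊆-trans Y⊆ Z⊆)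
          ; complete = λ i j → [ (λ k → fromSlot (∈-map⁻ a k) j) , (λ k → complete k (⊆-∈ Y⊆ (⊆-∈ P⊆ j))) ]′ (∈-++⁻ (map a Sl) i)
          ; ℰ⊆ = λ i → [ (λ k → ⊆-trans (⊆X k) (⊆-trans X⊆ Z⊆)) , ℰ⊆ ]′ (∈-++⁻ (sets Sl) i)
          ; ℰ≥ = λ i → [ ≥ω , ℰ≥ ]′ (∈-++⁻ (sets Sl) i)
          ; orient = λ i → [ (λ k → Oriented-swap (Oriented-⊆ (⊆X k) P⊆ XY)) , (λ k → Oriented-⊆ (⊆-trans P⊆ Y⊆) ⊆-refl (orient k)) ]′ (∈-++⁻ (sets Sl) i)
          ; good = Good-mono (⊆-++⁺ (⊆-map⁺ a Sl⊆) ⊆-refl)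
              (λ i → [ (λ k → ∈-++⁺ˡ (sets-mono k)) , ∈-++⁺ʳ (sets BX.Sl) ]′ (∈-++⁻ (sets Sl) i)) BX.good }
          where
          fromSlot : ∀ {τ z} → (∃ λ σ → σ ∈ Sl × τ ≡ a σ) → z ∈ P → rel c τ z ≡ true
          fromSlot (σ , m , refl) j = link m j
          ⊆X : ∀ {C} → C ∈ sets Sl → C ⊆ X
          ⊆X i with ∈-sets⁻ Sl i
          ... | σ , m , j , lt , refl = BX.W⊆ (⊆-∈ Sl⊆ m) lt
          ≥ω : ∀ {C} → C ∈ sets Sl → 2 ^ ω ≤ length C
          ≥ω i with ∈-sets⁻ Sl i
          ... | σ , m , j , lt , refl = BX.W≥ (⊆-∈ Sl⊆ m) lt

        module _ (BY : Block γ q P T₁ ℰ₁) where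
          module BY = Block BY

          Sl-linked : AllPairs Linked Sl
          Sl-linked = AllPairs-⊆ Sl⊆ BX.linked

          sets-++ : ∀ S₁ S₂ {C} → C ∈ sets (S₁ ++ S₂) → C ∈ sets S₁ ⊎ C ∈ sets S₂
          sets-++ S₁ S₂ i with ∈-sets⁻ (S₁ ++ S₂) i
          ... | σ , m , j , lt , refl with ∈-++⁻ S₁ m
          ...   | inj₁ k = inj₁ (∈-sets⁺ S₁ k lt)
          ...   | inj₂ k = inj₂ (∈-sets⁺ S₂ k lt)

          -- `BY.good` lists members in the order of choice, the second block first; the permutation
          -- is harmless by `Good-↭`.
          good₁ : Good (map a Sl ++ map a BY.Sl ++ T) (sets BY.Sl ++ ℰ₁)
          good₁ = Good-↭ (↭-trans (↭-sym (++-assoc (map a BY.Sl) (map a Sl) T))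
                     (↭-trans (++⁺ʳ T (++-comm (map a BY.Sl) (map a Sl))) (++-assoc (map a Sl) (map a BY.Sl) T))) BY.good

          -- The block built in X comes first or last according to the orientation of the pair.
          -- Links between the blocks come from `link`, in either direction.
          arrange : Oriented X Y → (∃ λ S → AllPairs Linked S × S ↭ (Sl ++ BY.Sl))
          arrange (inj₁ lt) = Sl ++ BY.Sl , AllPairs-++ Sl Sl-linked BY.linked
                  (λ {σ} {σ′} i j → (λ x y p q → below lt (In-X i p) (⊆-∈ P⊆ (BY.inZ j q))) , link i (BY.inZ j (inj₁ refl))) , ↭-refl
          arrange (inj₂ lt) = BY.Sl ++ Sl , AllPairs-++ BY.Sl BY.linked Sl-linked
                  (λ {σ} {σ′} i j → (λ x y p q → below lt (⊆-∈ P⊆ (BY.inZ i p)) (In-X j q)) ,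
                    ≡-trans (rel-sym c (a σ) (a σ′)) (link j (BY.inZ i (inj₁ refl)))) , ++-comm BY.Sl Sl

          merged : Block γ (suc q) Z T ℰ
          merged with arrange XY
          ... | S , linkedS , S↭ = record
            { Sl = S
            ; size≤ = ≤-trans (≤-reflexive len) (≤-trans (+-mono-≤ Sl-≤ BY.size≤) (≤-reflexive (lem₁ (2 ^ q) κ)))
            ; size≥ = bound
            ; inZ = λ {σ} i p → byCase (λ σ → ∀ {x} → In σ x → x ∈ Z) (λ j {x} p → ⊆-∈ X⊆ (In-X j p)) (λ j p → ⊆-∈ Y⊆ (⊆-∈ P⊆ (BY.inZ j p))) i p
            ; W⊆ = λ {σ} {j} i lt → byCase (λ σ → W σ j ⊆ Z) (λ k → ⊆-trans (BX.W⊆ (⊆-∈ Sl⊆ k) lt) X⊆) (λ k → ⊆-trans (BY.W⊆ k lt) (⊆-trans P⊆ Y⊆)) i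
            ; W≥ = λ {σ} {j} i lt → byCase (λ σ → 2 ^ ω ≤ length (W σ j)) (λ k → BX.W≥ (⊆-∈ Sl⊆ k) lt) (λ k → BY.W≥ k lt) i
            ; W≪ = λ {σ} {j} {j′} i l lt → byCase (λ σ → W σ j ≪ W σ j′) (λ k → BX.W≪ (⊆-∈ Sl⊆ k) l lt) (λ k → BY.W≪ k l lt) i
            ; W<a = λ {σ} {j} {y} i lt → byCase (λ σ → y ∈ W σ j → y < a σ) (λ k → BX.W<a (⊆-∈ Sl⊆ k) lt) (λ k → BY.W<a k lt) i
            ; linked = linkedS
            ; good = Good-mono ⊆-refl
                (λ i → [ (λ k → [ (λ l → ∈-++⁺ʳ (sets BY.Sl) (∈-++⁺ˡ l)) , ∈-++⁺ˡ ]′ (sets-++ Sl BY.Sl (sets-↭ k)))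
                       , (λ k → ∈-++⁺ʳ (sets BY.Sl) (∈-++⁺ʳ (sets Sl) k)) ]′ (∈-++⁻ (sets S) i))
                (Good-↭ a-↭ good₁) }
            where
            open ≤-Reasoning
            len : length S ≡ length Sl + length BY.Sl
            len = ≡-trans (↭-length S↭) (length-++ Sl)
            lem₁ : ∀ x k → x * k + x * k ≡ 2 * x * k
            lem₁ = solve-∀
            byCase : (R : Slot → Set) → (∀ {σ} → σ ∈ Sl → R σ) → (∀ {σ} → σ ∈ BY.Sl → R σ) → ∀ {σ} → σ ∈ S → R σ
            byCase R f g i = [ f , g ]′ (∈-++⁻ Sl (∈-resp-↭ S↭ i))
            sets-↭ : ∀ {C} → C ∈ sets S → C ∈ sets (Sl ++ BY.Sl)
            sets-↭ i with ∈-sets⁻ S i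
            ... | σ , m , j , lt , refl = ∈-sets⁺ (Sl ++ BY.Sl) (∈-resp-↭ S↭ m) lt
            a-↭ : map a Sl ++ map a BY.Sl ++ T ↭ map a S ++ T
            a-↭ = ↭-trans (↭-sym (++-assoc (map a Sl) (map a BY.Sl) T))
              (++⁺ʳ T (↭-trans (Perm.↭-reflexive (sym (map-++ a Sl BY.Sl))) (↭-sym (map-↭ a S↭))))
            g = 2 ^ γ
            m = 2 ^ q * κ
            bound : g * (2 * 2 ^ q * κ) ≤ g * length S + suc q * (2 * 2 ^ q * κ)
            bound = begin
              g * (2 * 2 ^ q * κ)            ≡⟨ lem₂ g (2 ^ q) κ ⟩
              g * m + g * m                  ≤⟨ +-mono-≤ (≤-trans BX.size≥ (+-monoˡ-≤ (q * m) (≤-trans few (+-monoʳ-≤ (g * length Sl) (*-monoʳ-≤ 2 BX.size≤))))) BY.size≥ ⟩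
              g * length Sl + 2 * m + q * m + (g * length BY.Sl + q * m)
                                             ≡⟨ lem₃ g (length Sl) (2 ^ q) κ q (length BY.Sl) ⟩
              g * (length Sl + length BY.Sl) + suc q * (2 * 2 ^ q * κ) ≡⟨ cong (λ l → g * l + suc q * (2 * 2 ^ q * κ)) len ⟨
              g * length S + suc q * (2 * 2 ^ q * κ) ∎
              where
              lem₂ : ∀ g x k → g * (2 * x * k) ≡ g * (x * k) + g * (x * k)
              lem₂ = solve-∀
              lem₃ : ∀ g s x k q t → g * s + 2 * (x * k) + q * (x * k) + (g * t + q * (x * k)) ≡ g * (s + t) + (1 + q) * (2 * x * k)
              lem₃ = solve-∀

      module Grow (γ K u p b : ℕ) (γ≥1 : 1 ≤ γ) (sparse : SparseAt (not c) γ K Z₀) (U≤ : U ≤ u * 2 ^ γ)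
                  (ω≤b : ω ≤ b) (v≤b : v + γ′ * κ ≤ b) (parts : κ * suc n ≤ 2 ^ p) where

        loss : ℕ
        loss = 1 + 2 * u + 2 * u * γ

        -- Each doubling pays K bits to find the pair and `loss` bits to clean Y. The two halves are
        -- built in different parts of the pair, so the loss is per level and not per slot.
        need : ℕ → ℕ
        need q = p + b + q * (K + loss)

        grow : ∀ q {Z T ℰ} → Context Z T ℰ → 2 ^ need q ≤ length Z →
               2 ^ q * κ + length T ≤ U → 2 ^ q * κ * n + length ℰ ≤ U * n → ¬ ¬ Block γ q Z T ℰ
        grow zero {Z} {T} {ℰ} ctx Z≥ T≤ ℰ≤ none = none (base ctx
          (subst (λ k → k + length T ≤ U) (+-identityʳ κ) T≤) (subst (λ k → k * n + length ℰ ≤ U * n) (+-identityʳ κ) ℰ≤))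
          where
          open ≤-Reasoning
          open Base Z (AllPairs-⊆ (Context.Z⊆ ctx) sZ₀) b (begin
            κ * suc n * 2 ^ b  ≤⟨ *-monoˡ-≤ (2 ^ b) parts ⟩
            2 ^ p * 2 ^ b      ≡⟨ ^-distribˡ-+-* 2 p b ⟨
            2 ^ (p + b)        ≡⟨ cong (2 ^_) (+-identityʳ (p + b)) ⟨
            2 ^ (p + b + 0)    ≤⟨ Z≥ ⟩
            length Z           ∎) ω≤b v≤b
        grow (suc q) {Z} {T} {ℰ} ctx Z≥ T≤ ℰ≤ none =
          sparse (loss + need q) Z (Context.Z⊆ ctx)
            (≤-trans (≤-reflexive (cong (2 ^_) (lem p b q K loss))) Z≥) λ pr →
            grow q (Context-⊆ (Pair.X⊆ pr) ctx)
              (≤-trans (^-monoʳ-≤ 2 (m≤n+m (need q) loss)) (Pair.X≥ pr)) (≤-trans (+-monoˡ-≤ (length T) half) T≤)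
              (≤-trans (+-monoˡ-≤ (length ℰ) (*-monoˡ-≤ n half)) ℰ≤) λ BX →
            second pr BX
              (Pattern.clean (λ σ → rel (not c) (a σ)) γ u (Block.Sl BX) (Pair.Y pr) γ≥1
                (≤-trans (m^n>0 2 (loss + need q)) (Pair.Y≥ pr))
                (λ i → Pair.sparse pr (Block.inZ BX i (inj₁ refl)))
                (≤-trans (Block.size≤ BX) (≤-trans half (≤-trans (≤-trans (m≤m+n _ (length T)) T≤) U≤))))
          where
          lem : ∀ p b q K l → K + (l + (p + b + q * (K + l))) ≡ p + b + (1 + q) * (K + l)
          lem = solve-∀
          half : 2 ^ q * κ ≤ 2 ^ suc q * κ
          half = *-monoˡ-≤ κ (m≤m+n (2 ^ q) _)
          second : (pr : Pair (not c) γ (loss + need q) Z) (BX : Block γ q (Pair.X pr) T ℰ) →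
                   Pattern.Cleared (λ σ → rel (not c) (a σ)) γ u (Block.Sl BX) (Pair.Y pr) → ⊥
          second pr BX cl = grow q context P≥
            (begin
              2 ^ q * κ + length (map a C.T′ ++ T)
                ≡⟨ cong (2 ^ q * κ +_) (≡-trans (length-++ (map a C.T′)) (cong (_+ length T) (length-map a C.T′))) ⟩
              2 ^ q * κ + (length C.T′ + length T)  ≤⟨ +-monoʳ-≤ (2 ^ q * κ) (+-monoˡ-≤ (length T) Sl-≤) ⟩
              2 ^ q * κ + (2 ^ q * κ + length T)    ≡⟨ lem₁ (2 ^ q) κ (length T) ⟩
              2 ^ suc q * κ + length T              ≤⟨ T≤ ⟩
              U ∎)
            (begin
              2 ^ q * κ * n + length (sets C.T′ ++ ℰ)
                ≡⟨ cong (2 ^ q * κ * n +_) (≡-trans (length-++ (sets C.T′)) (cong (_+ length ℰ) (length-sets C.T′))) ⟩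
              2 ^ q * κ * n + (length C.T′ * n + length ℰ) ≤⟨ +-monoʳ-≤ (2 ^ q * κ * n) (+-monoˡ-≤ (length ℰ) (*-monoˡ-≤ n Sl-≤)) ⟩
              2 ^ q * κ * n + (2 ^ q * κ * n + length ℰ) ≡⟨ lem₂ (2 ^ q) κ n (length ℰ) ⟩
              2 ^ suc q * κ * n + length ℰ          ≤⟨ ℰ≤ ⟩
              U * n ∎)
            λ BY → none (merged BY)
            where
            open ≤-Reasoning
            module C = Pattern.Cleared cl
            open Merge ctx (Pair.X⊆ pr) (Pair.Y⊆ pr) (Pair.orient pr) BX C.P⊆ C.T′⊆ C.clear C.few
            P≥ : 2 ^ need q ≤ length C.P
            P≥ = *-cancelˡ-≤ (2 ^ loss) {{m^n≢0 2 loss}} (≤-trans (≤-reflexive (sym (^-distribˡ-+-* 2 loss (need q)))) (≤-trans (Pair.Y≥ pr) C.large))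
            lem₁ : ∀ x k t → x * k + (x * k + t) ≡ 2 * x * k + t
            lem₁ = solve-∀
            lem₂ : ∀ x k n t → x * k * n + (x * k * n + t) ≡ 2 * x * k * n + t
            lem₂ = solve-∀

    -- Greedy embedding

    module Embed (c : Bool) (γ s : ℕ) (Z : List ℕ) (noPair : ¬ Pair c γ s Z) where

      open Host c γ s Z noPair

      earlier : List ℕ → ℕ → ℕ
      earlier []      w = 0
      earlier (v ∷ π) w = if v ≡ᵇ w then 0 else bit (e v w) + earlier π w

      earlier-∷ : ∀ {v w} π → v ≢ w → earlier (v ∷ π) w ≡ bit (e v w) + earlier π w
      earlier-∷ π ne = if-false (≢⇒≡ᵇ ne)

      earlier≤deg : ∀ π w → earlier π w ≤ deg π w
      earlier≤deg []      w = z≤n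
      earlier≤deg (v ∷ π) w rewrite count-∷ (e w) v π | e-sym w v with v ≡ᵇ w
      ... | true  = z≤n
      ... | false = +-monoʳ-≤ (bit (e v w)) (earlier≤deg π w)

      earlier-prefix : ∀ hs ls {w} → w ∈ hs → earlier (hs ++ ls) w ≤ length hs
      earlier-prefix (h ∷ hs) ls {w} i with h ≡ᵇ w in eq
      ... | true = z≤n
      earlier-prefix (h ∷ hs) ls {w} (here refl) | false = ⊥-elim (subst T eq (≡⇒≡ᵇ w w refl))
      earlier-prefix (h ∷ hs) ls {w} (there i) | false = +-mono-≤ (bit≤1 (e h w)) (earlier-prefix hs ls i)

      restrict : ℕ → ℕ → (ℕ → List ℕ) → ℕ → List ℕ
      restrict v x V w = if e v w then filterᵇ (rel c x) (V w) else V w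

      restrict-⊆ : ∀ v x V w → restrict v x V w ⊆ V w
      restrict-⊆ v x V w with e v w
      ... | true  = filterᵇ-⊆ _ (V w)
      ... | false = ⊆-refl

      module _ (k : ℕ) where

        record Embedding (π : List ℕ) (V : ℕ → List ℕ) : Set where
          field
            φ    : ℕ → ℕ
            φ∈   : ∀ {v} → v ∈ π → φ v ∈ V v
            edge : ∀ {v w} → v ∈ π → w ∈ π → v ≢ w → e v w ≡ true → rel c (φ v) (φ w) ≡ true

        -- Each vertex holds γ bits in reserve for every neighbour still to be placed before it.
        -- Placing `v` at a vertex supplied by `pick` shrinks the candidate sets of its neighbours
        -- by at most γ bits, exactly what leaves the reserve.
        embed : ∀ π V → AllPairs _≢_ π → (∀ {v} → v ∈ π → V v ⊆ Z) →
                (∀ {v w} → v ∈ π → w ∈ π → v < w → V v ≪ V w) →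
                (∀ {w} → w ∈ π → 2 ^ (k + γ * earlier π w) ≤ length (V w)) →
                length π * 2 ^ s ≤ 2 ^ k → s ≤ k → Embedding π V
        embed []      V _ _ _ _ _ _ = record { φ = λ v → v ; φ∈ = λ () ; edge = λ () }
        embed (v ∷ π) V (v∉ ∷ dist) V⊆ V≪ V≥ len s≤k = result
          where
          open ≤-Reasoning
          Ys = map V (filterᵇ (e v) π)
          ≢v : ∀ {w} → w ∈ π → v ≢ w
          ≢v = All.lookup v∉
          orient : ∀ {w} → w ∈ π → Oriented (V v) (V w)
          orient {w} i with <-≤-connex v w
          ... | inj₁ lt = inj₁ (V≪ (here refl) (there i) lt)
          ... | inj₂ ge = inj₂ (V≪ (there i) (here refl) (≤∧≢⇒< ge (≢v i ∘ sym)))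
          hY : ∀ {Y} → Y ∈ Ys → Y ⊆ Z × 2 ^ s ≤ length Y × Oriented (V v) Y
          hY i with ∈-map⁻ V i
          ... | w , j , refl with proj₁ (∈-filterᵇ⁻ (e v) {xs = π} j)
          ...   | w∈ = V⊆ (there w∈) , ≤-trans (^-monoʳ-≤ 2 (≤-trans s≤k (m≤m+n k _))) (V≥ (there w∈)) , orient w∈
          few : length Ys * 2 ^ s < length (V v)
          few = begin-strict
            length Ys * 2 ^ s                  ≡⟨ cong (_* 2 ^ s) (length-map V (filterᵇ (e v) π)) ⟩
            count (e v) π * 2 ^ s              ≤⟨ *-monoˡ-≤ (2 ^ s) (count≤length (e v) π) ⟩
            length π * 2 ^ s                   <⟨ m<n+m _ (m^n>0 2 s) ⟩
            2 ^ s + length π * 2 ^ s           ≤⟨ len ⟩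
            2 ^ k                              ≤⟨ ^-monoʳ-≤ 2 (m≤m+n k _) ⟩
            2 ^ (k + γ * earlier (v ∷ π) v)    ≤⟨ V≥ (here refl) ⟩
            length (V v)                       ∎
          module Step (x : ℕ) (x∈ : x ∈ V v) (x-good : ∀ {Y} → Y ∈ Ys → length Y ≤ 2 ^ γ * count (rel c x) Y) where
            V′ = restrict v x V
            V′≡ : ∀ w → e v w ≡ true → V′ w ≡ filterᵇ (rel c x) (V w)
            V′≡ w eq = if-true eq
            big : ∀ {w} → w ∈ π → 2 ^ (k + γ * earlier π w) ≤ length (V′ w)
            big {w} i with e v w in eq
            ... | false = subst (λ z → 2 ^ (k + γ * z) ≤ length (V w))
                            (≡-trans (earlier-∷ π (≢v i)) (cong (λ b → bit b + earlier π w) eq)) (V≥ (there i))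
            ... | true  = *-cancelˡ-≤ (2 ^ γ) {{m^n≢0 2 γ}} (begin
              2 ^ γ * 2 ^ (k + γ * earlier π w)    ≡⟨ ^-distribˡ-+-* 2 γ _ ⟨
              2 ^ (γ + (k + γ * earlier π w))      ≡⟨ cong (2 ^_) (lem γ k (earlier π w)) ⟩
              2 ^ (k + γ * suc (earlier π w))
                ≡⟨ cong (λ z → 2 ^ (k + γ * z)) (≡-trans (earlier-∷ π (≢v i)) (cong (λ b → bit b + earlier π w) eq)) ⟨
              2 ^ (k + γ * earlier (v ∷ π) w)      ≤⟨ V≥ (there i) ⟩
              length (V w)                         ≤⟨ x-good (∈-map⁺ V (∈-filterᵇ⁺ (e v) i eq)) ⟩
              2 ^ γ * length (filterᵇ (rel c x) (V w)) ∎)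
              where lem : ∀ γ k z → γ + (k + γ * z) ≡ k + γ * (1 + z)
                    lem = solve-∀
            extend : Embedding π V′ → Embedding (v ∷ π) V
            extend rest = record { φ = φ ; φ∈ = φ∈ ; edge = edge }
              where
              module R = Embedding rest
              φ : ℕ → ℕ
              φ w = if v ≡ᵇ w then x else R.φ w
              φ-v : φ v ≡ x
              φ-v = if-true (≡ᵇ-refl v)
              φ-π : ∀ {w} → w ∈ π → φ w ≡ R.φ w
              φ-π i = if-false (≢⇒≡ᵇ (≢v i))
              x-edge : ∀ {w} → w ∈ π → e v w ≡ true → rel c x (R.φ w) ≡ true
              x-edge {w} i ee = proj₂ (∈-filterᵇ⁻ (rel c x) {xs = V w} (subst (R.φ w ∈_) (V′≡ w ee) (R.φ∈ i)))
              φ∈ : ∀ {w} → w ∈ v ∷ π → φ w ∈ V w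
              φ∈ (here refl)   = subst (_∈ V v) (sym φ-v) x∈
              φ∈ {w} (there i) = subst (_∈ V w) (sym (φ-π i)) (⊆-∈ (restrict-⊆ v x V w) (R.φ∈ i))
              edge : ∀ {u w} → u ∈ v ∷ π → w ∈ v ∷ π → u ≢ w → e u w ≡ true → rel c (φ u) (φ w) ≡ true
              edge (here refl) (here refl) ne ee = ⊥-elim (ne refl)
              edge (here refl) (there j) ne ee =
                subst₂ (λ a b → rel c a b ≡ true) (sym φ-v) (sym (φ-π j)) (x-edge j ee)
              edge (there i) (here refl) ne ee =
                subst₂ (λ a b → rel c a b ≡ true) (sym (φ-π i)) (sym φ-v)
                  (≡-trans (rel-sym c _ x) (x-edge i (≡-trans (e-sym v _) ee)))
              edge (there i) (there j) ne ee =
                subst₂ (λ a b → rel c a b ≡ true) (sym (φ-π i)) (sym (φ-π j)) (R.edge i j ne ee)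
          result : Embedding (v ∷ π) V
          result with pick (V v) Ys (V⊆ (here refl)) hY few
          ... | x , x∈ , x-good = extend (embed π V′ dist (λ {w} i → ⊆-trans (restrict-⊆ v x V w) (V⊆ (there i)))
            (λ {u} {w} i j lt → ≪-⊆ (restrict-⊆ v x V u) (restrict-⊆ v x V w) (V≪ (there i) (there j) lt))
            big (≤-trans (m≤n+m _ (2 ^ s)) len) s≤k)
            where open Step x x∈ x-good

    -- I stands for the subgraph of e that it induces.
    record Target (ν : ℕ) (I : List ℕ) : Set where
      field
        sorted  : Sorted I
        bounded : ∀ {i} → i ∈ I → i < 2 ^ ν
        small   : length I < 2 ^ ν

    module Degrees (I : List ℕ) (sorted : Sorted I) (d : ℕ) where
      heavy : ℕ → Bool
      heavy v = d ≤ᵇ deg I v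

      hs ls : List ℕ
      hs = filterᵇ heavy I
      ls = filterᵇ (not ∘ heavy) I

      heavy-count : length hs * d ≤ ec I
      heavy-count = markov d (deg I) I

      light-deg : ∀ {v} → v ∈ ls → deg I v < d
      light-deg i = ≤ᵇ-false (not-true⁻ (proj₂ (∈-filterᵇ⁻ (not ∘ heavy) {xs = I} i)))

      split-∈ : ∀ {v} → v ∈ I → v ∈ hs ⊎ v ∈ ls
      split-∈ {v} i with heavy v in eq
      ... | true  = inj₁ (∈-filterᵇ⁺ heavy i eq)
      ... | false = inj₂ (∈-filterᵇ⁺ (not ∘ heavy) i (cong not eq))

      hs-∈ : ∀ {v} → v ∈ hs → v ∈ I
      hs-∈ = proj₁ ∘ ∈-filterᵇ⁻ heavy
      ls-∈ : ∀ {v} → v ∈ ls → v ∈ I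
      ls-∈ = proj₁ ∘ ∈-filterᵇ⁻ (not ∘ heavy)

      order-∈ : ∀ {v} → v ∈ hs ++ ls → v ∈ I
      order-∈ i = [ hs-∈ , ls-∈ ]′ (∈-++⁻ hs i)

      ∈-order : ∀ {v} → v ∈ I → v ∈ hs ++ ls
      ∈-order i = [ ∈-++⁺ˡ , ∈-++⁺ʳ hs ]′ (split-∈ i)

      distinct : ∀ {J} → J ⊆ I → AllPairs _≢_ J
      distinct τ = AllPairs.map (λ lt eq → <-irrefl eq lt) (AllPairs-⊆ τ sorted)

      order-distinct : AllPairs _≢_ (hs ++ ls)
      order-distinct = AllPairs-++ hs (distinct (filterᵇ-⊆ heavy I)) (distinct (filterᵇ-⊆ (not ∘ heavy) I))
        λ { {x} i j refl → true≢false (proj₂ (∈-filterᵇ⁻ heavy {xs = I} i)) (not-true⁻ (proj₂ (∈-filterᵇ⁻ (not ∘ heavy) {xs = I} j))) }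
        where true≢false : ∀ {b} → b ≡ true → b ≡ false → ⊥
              true≢false {true} _ ()

      order-length : length (hs ++ ls) ≡ length I
      order-length = ≡-trans (length-++ hs) (count-not heavy I)

      order-deg : ∀ v → deg (hs ++ ls) v ≡ deg I v
      order-deg v = ≡-trans (count-++ (e v) hs ls) (go I)
        where
        go : ∀ J → count (e v) (filterᵇ heavy J) + count (e v) (filterᵇ (not ∘ heavy) J) ≡ count (e v) J
        go []      = refl
        go (j ∷ J) with heavy j
        ... | true  rewrite count-∷ (e v) j (filterᵇ heavy J) | count-∷ (e v) j J =
          ≡-trans (+-assoc (bit (e v j)) _ _) (cong (bit (e v j) +_) (go J))
        ... | false rewrite count-∷ (e v) j (filterᵇ (not ∘ heavy) J) | count-∷ (e v) j J =
          ≡-trans (lem (count (e v) (filterᵇ heavy J)) (bit (e v j)) _) (cong (bit (e v j) +_) (go J))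
          where lem : ∀ a b c → a + (b + c) ≡ b + (a + c)
                lem = solve-∀

    -- Embedding the vertices of degree at least r first, every vertex has at most r earlier neighbours.
    greedy : ∀ c I Z₀ γ ν r → Sorted Z₀ → Target ν I → ec I ≤ r * r → 1 ≤ r → ¬ Copy c I Z₀ →
             SparseAt c γ (2 * ν + γ * r) Z₀
    greedy c I Z₀ γ ν r sZ₀ tI ecI r≥1 noCopy s Z Z⊆ Z≥ noPair = noCopy (record
      { φ = E.φ
      ; φ∈ = λ {i} i∈ → ⊆-∈ Z⊆ (⊆-∈ (piece-⊆ Z b i) (E.φ∈ (∈-order i∈)))
      ; mono = λ i∈ j∈ lt → below (piece-≪ b sZ lt) (E.φ∈ (∈-order i∈)) (E.φ∈ (∈-order j∈))
      ; edge = λ i∈ j∈ lt → E.edge (∈-order i∈) (∈-order j∈) (λ eq → <-irrefl eq lt) })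
      where
      open Embed c γ s Z noPair
      open Target tI
      open Degrees I sorted r
      sZ = AllPairs-⊆ Z⊆ sZ₀
      -- One ν pays for giving each of the possible 2 ^ ν vertices its own piece of Z, the other for
      -- the union bound over the neighbours still to be placed.
      b = 2 ^ (ν + s + γ * r)
      room : 2 ^ ν * b ≤ length Z
      room = ≤-trans (≤-reflexive (≡-trans (sym (^-distribˡ-+-* 2 ν (ν + s + γ * r))) (cong (2 ^_) (lem ν s (γ * r))))) Z≥
        where lem : ∀ ν s z → ν + (ν + s + z) ≡ 2 * ν + z + s
              lem = solve-∀
      hs≤ : length hs ≤ r
      hs≤ = *-cancelʳ-≤ _ _ r {{>-nonZero r≥1}} (≤-trans heavy-count ecI)
      earlier≤ : ∀ {w} → w ∈ hs ++ ls → earlier (hs ++ ls) w ≤ r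
      earlier≤ {w} i with ∈-++⁻ hs i
      ... | inj₁ j = ≤-trans (earlier-prefix hs ls j) hs≤
      ... | inj₂ j = ≤-trans (earlier≤deg (hs ++ ls) w) (≤-trans (≤-reflexive (order-deg w)) (<⇒≤ (light-deg j)))
      emb : Embedding (ν + s) (hs ++ ls) (piece Z b)
      emb = embed (ν + s) (hs ++ ls) (piece Z b) order-distinct (λ {v} _ → piece-⊆ Z b v)
        (λ _ _ lt → piece-≪ b sZ lt)
        (λ {w} i → ≤-trans (^-monoʳ-≤ 2 (+-monoʳ-≤ (ν + s) (*-monoʳ-≤ γ (earlier≤ i))))
                     (≤-reflexive (sym (piece-length Z b (bounded (order-∈ i)) room))))
        (≤-trans (*-monoˡ-≤ (2 ^ s) (≤-trans (≤-reflexive order-length) (<⇒≤ small))) (≤-reflexive (sym (^-distribˡ-+-* 2 ν s))))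
        (m≤n+m s ν)
      module E = Embedding emb

    -- Placing a target on a clique with reserved sets

    module Assemble (c : Bool) (γ′ s ν δ : ℕ) (Z : List ℕ) (noPair : ¬ Pair c γ′ s Z) (sZ : Sorted Z)
                    (I : List ℕ) (tI : Target ν I) where

      open Embed c γ′ s Z noPair
      open Nbhd (rel c)
      open Slots c γ′ s Z noPair sZ δ (2 ^ ν)
      open Slot
      open Target tI
      open Degrees I sorted δ

      -- A heavy vertex takes the clique vertex of its slot, and the light vertices preceding it,
      -- back to the previous heavy one, use reserved sets of the same slot. Light vertices behind
      -- the last heavy one need a further slot, so `enough` is strict.
      assemble : (Sl : List Slot) → length hs < length Sl →
                 (∀ {σ j} → σ ∈ Sl → j < 2 ^ ν → W σ j ⊆ Z) →
                 (∀ {σ x} → σ ∈ Sl → In σ x → x ∈ Z) →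
                 (∀ {σ j} → σ ∈ Sl → j < 2 ^ ν → 2 ^ (ν + s + 2 * (γ′ * δ)) ≤ length (W σ j)) →
                 (∀ {σ i j} → σ ∈ Sl → i < j → j < 2 ^ ν → W σ i ≪ W σ j) →
                 (∀ {σ j y} → σ ∈ Sl → j < 2 ^ ν → y ∈ W σ j → y < a σ) →
                 AllPairs Linked Sl → Good (map a Sl) (sets Sl) → Copy c I Z
      assemble Sl enough W⊆ inZ W≥ W≪ W<a linked good = record { φ = φ ; φ∈ = φ∈ ; mono = mono ; edge = edge }
        where
        open ≤-Reasoning
        heavy-before : ℕ → ℕ → Bool
        heavy-before v h = (h <ᵇ v) ∧ heavy h
        idx : ℕ → ℕ
        idx v = count (heavy-before v) I
        idx< : ∀ v → idx v < length Sl
        idx< v = ≤-<-trans (count-mono (heavy-before v) heavy I (λ _ p → proj₂ (∧-true p))) enough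
        idx-mono : ∀ {u v} → u < v → idx u ≤ idx v
        idx-mono {u} {v} lt = count-mono (heavy-before u) (heavy-before v) I λ {h} _ p →
          cong₂ _∧_ (<ᵇ-true⁺ (<-trans (<ᵇ-true⁻ {h} {u} (proj₁ (∧-true p))) lt)) (proj₂ (∧-true p))
        idx-strict : ∀ {u v} → u ∈ hs → u < v → idx u < idx v
        idx-strict {u} {v} i lt = count-strict (heavy-before u) (heavy-before v) I
          (λ h p → cong₂ _∧_ (<ᵇ-true⁺ (<-trans (<ᵇ-true⁻ {h} {u} (proj₁ (∧-true p))) lt)) (proj₂ (∧-true p)))
          (hs-∈ i) (not-false λ p → <-irrefl refl (<ᵇ-true⁻ {u} {u} (proj₁ (∧-true p))))
          (cong₂ _∧_ (<ᵇ-true⁺ lt) (proj₂ (∈-filterᵇ⁻ heavy {xs = I} i)))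
        place : ℕ → Slot
        place v = nth (slot (λ _ → []) 0) Sl (idx v)
        place-∈ : ∀ v → place v ∈ Sl
        place-∈ v = nth-∈ _ Sl (idx< v)
        place-linked : ∀ {u v} → idx u < idx v → Linked (place u) (place v)
        place-linked {u} {v} lt = nth-pairs _ linked lt (idx< v)
        as : List ℕ
        as = map a Sl
        as-sorted : AllPairs _<_ as
        as-sorted = AllPairs-map⁺ (AllPairs.map (λ {σ} {σ′} l → proj₁ l (a σ) (a σ′) (inj₁ refl) (inj₁ refl)) linked)
        joins : ℕ → ℕ → ℕ → Bool
        joins v x h = (heavy h ∧ e v h) ∧ (a (place h) ≡ᵇ x)
        hit : ℕ → ℕ → Bool
        hit v x = 1 ≤ᵇ count (joins v x) I
        -- The images of the heavy neighbours of v, obtained as a filter of `as` because `Good`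
        -- speaks of sublists.
        Q : ℕ → List ℕ
        Q v = filterᵇ (hit v) as
        Q-length : ∀ v → length (Q v) ≤ deg I v
        Q-length v = begin
          count (hit v) as                            ≡⟨ *-identityʳ _ ⟨
          count (hit v) as * 1                        ≤⟨ markov 1 (λ x → count (joins v x) I) as ⟩
          Σ[ as ] (λ x → count (joins v x) I)         ≡⟨ double-count (joins v) as I ⟩
          Σ[ I ] (λ h → count (λ x → joins v x h) as) ≤⟨ Σ-mono I (λ {h} _ → once h) ⟩
          Σ[ I ] (λ h → bit (e v h))                  ≡⟨ count-Σ (e v) I ⟨
          deg I v                                     ∎
          where
          once : ∀ h → count (λ x → joins v x h) as ≤ bit (e v h)
          once h with e v h in eq
          ... | true  = ≤-trans (count-mono (λ x → (heavy h ∧ true) ∧ (a (place h) ≡ᵇ x)) (a (place h) ≡ᵇ_) as (λ _ p → proj₂ (∧-true p))) (count-≡ᵇ (a (place h)) as-sorted)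
          ... | false = ≤-reflexive (count-none _ as λ {x} _ → not-false (λ p → false≢true (proj₂ (∧-true (proj₁ (∧-true {heavy h ∧ false} p))))))
            where false≢true : false ≢ true
                  false≢true ()
        V : ℕ → List ℕ
        V v = nb (Q v) (W (place v) v)
        V⊆W : ∀ v → V v ⊆ W (place v) v
        V⊆W v = nb-⊆ (Q v) (W (place v) v)
        bd : ∀ {v} → v ∈ ls → v < 2 ^ ν
        bd i = bounded (ls-∈ i)
        V≪ : ∀ {u w} → u ∈ ls → w ∈ ls → u < w → V u ≪ V w
        V≪ {u} {w} i j lt with m≤n⇒m<n∨m≡n (idx-mono lt)
        ... | inj₁ l  = ≪-intro λ {x} {y} p q → proj₁ (place-linked {u} {w} l) x y
                (inj₂ (u , bd i , ⊆-∈ (V⊆W u) p)) (inj₂ (w , bd j , ⊆-∈ (V⊆W w) q))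
        ... | inj₂ eq = ≪-⊆ (V⊆W u) (V⊆W w) (subst (λ k → W (nth _ Sl (idx u)) u ≪ W (nth _ Sl k) w) eq (W≪ (place-∈ u) lt (bd j)))
        -- A light vertex has at most δ heavy and at most δ earlier light neighbours. `Good` charges
        -- γ′ bits for each of the former, `embed` for each of the latter, whence `2 * (γ′ * δ)`.
        V≥ : ∀ {w} → w ∈ ls → 2 ^ (ν + s + γ′ * earlier ls w) ≤ length (V w)
        V≥ {w} i = *-cancelˡ-≤ (2 ^ k) {{m^n≢0 2 k}} (begin
          2 ^ k * 2 ^ (ν + s + γ′ * earlier ls w)   ≡⟨ ^-distribˡ-+-* 2 k _ ⟨
          2 ^ (k + (ν + s + γ′ * earlier ls w))     ≤⟨ ^-monoʳ-≤ 2 (+-mono-≤ (*-monoʳ-≤ γ′ Q≤δ) (+-monoʳ-≤ (ν + s) (*-monoʳ-≤ γ′ ear≤δ))) ⟩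
          2 ^ (γ′ * δ + (ν + s + γ′ * δ))           ≡⟨ cong (2 ^_) (lem (γ′ * δ) (ν + s)) ⟩
          2 ^ (ν + s + 2 * (γ′ * δ))                ≤⟨ W≥ (place-∈ w) (bd i) ⟩
          length (W (place w) w)                    ≤⟨ good (∈-sets⁺ Sl (place-∈ w) (bd i)) (filterᵇ-⊆ (hit w) as) Q≤δ ⟩
          2 ^ k * length (V w)                      ∎)
          where
          k = γ′ * length (Q w)
          Q≤δ : length (Q w) ≤ δ
          Q≤δ = ≤-trans (Q-length w) (<⇒≤ (light-deg i))
          ear≤δ : earlier ls w ≤ δ
          ear≤δ = ≤-trans (earlier≤deg ls w) (≤-trans (count-⊆ (e w) (filterᵇ-⊆ (not ∘ heavy) I)) (<⇒≤ (light-deg i)))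
          lem : ∀ x y → x + (y + x) ≡ y + 2 * x
          lem = solve-∀
        emb : Embedding (ν + s) ls V
        emb = embed (ν + s) ls V (distinct (filterᵇ-⊆ (not ∘ heavy) I)) (λ {v} i → ⊆-trans (V⊆W v) (W⊆ (place-∈ v) (bd i))) V≪ V≥
          (≤-trans (*-monoˡ-≤ (2 ^ s) (≤-trans (count≤length (not ∘ heavy) I) (<⇒≤ small))) (≤-reflexive (sym (^-distribˡ-+-* 2 ν s)))) (m≤n+m s ν)
        module E = Embedding emb
        φ : ℕ → ℕ
        φ v = if heavy v then a (place v) else E.φ v
        φ-heavy : ∀ {v} → v ∈ hs → φ v ≡ a (place v)
        φ-heavy i = if-true (proj₂ (∈-filterᵇ⁻ heavy {xs = I} i))
        φ-light : ∀ {v} → v ∈ ls → φ v ≡ E.φ v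
        φ-light i = if-false (not-true⁻ (proj₂ (∈-filterᵇ⁻ (not ∘ heavy) {xs = I} i)))
        φ-W : ∀ {v} → v ∈ ls → φ v ∈ W (place v) v
        φ-W {v} i = subst (_∈ W (place v) v) (sym (φ-light i)) (⊆-∈ (V⊆W v) (E.φ∈ i))
        φ-In : ∀ {v} → v ∈ I → In (place v) (φ v)
        φ-In {v} i = [ (λ h → inj₁ (φ-heavy h)) , (λ l → inj₂ (v , bounded i , φ-W l)) ]′ (split-∈ i)
        φ∈ : ∀ {v} → v ∈ I → φ v ∈ Z
        φ∈ {v} i = inZ (place-∈ v) (φ-In i)
        apart : ∀ {u v} → u ∈ I → v ∈ I → idx u < idx v → φ u < φ v
        apart {u} {v} i j lt = proj₁ (place-linked {u} {v} lt) (φ u) (φ v) (φ-In i) (φ-In j)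
        mono : ∀ {u v} → u ∈ I → v ∈ I → u < v → φ u < φ v
        mono {u} {v} i j lt = [ (λ h → apart i j (idx-strict h lt))
                              , (λ l → [ apart i j , (λ eq → [ same-heavy l eq , same-light l eq ]′ (split-∈ j)) ]′ (m≤n⇒m<n∨m≡n (idx-mono lt))) ]′ (split-∈ i)
          where
          moved : u ∈ ls → idx u ≡ idx v → φ u ∈ W (place v) u
          moved l eq = subst (λ k → φ u ∈ W (nth _ Sl k) u) eq (φ-W l)
          same-heavy : u ∈ ls → idx u ≡ idx v → v ∈ hs → φ u < φ v
          same-heavy l eq h = subst (φ u <_) (sym (φ-heavy h)) (W<a (place-∈ v) (bd l) (moved l eq))
          same-light : u ∈ ls → idx u ≡ idx v → v ∈ ls → φ u < φ v
          same-light l eq l′ = below (W≪ (place-∈ v) lt (bd l′)) (moved l eq) (φ-W l′)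
        cross : ∀ {u v} → u ∈ hs → v ∈ ls → e v u ≡ true → rel c (φ u) (φ v) ≡ true
        cross {u} {v} h l ee = subst₂ (λ x y → rel c x y ≡ true) (sym (φ-heavy h)) (sym (φ-light l))
          (nb-∈ {Q v} {W (place v) v} (E.φ∈ l) (∈-filterᵇ⁺ (hit v) (∈-map⁺ a (place-∈ u))
            (Equivalence.to T-≡ (≤⇒≤ᵇ (count-∈ (joins v (a (place u))) I (hs-∈ h)
              (cong₂ _∧_ (cong₂ _∧_ (proj₂ (∈-filterᵇ⁻ heavy {xs = I} h)) ee) (≡ᵇ-refl (a (place u)))))))))
        edge : ∀ {u v} → u ∈ I → v ∈ I → u < v → e u v ≡ true → rel c (φ u) (φ v) ≡ true
        edge {u} {v} i j lt ee = [ (λ h → [ hh h , (λ l′ → cross h l′ (≡-trans (e-sym v u) ee)) ]′ (split-∈ j))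
                                 , (λ l → [ (λ h′ → ≡-trans (rel-sym c (φ u) (φ v)) (cross h′ l ee)) , ll l ]′ (split-∈ j)) ]′ (split-∈ i)
          where
          hh : u ∈ hs → v ∈ hs → rel c (φ u) (φ v) ≡ true
          hh h h′ = subst₂ (λ x y → rel c x y ≡ true) (sym (φ-heavy h)) (sym (φ-heavy h′)) (proj₂ (place-linked {u} {v} (idx-strict h lt)))
          ll : u ∈ ls → v ∈ ls → rel c (φ u) (φ v) ≡ true
          ll l l′ = subst₂ (λ x y → rel c x y ≡ true) (sym (φ-light l)) (sym (φ-light l′)) (E.edge l l′ (λ eq → <-irrefl eq lt) ee)

    -- A c-coloured clique with reserved sets is grown by repeated doubling inside sparse pairs, and I is placed on it.
    amplify : ∀ c I Z₀ γ′ K ν a δ → Sorted Z₀ → Target ν I → ec I ≤ (2 ^ a * δ) * (2 ^ a * δ) → 1 ≤ δ → δ ≤ 2 ^ ν →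
              SparseAt (not c) (2 + 2 * a) K Z₀ → ¬ Copy c I Z₀ → SparseAt c γ′ (ampCost ν a δ γ′ K) Z₀
    amplify c I Z₀ γ′ K ν a δ sZ₀ tI ecI δ≥1 δ≤ sparse noCopy s Z Z⊆ Z≥ noPair =
      grow γ context Z≥′ (≤-reflexive (+-identityʳ U)) (≤-reflexive (+-identityʳ (U * n))) finish
      where
      open ≤-Reasoning
      γ = 2 + 2 * a
      n = 2 ^ ν
      -- Four times 4 ^ a δ, the maximal number of vertices of degree at least δ. Half of the slots
      -- may be lost, and strictly more than 4 ^ a δ must remain.
      U = 2 ^ γ * δ
      x = γ′ * δ
      ω = ν + s + 2 * x
      -- Chosen for `room`: at most U n reserved sets, with at most 2 ^ (2 δ + γ δ) tests each, and
      -- two bits to spare for the pools and for strictness.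
      v = s + (γ + 2 * ν + 2 * δ + γ * δ + 2)
      b = v + 3 * x
      sZ : Sorted Z
      sZ = AllPairs-⊆ Z⊆ sZ₀
      shortSublists≤ : ∀ (T : List ℕ) → length T ≤ U → length (shortSublists δ T) ≤ 2 ^ (2 * δ + γ * δ)
      shortSublists≤ T T≤ = shortSublists-bound (1 + 2 * a) δ δ T (≤-trans T≤ (≤-reflexive (*-comm (2 ^ γ) δ)))
      pow : ∀ i j → 2 ^ i * 2 ^ j ≡ 2 ^ (i + j)
      pow i j = sym (^-distribˡ-+-* 2 i j)
      room : ∀ (T : List ℕ) → length T ≤ U → (δ + U * n * length (shortSublists δ T)) * 2 ^ s < 2 ^ v
      room T T≤ = begin-strict
        (δ + U * n * length (shortSublists δ T)) * 2 ^ s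
          ≤⟨ *-monoˡ-≤ (2 ^ s) (+-mono-≤ (≤-trans δ≤ (^-monoʳ-≤ 2 ν≤w)) big) ⟩
        (2 ^ w + 2 ^ w) * 2 ^ s     ≡⟨ cong (_* 2 ^ s) (cong (2 ^ w +_) (+-identityʳ (2 ^ w))) ⟨
        2 ^ suc w * 2 ^ s           ≡⟨ pow (suc w) s ⟩
        2 ^ (suc w + s)             <⟨ ^-monoʳ-< 2 (s≤s (s≤s z≤n)) (≤-reflexive (lem₁ γ ν δ (γ * δ) s)) ⟩
        2 ^ v                       ∎
        where
        w = γ + ν + ν + (2 * δ + γ * δ)
        ν≤w : ν ≤ w
        ν≤w = ≤-trans (m≤n+m ν (γ + ν)) (m≤m+n (γ + ν + ν) _)
        big : U * n * length (shortSublists δ T) ≤ 2 ^ w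
        big = begin
          2 ^ γ * δ * 2 ^ ν * length (shortSublists δ T)                 ≤⟨ *-mono-≤ (*-monoˡ-≤ (2 ^ ν) (*-monoʳ-≤ (2 ^ γ) δ≤)) (shortSublists≤ T T≤) ⟩
          2 ^ γ * 2 ^ ν * 2 ^ ν * 2 ^ (2 * δ + γ * δ)           ≡⟨ cong (λ z → z * 2 ^ ν * 2 ^ (2 * δ + γ * δ)) (pow γ ν) ⟩
          2 ^ (γ + ν) * 2 ^ ν * 2 ^ (2 * δ + γ * δ)             ≡⟨ cong (_* 2 ^ (2 * δ + γ * δ)) (pow (γ + ν) ν) ⟩
          2 ^ (γ + ν + ν) * 2 ^ (2 * δ + γ * δ)                 ≡⟨ pow (γ + ν + ν) _ ⟩
          2 ^ w ∎
        lem₁ : ∀ γ ν δ y s → 1 + (1 + (γ + ν + ν + (2 * δ + y)) + s) ≡ s + (γ + 2 * ν + 2 * δ + y + 2)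
        lem₁ = solve-∀
      ω≥ : s + γ′ * δ ≤ ω
      ω≥ = ≤-trans (m≤m+n (s + x) (ν + x)) (≤-reflexive (lem s x ν))
        where lem : ∀ s x ν → s + x + (ν + x) ≡ ν + s + 2 * x
              lem = solve-∀
      ω≤b : ω ≤ b
      ω≤b = ≤-trans (m≤m+n ω (γ + ν + 2 * δ + γ * δ + 2 + x)) (≤-reflexive (lem γ ν δ (γ * δ) s x))
        where lem : ∀ γ ν δ y s x → ν + s + 2 * x + (γ + ν + 2 * δ + y + 2 + x) ≡ s + (γ + 2 * ν + 2 * δ + y + 2) + 3 * x
              lem = solve-∀
      parts : δ * suc n ≤ 2 ^ (2 * ν + 1)
      parts = begin
        δ * suc n           ≤⟨ *-mono-≤ δ≤ (+-monoˡ-≤ n (m^n>0 2 ν)) ⟩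
        2 ^ ν * (n + n)     ≡⟨ cong (λ z → 2 ^ ν * (n + z)) (+-identityʳ n) ⟨
        2 ^ ν * 2 ^ suc ν   ≡⟨ pow ν (suc ν) ⟩
        2 ^ (ν + suc ν)     ≡⟨ cong (2 ^_) (lem ν) ⟩
        2 ^ (2 * ν + 1)     ∎
        where lem : ∀ ν → ν + (1 + ν) ≡ 2 * ν + 1
              lem = solve-∀
      open Slots c γ′ s Z noPair sZ δ n
      open Cliques c γ′ s Z noPair sZ δ n δ U ω v ω≥ (m≤m+n s _) room
      open Growth.Grow c γ′ s Z noPair sZ δ n δ U ω v ω≥ (m≤m+n s _) room γ K δ (2 * ν + 1) b (s≤s z≤n) (SparseAt-⊆ {not c} {γ} {K} Z⊆ sparse) (≤-reflexive (*-comm (2 ^ γ) δ))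
        ω≤b (+-monoʳ-≤ v (m≤m+n x _)) parts
      context : Context Z [] []
      context = record { Z⊆ = ⊆-refl ; complete = λ () ; ℰ⊆ = λ () ; ℰ≥ = λ () ; orient = λ () ; good = λ () }
      Z≥′ : 2 ^ need γ ≤ length Z
      Z≥′ = ≤-trans (≤-reflexive (cong (2 ^_) (lem ν s (γ + 2 * ν + 2 * δ + γ * δ + 2) x (γ * (K + (1 + 2 * δ + 2 * δ * γ)))))) Z≥
        where lem : ∀ ν s y x z → 2 * ν + 1 + (s + y + 3 * x) + z ≡ 2 * ν + 1 + (y + 3 * x) + z + s
              lem = solve-∀
      open Degrees I (Target.sorted tI) δ
      hs≤ : length hs ≤ 2 ^ a * 2 ^ a * δ
      hs≤ = *-cancelʳ-≤ _ _ δ {{>-nonZero δ≥1}} (≤-trans heavy-count (≤-trans ecI (≤-reflexive (lem (2 ^ a) δ))))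
        where lem : ∀ A δ → A * δ * (A * δ) ≡ A * A * δ * δ
              lem = solve-∀
      U≡ : U ≡ 2 * (2 * (2 ^ a * 2 ^ a * δ))
      U≡ = ≡-trans (cong (λ z → 2 * (2 * 2 ^ z) * δ) (cong (a +_) (+-identityʳ a))) (≡-trans (cong (λ z → 2 * (2 * z) * δ) (^-distribˡ-+-* 2 a a)) (lem (2 ^ a * 2 ^ a) δ))
        where lem : ∀ A δ → 2 * (2 * A) * δ ≡ 2 * (2 * (A * δ))
              lem = solve-∀
      enough : (B : Block γ γ Z [] []) → length hs < length (Block.Sl B)
      enough B = begin-strict
        length hs            ≤⟨ hs≤ ⟩
        half                    <⟨ m<m+n half (*-mono-≤ (*-mono-≤ (m^n>0 2 a) (m^n>0 2 a)) δ≥1) ⟩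
        half + half                ≡⟨ cong (half +_) (+-identityʳ half) ⟨
        2 * half                ≤⟨ *-cancelˡ-≤ 2 (≤-trans (≤-reflexive (sym U≡)) U≤2S) ⟩
        length (Block.Sl B)  ∎
        where
        half = 2 ^ a * 2 ^ a * δ
        g = 2 ^ γ
        S = length (Block.Sl B)
        U≤2S : U ≤ 2 * S
        U≤2S = *-cancelˡ-≤ g {{m^n≢0 2 γ}} (+-cancelʳ-≤ (g * U) _ _ (begin
          g * U + g * U                ≡⟨ lem₁ (g * U) ⟩
          2 * (g * U)                  ≤⟨ *-monoʳ-≤ 2 (Block.size≥ B) ⟩
          2 * (g * S + γ * U)          ≡⟨ lem₂ g S γ U ⟩
          g * (2 * S) + 2 * γ * U      ≤⟨ +-monoʳ-≤ (g * (2 * S)) (*-monoˡ-≤ U (twice-≤-power a)) ⟩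
          g * (2 * S) + g * U          ∎))
          where
          lem₁ : ∀ x → x + x ≡ 2 * x
          lem₁ = solve-∀
          lem₂ : ∀ g S γ U → 2 * (g * S + γ * U) ≡ g * (2 * S) + 2 * γ * U
          lem₂ = solve-∀
      finish : Block γ γ Z [] [] → ⊥
      finish B = noCopy (Copy-⊆ Z⊆ (assemble B.Sl (enough B) B.W⊆ B.inZ B.W≥ B.W≪ B.W<a B.linked
        (subst₂ Good (++-identityʳ _) (++-identityʳ _) B.good)))
        where
        module B = Block B
        open Assemble c γ′ s ν δ Z noPair sZ I tI

    -- Halving the targets

    edges : List ℕ → List ℕ → ℕ
    edges I J = Σ[ I ] (λ v → count (e v) J)

    edges-++ʳ : ∀ I J K → edges I (J ++ K) ≡ edges I J + edges I K
    edges-++ʳ I J K = ≡-trans (Σ-cong I (λ v → count-++ (e v) J K)) (Σ-+ I _ _)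

    edges-++ˡ : ∀ I J K → edges (I ++ J) K ≡ edges I K + edges J K
    edges-++ˡ I J K = Σ-++ I J _

    ec-++ : ∀ I J → ec (I ++ J) ≡ edges I I + edges I J + (edges J I + edges J J)
    ec-++ I J = ≡-trans (edges-++ˡ I J (I ++ J)) (cong₂ _+_ (edges-++ʳ I I J) (edges-++ʳ J I J))

    -- The two parts share only v, and `e` is irreflexive, so no edge is counted twice. Hence when
    -- the prefix up to v spans more than half of the edges, the suffix starting at v spans less
    -- than half.
    ec-overlap : ∀ A v B → ec (A ++ v ∷ []) + ec (v ∷ B) ≤ ec (A ++ v ∷ B)
    ec-overlap A v B = begin
      ec (A ++ V) + ec (V ++ B)
        ≡⟨ cong₂ _+_ (ec-++ A V) (ec-++ V B) ⟩
      AA + AV + (VA + VV) + (VV + VB + (BV + BB))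
        ≡⟨ cong (λ z → AA + AV + (VA + z) + (z + VB + (BV + BB))) VV≡0 ⟩
      AA + AV + (VA + 0) + (0 + VB + (BV + BB))
        ≤⟨ m≤m+n _ (AB + BA) ⟩
      AA + AV + (VA + 0) + (0 + VB + (BV + BB)) + (AB + BA)
        ≡⟨ lem AA AV VA VB BV BB AB BA ⟩
      AA + (AV + AB) + ((VA + BA) + (0 + VB + (BV + BB)))
        ≡⟨ cong (λ z → AA + (AV + AB) + ((VA + BA) + (z + VB + (BV + BB)))) VV≡0 ⟨
      AA + (AV + AB) + ((VA + BA) + (VV + VB + (BV + BB)))
        ≡⟨ cong₂ _+_ (cong (AA +_) (edges-++ʳ A V B)) (cong₂ _+_ (edges-++ˡ V B A) (ec-++ V B)) ⟨
      AA + edges A (V ++ B) + (edges (V ++ B) A + edges (V ++ B) (V ++ B))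
        ≡⟨ ec-++ A (V ++ B) ⟨
      ec (A ++ V ++ B) ∎
      where
      open ≤-Reasoning
      V = v ∷ []
      AA = edges A A
      AV = edges A V
      AB = edges A B
      VA = edges V A
      VV = edges V V
      VB = edges V B
      BA = edges B A
      BV = edges B V
      BB = edges B B
      VV≡0 : VV ≡ 0
      VV≡0 = ≡-trans (+-identityʳ _) (≡-trans (count-∷ (e v) v []) (cong (λ b → bit b + 0) (e-irr v)))
      lem : ∀ a b c d f g x y → a + b + (c + 0) + (0 + d + (f + g)) + (x + y) ≡ a + (b + x) + ((c + y) + (0 + d + (f + g)))
      lem = solve-∀

    Halves : List ℕ → Set
    Halves I = Σ (List ℕ) λ A → Σ (List ℕ) λ B → (I ≡ A ++ B) × (2 * ec A ≤ ec I) × (2 * ec B ≤ ec I)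

    -- Cut after the longest prefix spanning at most half of the edges; the next vertex goes right.
    halve : ∀ I → Halves I
    halve I = go [] I refl z≤n
      where
      go : ∀ A B → I ≡ A ++ B → 2 * ec A ≤ ec I → Halves I
      go A []      eq le = A , [] , eq , le , z≤n
      go A (v ∷ B) eq le with 2 * ec (A ++ v ∷ []) ≤? ec I
      ... | yes le′ = go (A ++ v ∷ []) B (≡-trans eq (sym (++-assoc′ A (v ∷ []) B))) le′
      ... | no  gt  = A , v ∷ B , eq , le , +-cancelˡ-≤ (ec I) _ _ (begin
        ec I + 2 * ec (v ∷ B)                    ≤⟨ +-monoˡ-≤ _ (<⇒≤ (≰⇒> gt)) ⟩
        2 * ec (A ++ v ∷ []) + 2 * ec (v ∷ B)    ≡⟨ *-distribˡ-+ 2 (ec (A ++ v ∷ [])) (ec (v ∷ B)) ⟨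
        2 * (ec (A ++ v ∷ []) + ec (v ∷ B))      ≤⟨ *-monoʳ-≤ 2 (ec-overlap A v B) ⟩
        2 * ec (A ++ v ∷ B)                      ≡⟨ cong (λ J → 2 * ec J) eq ⟨
        2 * ec I                                 ≡⟨ cong (ec I +_) (+-identityʳ (ec I)) ⟩
        ec I + ec I                              ∎)
        where open ≤-Reasoning

    Target-⊆ : ∀ {ν I J} → J ⊆ I → Target ν I → Target ν J
    Target-⊆ τ t = record
      { sorted = AllPairs-⊆ τ (Target.sorted t) ; bounded = λ i → Target.bounded t (⊆-∈ τ i)
      ; small = ≤-<-trans (length-mono-≤ τ) (Target.small t) }

    Copy-++ : ∀ {c A B X Y Z} → Sorted (A ++ B) → X ⊆ Z → Y ⊆ Z → X ≪ Y →
              (p : Copy c A X) (q : Copy c B Y) →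
              (∀ {i j} → i ∈ A → j ∈ B → rel c (Copy.φ p i) (Copy.φ q j) ≡ true) → Copy c (A ++ B) Z
    Copy-++ {c} {A} {B} {X} {Y} {Z} sAB X⊆ Y⊆ X≪Y p q cross = record
      { φ = φ
      ; φ∈ = λ i → cases i (λ a → subst (_∈ Z) (sym (φ-A a)) (⊆-∈ X⊆ (P.φ∈ a))) (λ b → subst (_∈ Z) (sym (φ-B b)) (⊆-∈ Y⊆ (Q.φ∈ b)))
      ; mono = λ {i} {j} i∈ j∈ lt → cases i∈
          (λ a → cases j∈ (λ a′ → subst₂ _<_ (sym (φ-A a)) (sym (φ-A a′)) (P.mono a a′ lt))
                          (λ b → subst₂ _<_ (sym (φ-A a)) (sym (φ-B b)) (below X≪Y (P.φ∈ a) (Q.φ∈ b))))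
          (λ b → cases j∈ (λ a → ⊥-elim (<-asym lt (A<B sAB a b)))
                          (λ b′ → subst₂ _<_ (sym (φ-B b)) (sym (φ-B b′)) (Q.mono b b′ lt)))
      ; edge = λ {i} {j} i∈ j∈ lt ee → cases i∈
          (λ a → cases j∈ (λ a′ → colour (φ-A a) (φ-A a′) (P.edge a a′ lt ee))
                          (λ b → colour (φ-A a) (φ-B b) (cross a b)))
          (λ b → cases j∈ (λ a → ⊥-elim (<-asym lt (A<B sAB a b)))
                          (λ b′ → colour (φ-B b) (φ-B b′) (Q.edge b b′ lt ee))) }
      where
      module P = Copy p
      module Q = Copy q
      cases : ∀ {i} {R : Set} → i ∈ A ++ B → (i ∈ A → R) → (i ∈ B → R) → R
      cases i f g = [ f , g ]′ (∈-++⁻ A i)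
      colour : ∀ {x y x′ y′} → x ≡ x′ → y ≡ y′ → rel c x′ y′ ≡ true → rel c x y ≡ true
      colour refl refl h = h
      A<B : ∀ {A} → Sorted (A ++ B) → ∀ {i j} → i ∈ A → j ∈ B → i < j
      A<B {a ∷ A} (s ∷ _)  (here refl) j = All.lookup s (∈-++⁺ʳ A j)
      A<B {a ∷ A} (_ ∷ ss) (there i)   j = A<B ss i j
      left : ℕ → Bool
      left i = 1 ≤ᵇ count (i ≡ᵇ_) A
      φ : ℕ → ℕ
      φ i = if left i then P.φ i else Q.φ i
      φ-A : ∀ {i} → i ∈ A → φ i ≡ P.φ i
      φ-A {i} a = if-true (Equivalence.to T-≡ (≤⇒≤ᵇ (count-∈ (i ≡ᵇ_) A a (≡ᵇ-refl i))))
      φ-B : ∀ {i} → i ∈ B → φ i ≡ Q.φ i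
      φ-B {i} b = if-false (cong (1 ≤ᵇ_) (count-none (i ≡ᵇ_) A λ a → ≢⇒≡ᵇ (λ eq → <-irrefl (sym eq) (A<B sAB a b))))

    replace : Bool → List ℕ → (Bool → List ℕ) → Bool → List ℕ
    replace true  J I true  = J
    replace true  J I false = I false
    replace false J I true  = I true
    replace false J I false = J

    replace-all : ∀ (R : Bool → List ℕ → Set) c {J I} → R c J → R (not c) (I (not c)) → ∀ x → R x (replace c J I x)
    replace-all R true  p q true  = p
    replace-all R true  p q false = q
    replace-all R false p q true  = q
    replace-all R false p q false = p

    ec-product : (Bool → List ℕ) → ℕ
    ec-product I = ec (I true) * ec (I false)

    ec-replace : ∀ c {J I} → 2 * ec J ≤ ec (I c) → 2 * ec-product (replace c J I) ≤ ec-product I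
    ec-replace true  {J} {I} le = ≤-trans (≤-reflexive (sym (*-assoc 2 (ec J) _))) (*-monoˡ-≤ (ec (I false)) le)
    ec-replace false {J} {I} le = ≤-trans (≤-reflexive (lem (ec (I true)) (ec J))) (*-monoʳ-≤ (ec (I true)) le)
      where lem : ∀ x y → 2 * (x * y) ≡ x * (2 * y)
            lem = solve-∀

    module Recursion (ν M : ℕ) where

      -- Which target is halved is dictated by the colour of the sparse pair that turns up. The
      -- product of the two edge counts is halved in either case, and it controls the smaller one.
      record State (h : ℕ) (I : Bool → List ℕ) (Z : List ℕ) : Set where
        field
          sZ      : Sorted Z
          targets : ∀ b → Target ν (I b)
          ec≤     : ∀ b → ec (I b) ≤ M
          product : ec-product I * 2 ^ h ≤ M * M
          noCopy  : ∀ b → ¬ Copy b (I b) Z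

      Claim : ℕ → ℕ → Set
      Claim h E = ∀ I Z → State h I Z → ¬ 2 ^ E ≤ length Z

      Available : ℕ → ℕ → Set
      Available h K = ∀ I Z → State h I Z → ∃ λ b → SparseAt b (suc ν) K Z

      -- `claim` with a halved target says that large sets contain that half. The exponent `suc ν`
      -- leaves half of Y as common neighbourhood: each of fewer than 2 ^ ν vertices misses at most
      -- a fraction 2 ^ -(ν + 1) of Y. The extra bit in `suc E` pays for this.
      step : ∀ {h K E} → Available h K → Claim (suc h) E → Claim h (K + suc E)
      step {h} {K} {E} avail claim I Z st Z≥ = body (avail I Z st)
        where
        open State st
        body : (∃ λ b → SparseAt b (suc ν) K Z) → ⊥
        body (b , sparse) = sparse (suc E) Z ⊆-refl Z≥ λ pr → split pr (halve (I c))
          where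
          c = not b
          next : ∀ J → J ⊆ I c → 2 * ec J ≤ ec (I c) → ∀ {X} → X ⊆ Z → ¬ Copy c J X → State (suc h) (replace c J I) X
          next J J⊆ half {X} X⊆ none = record
            { sZ = AllPairs-⊆ X⊆ sZ
            ; targets = replace-all (λ _ → Target ν) c (Target-⊆ J⊆ (targets c)) (targets (not c))
            ; ec≤ = replace-all (λ _ J → ec J ≤ M) c (≤-trans (m≤m+n (ec J) _) (≤-trans half (ec≤ c))) (ec≤ (not c))
            ; product = ≤-trans (≤-reflexive (lem (ec-product (replace c J I)) (2 ^ h))) (≤-trans (*-monoˡ-≤ (2 ^ h) (ec-replace c {J} {I} half)) product)
            ; noCopy = replace-all (λ x J → ¬ Copy x J X) c none (λ k → noCopy (not c) (Copy-⊆ X⊆ k)) }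
            where lem : ∀ x y → x * (2 * y) ≡ 2 * x * y
                  lem = solve-∀
          module _ (pr : Pair b (suc ν) (suc E) Z) where
            open Pair pr
            open Nbhd (rel c)
            -- J₁ is sought in X, and J₂ in the common neighbourhood of the copy found there.
            two : ∀ J₁ J₂ → J₁ ⊆ I c → J₂ ⊆ I c → 2 * ec J₁ ≤ ec (I c) → 2 * ec J₂ ≤ ec (I c) →
                  (∀ {Y′} (p : Copy c J₁ X) (q : Copy c J₂ Y′) → Y′ ⊆ Y →
                    (∀ {i j} → i ∈ J₁ → j ∈ J₂ → rel c (Copy.φ p i) (Copy.φ q j) ≡ true) → Copy c (I c) Z) → ⊥
            two J₁ J₂ J₁⊆ J₂⊆ half₁ half₂ join =
              claim _ X (next J₁ J₁⊆ half₁ X⊆ λ p →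
                claim _ (Y′ p) (next J₂ J₂⊆ half₂ (⊆-trans (nb-⊆ (map (Copy.φ p) J₁) Y) Y⊆) λ q →
                  noCopy c (join p q (nb-⊆ (map (Copy.φ p) J₁) Y) λ i j → nb-∈ {map (Copy.φ p) J₁} {Y} (Copy.φ∈ q j) (∈-map⁺ (Copy.φ p) i)))
                  (Y′≥ p))
                (≤-trans (^-monoʳ-≤ 2 (n≤1+n E)) X≥)
              where
              open ≤-Reasoning
              Y′ : Copy c J₁ X → List ℕ
              Y′ p = nb (map (Copy.φ p) J₁) Y
              Y′≥ : ∀ p → 2 ^ E ≤ length (Y′ p)
              Y′≥ p = *-cancelˡ-≤ 2 (begin
                2 * 2 ^ E        ≤⟨ Y≥ ⟩
                length Y         ≤⟨ +-cancelʳ-≤ (length Y) _ _ (begin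
                  length Y + length Y            ≡⟨ cong (length Y +_) (+-identityʳ _) ⟨
                  2 * length Y                   ≤⟨ *-monoʳ-≤ 2 (nb-union Q Y) ⟩
                  2 * (length (Y′ p) + missing)  ≡⟨ *-distribˡ-+ 2 (length (Y′ p)) missing ⟩
                  2 * length (Y′ p) + 2 * missing ≤⟨ +-monoʳ-≤ (2 * length (Y′ p)) missing≤ ⟩
                  2 * length (Y′ p) + length Y   ∎) ⟩
                2 * length (Y′ p) ∎)
                where
                Q = map (Copy.φ p) J₁
                missing = Σ[ Q ] (λ q → count (not ∘ rel c q) Y)
                Q∈X : ∀ {q} → q ∈ Q → q ∈ X
                Q∈X i with ∈-map⁻ (Copy.φ p) i
                ... | j , j∈ , refl = Copy.φ∈ p j∈
                each : ∀ {q} → q ∈ Q → 2 ^ suc ν * count (not ∘ rel c q) Y ≤ length Y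
                each {q} i = ≤-trans (*-monoʳ-≤ (2 ^ suc ν) (count-mono (not ∘ rel c q) (rel b q) Y
                  (λ {y} _ m → ≡-trans (sym (≡-trans (cong not (rel-not b q y)) (not-involutive (rel b q y)))) m))) (sparse′ (Q∈X i))
                  where sparse′ = Pair.sparse pr
                missing≤ : 2 * missing ≤ length Y
                missing≤ = *-cancelˡ-≤ (2 ^ ν) {{m^n≢0 2 ν}} (begin
                  2 ^ ν * (2 * missing)        ≡⟨ lem (2 ^ ν) missing ⟩
                  2 ^ suc ν * missing          ≡⟨ Σ-* (2 ^ suc ν) Q _ ⟨
                  Σ[ Q ] (λ q → 2 ^ suc ν * count (not ∘ rel c q) Y) ≤⟨ Σ-mono Q each ⟩
                  Σ[ Q ] (λ _ → length Y)      ≡⟨ Σ-const (length Y) Q ⟩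
                  length Q * length Y          ≤⟨ *-monoˡ-≤ (length Y) (≤-trans (≤-reflexive (length-map _ J₁))
                                                   (≤-trans (length-mono-≤ J₁⊆) (<⇒≤ (Target.small (targets c))))) ⟩
                  2 ^ ν * length Y             ∎)
                  where lem : ∀ x y → x * (2 * y) ≡ 2 * x * y
                        lem = solve-∀
            split : Halves (I c) → ⊥
            split (A , B , eq , halfA , halfB) = go orient
              where
              A⊆ : A ⊆ I c
              A⊆ = subst (A ⊆_) (sym eq) (⊆-++ʳ A B)
              B⊆ : B ⊆ I c
              B⊆ = subst (B ⊆_) (sym eq) (⊆-++ˡ A B)
              sAB : Sorted (A ++ B)
              sAB = subst Sorted eq (Target.sorted (targets c))
              go : Oriented X Y → ⊥
              go (inj₁ lt) = two A B A⊆ B⊆ halfA halfB λ p q Y′⊆ cross →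
                subst (λ J → Copy c J Z) (sym eq) (Copy-++ sAB X⊆ (⊆-trans Y′⊆ Y⊆) (≪-⊆ ⊆-refl Y′⊆ lt) p q cross)
              go (inj₂ lt) = two B A B⊆ A⊆ halfB halfA λ p q Y′⊆ cross →
                subst (λ J → Copy c J Z) (sym eq) (Copy-++ sAB (⊆-trans Y′⊆ Y⊆) X⊆ (≪-⊆ Y′⊆ ⊆-refl lt) q p
                  λ i j → ≡-trans (rel-sym c _ _) (cross j i))

      steps : ∀ k {h K E} → (∀ {h′} → h ≤ h′ → Available h′ K) → Claim (k + h) E → Claim h (k * suc K + E)
      steps zero    avail claim = claim
      steps (suc k) {h} {K} {E} avail claim = subst (Claim h) (lem k K E)
        (step {h} {K} {k * suc K + E} (avail ≤-refl) (steps k {suc h} {K} {E} (λ le → avail (<⇒≤ le)) (subst (λ z → Claim z E) (sym (+-suc k h)) claim)))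
        where lem : ∀ k K E → K + suc (k * suc K + E) ≡ suc k * suc K + E
              lem = solve-∀

      copy-by-position : ∀ {c I Z} → Sorted Z → (∀ {i} → i ∈ I → i < length Z) →
                         (∀ {i j} → i ∈ I → j ∈ I → i < j → e i j ≡ true → rel c (nth 0 Z i) (nth 0 Z j) ≡ true) → Copy c I Z
      copy-by-position {Z = Z} sZ bd col = record
        { φ = nth 0 Z ; φ∈ = λ i → nth-∈ 0 Z (bd i) ; mono = λ i j lt → nth-pairs 0 sZ lt (bd j) ; edge = col }

      edgeless : ∀ {I i j} → ec I ≡ 0 → i ∈ I → j ∈ I → e i j ≢ true
      edgeless {I} {i} {j} ec≡0 i∈ j∈ ee = <⇒≱ (count-∈ (e i) I j∈ ee)
        (≤-trans (member I i∈) (≤-reflexive ec≡0))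
        where
        member : ∀ J → i ∈ J → count (e i) I ≤ Σ[ J ] (λ v → count (e v) I)
        member (_ ∷ J) (here refl) = m≤m+n _ _
        member (_ ∷ J) (there k)   = ≤-trans (member J k) (m≤n+m _ _)

      -- The product has dropped below 1, so one target has no edges, and any set of 2 ^ ν vertices
      -- contains it.
      exhausted : ∀ h → M * M < 2 ^ h → Claim h ν
      exhausted h lt I Z st Z≥ = [ trivial true , trivial false ]′ (m*n≡0⇒m≡0∨n≡0 (ec (I true)) zero-product)
        where
        open State st
        zero-product : ec-product I ≡ 0
        zero-product = n<1⇒n≡0 (*-cancelʳ-< (2 ^ h) _ _ (≤-<-trans product (<-≤-trans lt (≤-reflexive (sym (+-identityʳ _))))))
        trivial : ∀ b → ec (I b) ≡ 0 → ⊥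
        trivial b z = noCopy b (copy-by-position sZ (λ i → <-≤-trans (Target.bounded (targets b) i) Z≥)
          (λ i j _ ee → ⊥-elim (edgeless z i j ee)))

    -- Ramsey's theorem for cliques

    Clique : Bool → ℕ → List ℕ → Set
    Clique c k Z = ∃ λ Q → Q ⊆ Z × length Q ≡ k × AllPairs (λ x y → rel c x y ≡ true) Q

    -- The Erdős-Szekeres recursion on the neighbourhoods of the first vertex, with 2 ^ (a + b) in
    -- place of the binomial coefficient.
    ramsey : ∀ a b Z → 2 ^ (a + b) ≤ length Z → Clique true a Z ⊎ Clique false b Z
    ramsey zero    b       Z       le = inj₁ ([] , minimum Z , refl , [])
    ramsey (suc a) zero    Z       le = inj₂ ([] , minimum Z , refl , [])
    ramsey (suc a) (suc b) []      le = ⊥-elim (<⇒≱ (m^n>0 2 (suc a + suc b)) le)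
    ramsey (suc a) (suc b) (z ∷ Z) le with 2 ^ (a + suc b) ≤? count (χ z) Z
    ... | yes big = [ (λ { (Q , τ , l , cl) → inj₁ (z ∷ Q , refl ∷ ⊆-trans τ (filterᵇ-⊆ (χ z) Z) , cong suc l ,
                            All.tabulate (λ i → proj₂ (∈-filterᵇ⁻ (χ z) {xs = Z} (⊆-∈ τ i))) ∷ cl) })
                    , (λ { (Q , τ , r) → inj₂ (Q , z ∷ʳ ⊆-trans τ (filterᵇ-⊆ (χ z) Z) , r) }) ]′
                    (ramsey a (suc b) (filterᵇ (χ z) Z) big)
    ... | no small = [ (λ { (Q , τ , r) → inj₁ (Q , z ∷ʳ ⊆-trans τ (filterᵇ-⊆ (not ∘ χ z) Z) , r) })
                     , (λ { (Q , τ , l , cl) → inj₂ (z ∷ Q , refl ∷ ⊆-trans τ (filterᵇ-⊆ (not ∘ χ z) Z) , cong suc l ,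
                            All.tabulate (λ i → proj₂ (∈-filterᵇ⁻ (not ∘ χ z) {xs = Z} (⊆-∈ τ i))) ∷ cl) }) ]′
                     (ramsey (suc a) b (filterᵇ (not ∘ χ z) Z) big)
      where
      open ≤-Reasoning
      m = 2 ^ (a + suc b)
      big : 2 ^ (suc a + b) ≤ count (not ∘ χ z) Z
      big = subst (λ k → 2 ^ k ≤ count (not ∘ χ z) Z) (+-suc a b) (+-cancelˡ-≤ (suc (count (χ z) Z)) _ _ (begin
        suc (count (χ z) Z) + m                      ≤⟨ +-monoˡ-≤ m (≰⇒> small) ⟩
        m + m                                        ≡⟨ cong (m +_) (+-identityʳ m) ⟨
        2 ^ (suc a + suc b)                          ≤⟨ le ⟩
        suc (length Z)                               ≡⟨ cong suc (count-not (χ z) Z) ⟨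
        suc (count (χ z) Z) + count (not ∘ χ z) Z    ∎))

    ramsey-copy : ∀ n Z → Sorted Z → 2 ^ (n + n) ≤ length Z → (∀ b → ¬ Copy b (upTo n) Z) → ⊥
    ramsey-copy n Z sZ le none = [ found true , found false ]′ (ramsey n n Z le)
      where
      open Recursion 0 0
      found : ∀ b → Clique b n Z → ⊥
      found b (Q , τ , l , cl) = none b (Copy-⊆ τ (copy-by-position (AllPairs-⊆ τ sZ) bd
        (λ i j lt _ → nth-pairs 0 cl lt (bd j))))
        where
        bd : ∀ {i} → i ∈ upTo n → i < length Q
        bd i = subst (_ <_) (sym l) (∈-upTo⁻ i)

    -- The three phases of the recursion

    module Phases (α τ ρ : ℕ) (α≥3 : 3 ≤ α) (β≥6 : 6 ≤ α + τ) (β≤ : α + τ ≤ 2 ^ α) (ρ≥1 : 1 ≤ ρ) (M : ℕ) where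

      open Numbers α τ ρ α≥3 β≥6 β≤ ρ≥1
      open Recursion ν M

      module _ (M< : M < 2 ^ ν) (M≤r² : M ≤ r * r) (r≤ : r ≤ 2 ^ ν) where

        smaller : ∀ I → ∃ λ b → ec (I b) * ec (I b) ≤ ec-product I
        smaller I with ≤-total (ec (I true)) (ec (I false))
        ... | inj₁ le = true , *-monoʳ-≤ (ec (I true)) le
        ... | inj₂ le = false , *-monoˡ-≤ (ec (I false)) le

        -- Halving √x means a factor 4 in x and a factor 16 in the product, so dividing r by 2 ^ j
        -- takes `4 * j` halvings.
        reduced : ∀ {x h} j s → 4 * j ≤ h → 2 ^ j * s ≡ r → x * x * 2 ^ h ≤ M * M → x ≤ s * s
        reduced {x} {h} j s j≤h B≡ le = *-cancelˡ-≤ (B * B) {{m*n≢0 B B {{m^n≢0 2 j}} {{m^n≢0 2 j}}}} (begin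
          B * B * x            ≤⟨ square-cancel (begin
            B * B * x * (B * B * x)       ≡⟨ lem₁ B x ⟩
            x * x * (B * B * (B * B))     ≡⟨ cong (λ z → x * x * (z * z)) (^-distribˡ-+-* 2 j j) ⟨
            x * x * (2 ^ (j + j) * 2 ^ (j + j)) ≡⟨ cong (x * x *_) (^-distribˡ-+-* 2 (j + j) (j + j)) ⟨
            x * x * 2 ^ (j + j + (j + j)) ≤⟨ *-monoʳ-≤ (x * x) (^-monoʳ-≤ 2 (≤-trans (≤-reflexive (lem₂ j)) j≤h)) ⟩
            x * x * 2 ^ h                 ≤⟨ le ⟩
            M * M                         ∎) ⟩
          M                    ≤⟨ M≤r² ⟩
          r * r                ≡⟨ cong₂ _*_ B≡ B≡ ⟨
          B * s * (B * s)      ≡⟨ lem₃ B s ⟩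
          B * B * (s * s)      ∎)
          where
          open ≤-Reasoning
          B = 2 ^ j
          lem₁ : ∀ B x → B * B * x * (B * B * x) ≡ x * x * (B * B * (B * B))
          lem₁ = solve-∀
          lem₂ : ∀ j → j + j + (j + j) ≡ 4 * j
          lem₂ = solve-∀
          lem₃ : ∀ B s → B * s * (B * s) ≡ B * B * (s * s)
          lem₃ = solve-∀

        not-not : ∀ {b γ K Z} → SparseAt b γ K Z → SparseAt (not (not b)) γ K Z
        not-not {b} {γ} {K} {Z} = subst (λ c → SparseAt c γ K Z) (sym (not-involutive b))

        denser : ∀ c K {h I Z} → State h I Z → SparseAt (not c) γB K Z → SparseAt c (suc ν) (ampCost ν β δB (suc ν) K) Z
        denser c K {I = I} {Z} st sparse = amplify c (I c) Z (suc ν) K ν β δB (State.sZ st) (State.targets st c)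
          (≤-trans (State.ec≤ st c) M≤r²) δB≥1 (≤-trans δB≤r r≤) sparse (State.noCopy st c)

        -- The colours alternate: `true` is sparse at γA by greedy embedding, then `false` at γB,
        -- then `true` at `suc ν`. Only the bound M on both targets enters.
        phase₁ : ∀ h → Available h KB
        phase₁ h I Z st = true , denser true KA st
          (amplify false (I false) Z γB K₀ ν α δA sZ (targets false) (≤-trans (≤-trans (ec≤ false) M≤r²) (≤-reflexive (sym (cong₂ _*_ r≡δA r≡δA))))
            δA≥1 (≤-trans δA≤r r≤)
            (greedy true (I true) Z γA ν r sZ (targets true) (≤-trans (ec≤ true) M≤r²) r≥1 (noCopy true)) (noCopy false))
          where open State st

        -- The smaller target is now cheap enough to be embedded greedily at γB, which replaces the
        -- first amplification; the other target may still have M edges.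
        phase₂ : ∀ {h} → 8 * α ≤ h → Available h K₂
        phase₂ {h} h≥ I Z st = not b , denser (not b) (2 * ν + γB * r₂) st (not-not {b} {γB} {2 * ν + γB * r₂} {Z} (greedy b (I b) Z γB ν r₂ sZ (targets b)
            (reduced {h = h} (2 * α) r₂ (≤-trans (≤-reflexive (lem α)) h≥) r≡r₂ (≤-trans (*-monoˡ-≤ (2 ^ h) (proj₂ (smaller I))) product)) r₂≥1 (noCopy b)))
          where
          open State st
          b = proj₁ (smaller I)
          lem : ∀ a → 4 * (2 * a) ≡ 8 * a
          lem = solve-∀

        -- Even the exponent `suc ν` is affordable for a greedy embedding of the smaller target.
        phase₃ : ∀ {h} → 8 * β ≤ h → Available h K₃
        phase₃ {h} h≥ I Z st = b , greedy b (I b) Z (suc ν) ν ρ sZ (targets b)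
            (reduced {h = h} (2 * β) ρ (≤-trans (≤-reflexive (lem β)) h≥) r≡ρ (≤-trans (*-monoˡ-≤ (2 ^ h) (proj₂ (smaller I))) product)) ρ≥1 (noCopy b)
          where
          open State st
          b = proj₁ (smaller I)
          lem : ∀ a → 4 * (2 * a) ≡ 8 * a
          lem = solve-∀

        claim : Claim 0 E
        -- `reduced` needs 8α halvings to reach `r₂` and 8β to reach ρ. The last 2λ′ + 2 = 2ν
        -- halvings exhaust the product, since M < 2 ^ ν.
        claim = steps (8 * α) {0} {KB} (λ {h} _ → phase₁ h) (steps (8 * β) {8 * α + 0} {K₂} (λ le → phase₂ (≤-trans (m≤m+n (8 * α) 0) le))
          (steps (2 * λ′ + 2) {8 * β + (8 * α + 0)} {K₃} (λ le → phase₃ (≤-trans (m≤m+n (8 * β) _) le)) (exhausted (2 * λ′ + 2 + (8 * β + (8 * α + 0))) last)))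
          where
          open ≤-Reasoning
          last : M * M < 2 ^ (2 * λ′ + 2 + (8 * β + (8 * α + 0)))
          last = begin-strict
            M * M                   <⟨ *-mono-< M< M< ⟩
            2 ^ ν * 2 ^ ν           ≡⟨ ^-distribˡ-+-* 2 ν ν ⟨
            2 ^ (ν + ν)             ≤⟨ ^-monoʳ-≤ 2 (≤-trans (≤-reflexive (lem λ′)) (m≤m+n _ _)) ⟩
            2 ^ (2 * λ′ + 2 + (8 * β + (8 * α + 0))) ∎
            where lem : ∀ l → (l + 1) + (l + 1) ≡ 2 * l + 2
                  lem = solve-∀

    -- The choice of α, τ and ρ for given m

    Bounded : ℕ → ℕ → ℕ → Set
    Bounded N m β = ∃ λ E → suc N ≤ 2 ^ E × E * E ≤ m * (β * β * β) * 100000000000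

    module _ (n N m : ℕ) (M≡ : ec (upTo n) ≡ 2 * m) (m≥3 : 3 ≤ m) (n≤M : n ≤ ec (upTo n))
             (noCopy : ∀ b → ¬ Copy b (upTo n) (upTo N)) where

      M : ℕ
      M = ec (upTo n)

      m≤M : m ≤ M
      m≤M = ≤-trans (m≤m+n m (m + 0)) (≤-reflexive (sym M≡))

      M≥1 : 1 ≤ M
      M≥1 = ≤-trans (≤-trans (s≤s z≤n) m≥3) m≤M

      -- With ρ least, r exceeds √M by at most λ′². As β ≥ 6 gives 4β ≤ 2 ^ (β - 1), λ′⁴ is at most
      -- m, so that the overshoot is itself at most √M and r² ≤ 4M.
      large-case : ∀ α τ → 3 ≤ α → 6 ≤ α + τ → α + τ ≤ 2 ^ α → 2 ^ α ≤ 2 * (α + τ) →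
                   m < 2 ^ 2 ^ (α + τ) → 2 ^ 2 ^ pred (α + τ) ≤ m → Bounded N m (α + τ)
      large-case α τ α≥3 β≥6 β≤ ≤2β m< ≤m = found (least (λ ρ → M ≤? R ρ * R ρ) M M≤RM)
        where
        open ≤-Reasoning
        β = α + τ
        l = 2 ^ β
        R : ℕ → ℕ
        R ρ = l * (l * ρ)
        M≤RM : M ≤ R M * R M
        M≤RM = ≤-trans (m≤m*n M M {{>-nonZero M≥1}}) (*-mono-≤ M≤R M≤R)
          where M≤R : M ≤ R M
                M≤R = ≤-trans (m≤n*m M l {{m^n≢0 2 β}}) (m≤n*m (l * M) l {{m^n≢0 2 β}})
        4β≤ : 4 * β ≤ 2 ^ pred β
        4β≤ = subst (λ b → 4 * b ≤ 2 ^ pred b) (m+[n∸m]≡n β≥6) (go (β ∸ 6))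
          where
          go : ∀ k → 4 * (6 + k) ≤ 2 ^ (5 + k)
          go k = *-cancelˡ-≤ 2 (begin
            2 * (4 * (6 + k))                          ≤⟨ m≤m+n _ (1 + 6 * k + k * k) ⟩
            2 * (4 * (6 + k)) + (1 + 6 * k + k * k)    ≡⟨ lem k ⟩
            (7 + k) * (7 + k)                          ≤⟨ square-≤-power k ⟩
            2 ^ (6 + k)                                ∎)
            where lem : ∀ k → 2 * (4 * (6 + k)) + (1 + 6 * k + k * k) ≡ (7 + k) * (7 + k)
                  lem = solve-∀
        l⁴≤M : l * l * (l * l) ≤ M
        l⁴≤M = begin
          l * l * (l * l)                ≡⟨ cong₂ _*_ (^-distribˡ-+-* 2 β β) (^-distribˡ-+-* 2 β β) ⟨
          2 ^ (β + β) * 2 ^ (β + β)      ≡⟨ ^-distribˡ-+-* 2 (β + β) (β + β) ⟨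
          2 ^ (β + β + (β + β))          ≤⟨ ^-monoʳ-≤ 2 (≤-trans (≤-reflexive (lem β)) 4β≤) ⟩
          2 ^ 2 ^ pred β                 ≤⟨ ≤m ⟩
          m                              ≤⟨ m≤M ⟩
          M                              ∎
          where lem : ∀ b → b + b + (b + b) ≡ 4 * b
                lem = solve-∀
        found : (∃ λ ρ → ρ ≤ M × M ≤ R ρ * R ρ × (∀ i → i < ρ → ¬ M ≤ R i * R i)) → Bounded N m β
        found (zero , _ , le , _) = ⊥-elim (<⇒≱ M≥1 (≤-trans le (≤-reflexive (lem l))))
          where lem : ∀ l → l * (l * 0) * (l * (l * 0)) ≡ 0
                lem = solve-∀
        found (suc p , _ , M≤r² , min) = E , suc-N , E²≤
          where
          open Numbers α τ (suc p) α≥3 β≥6 β≤ (s≤s z≤n) using (ν; r; E; E≤; λ≥4)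
          open Recursion ν M using (State)
          square-sum : ∀ x y → x * x ≤ M → y * y ≤ M → (x + y) * (x + y) ≤ 4 * M
          square-sum x y hx hy with ≤-total x y
          ... | inj₁ le = ≤-trans (*-mono-≤ (+-monoˡ-≤ y le) (+-monoˡ-≤ y le)) (≤-trans (≤-reflexive (lem y)) (*-monoʳ-≤ 4 hy))
            where lem : ∀ y → (y + y) * (y + y) ≡ 4 * (y * y)
                  lem = solve-∀
          ... | inj₂ le = ≤-trans (*-mono-≤ (+-monoʳ-≤ x le) (+-monoʳ-≤ x le)) (≤-trans (≤-reflexive (lem x)) (*-monoʳ-≤ 4 hx))
            where lem : ∀ y → (y + y) * (y + y) ≡ 4 * (y * y)
                  lem = solve-∀
          r²≤ : r * r ≤ 4 * M
          r²≤ = subst (λ z → z * z ≤ 4 * M) (lem l p) (square-sum (R p) (l * l) (<⇒≤ (≰⇒> (min p ≤-refl))) l⁴≤M)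
            where lem : ∀ l p → l * (l * p) + l * l ≡ l * (l * (1 + p))
                  lem = solve-∀
          M< : M < 2 ^ ν
          M< = begin-strict
            M             ≡⟨ M≡ ⟩
            2 * m         <⟨ *-monoʳ-< 2 m< ⟩
            2 ^ suc l     ≡⟨ cong (2 ^_) (+-comm 1 l) ⟩
            2 ^ (l + 1)   ∎
          r≤ : r ≤ 2 ^ ν
          r≤ = square-cancel (begin
            r * r           ≤⟨ r²≤ ⟩
            2 ^ 2 * M       ≤⟨ *-mono-≤ (^-monoʳ-≤ 2 {2} {ν} (≤-trans (≤-trans (≤ᵇ⇒≤ 2 4 _) λ≥4) (m≤m+n l 1))) (<⇒≤ M<) ⟩
            2 ^ ν * 2 ^ ν   ∎)
          state : State 0 (λ _ → upTo n) (upTo N)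
          state = record
            { sZ = upTo-sorted N
            ; targets = λ _ → record
                { sorted = upTo-sorted n ; bounded = λ i → <-trans (<-≤-trans (∈-upTo⁻ i) n≤M) M<
                ; small = ≤-<-trans (≤-reflexive (length-upTo n)) (≤-<-trans n≤M M<) }
            ; ec≤ = λ _ → ≤-refl ; product = ≤-reflexive (*-identityʳ _) ; noCopy = noCopy }
          suc-N : suc N ≤ 2 ^ E
          suc-N = ≰⇒> λ le → Phases.claim α τ (suc p) α≥3 β≥6 β≤ (s≤s z≤n) M M< M≤r² r≤ (λ _ → upTo n) (upTo N) state
                    (≤-trans le (≤-reflexive (sym (length-upTo N))))
          -- The factor 16 · 1100 · 1300² is about 3 · 10¹⁰: 1300 comes from `E≤`, 2 · 1100 from α⁶
          -- ≤ 2200 β, and the remaining 8 from r² ≤ 4M = 8m.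
          E²≤ : E * E ≤ m * (β * β * β) * 100000000000
          E²≤ = begin
            E * E                                            ≤⟨ *-mono-≤ E≤ E≤ ⟩
            β * a³ * r * 1300 * (β * a³ * r * 1300)          ≡⟨ lem₁ β a³ r 1300 ⟩
            β * β * (a³ * a³) * (r * r) * (1300 * 1300)      ≤⟨ *-monoˡ-≤ (1300 * 1300) (*-mono-≤ (*-monoʳ-≤ (β * β) six) r²≤) ⟩
            β * β * (2 * β * 1100) * (4 * M) * (1300 * 1300) ≡⟨ cong (λ z → β * β * (2 * β * 1100) * (4 * z) * (1300 * 1300)) M≡ ⟩
            β * β * (2 * β * 1100) * (4 * (2 * m)) * (1300 * 1300) ≡⟨ lem₂ β m 1100 (1300 * 1300) ⟩
            m * (β * β * β) * (16 * 1100 * (1300 * 1300))    ≤⟨ *-monoʳ-≤ (m * (β * β * β)) (≤ᵇ⇒≤ (16 * 1100 * (1300 * 1300)) 100000000000 _) ⟩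
            m * (β * β * β) * 100000000000                   ∎
            where
            a³ = α * α * α
            six : a³ * a³ ≤ 2 * β * 1100
            six = ≤-trans (subst (λ a → a * a * a * (a * a * a) ≤ 2 ^ a * 1100) (m+[n∸m]≡n α≥3) (sixth-power (α ∸ 3))) (*-monoˡ-≤ 1100 ≤2β)
            lem₁ : ∀ b a r c → b * a * r * c * (b * a * r * c) ≡ b * b * (a * a) * (r * r) * (c * c)
            lem₁ = solve-∀
            lem₂ : ∀ b m c d → b * b * (2 * b * c) * (4 * (2 * m)) * d ≡ m * (b * b * b) * (16 * c * d)
            lem₂ = solve-∀

      -- Ramsey's theorem for a clique on n ≤ 2m vertices gives E = 2n ≤ 4m. For m < 2³² the square
      -- of this is at most 2³⁶ m, and 2³⁶ < 10¹¹.
      small-case : ∀ β → 1 ≤ β → m < 2 ^ 2 ^ 5 → Bounded N m β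
      small-case β β≥1 m< = n + n , ≰⇒> (λ le → ramsey-copy n (upTo N) (upTo-sorted N) (≤-trans le (≤-reflexive (sym (length-upTo N)))) noCopy) , (begin
        (n + n) * (n + n)               ≤⟨ *-mono-≤ (+-mono-≤ n≤2m n≤2m) (+-mono-≤ n≤2m n≤2m) ⟩
        (2 * m + 2 * m) * (2 * m + 2 * m) ≡⟨ lem m ⟩
        m * 16 * m                      ≤⟨ *-monoʳ-≤ (m * 16) (<⇒≤ m<) ⟩
        m * 16 * 2 ^ 2 ^ 5              ≡⟨ *-assoc m 16 (2 ^ 2 ^ 5) ⟩
        m * (16 * 2 ^ 2 ^ 5)            ≡⟨ cong (_* (16 * 2 ^ 2 ^ 5)) (*-identityʳ m) ⟨
        m * 1 * (16 * 2 ^ 2 ^ 5)        ≤⟨ *-mono-≤ (*-monoʳ-≤ m (*-mono-≤ (*-mono-≤ β≥1 β≥1) β≥1)) (≤ᵇ⇒≤ (16 * 2 ^ 2 ^ 5) 100000000000 _) ⟩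
        m * (β * β * β) * 100000000000  ∎)
        where
        open ≤-Reasoning
        n≤2m : n ≤ 2 * m
        n≤2m = ≤-trans n≤M (≤-reflexive M≡)
        lem : ∀ m → (2 * m + 2 * m) * (2 * m + 2 * m) ≡ m * 16 * m
        lem = solve-∀

      -- The large case also needs m bounded below in terms of β, so the least admissible exponent
      -- replaces β; the conclusion is monotone in β.
      core : ∀ β → m < 2 ^ 2 ^ β → Bounded N m β
      core β m<β = enlarge (least (λ b → m <? 2 ^ 2 ^ b) β m<β)
        where
        open ≤-Reasoning
        enlarge : (∃ λ b → b ≤ β × m < 2 ^ 2 ^ b × (∀ i → i < b → ¬ m < 2 ^ 2 ^ i)) → Bounded N m β
        enlarge (zero , _ , m<2 , _) = ⊥-elim (<⇒≱ m<2 (≤-trans (n≤1+n 2) m≥3))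
        enlarge (b@(suc k) , b≤β , m< , min) with b ≤? 5
        ... | yes b≤5 = small-case β (≤-trans (s≤s z≤n) b≤β) (<-≤-trans m< (^-monoʳ-≤ 2 (^-monoʳ-≤ 2 b≤5)))
        ... | no  b≰5 = weaken (exponent (least (λ a → b ≤? 2 ^ a) b (<⇒≤ (n<2^n b))))
          where
          weaken : Bounded N m b → Bounded N m β
          weaken (E , lt , le) = E , lt , ≤-trans le (*-monoˡ-≤ 100000000000 (*-monoʳ-≤ m (*-mono-≤ (*-mono-≤ b≤β b≤β) b≤β)))
          exponent : (∃ λ a → a ≤ b × b ≤ 2 ^ a × (∀ i → i < a → ¬ b ≤ 2 ^ i)) → Bounded N m b
          exponent (a , a≤b , b≤2^a , mina) = subst (Bounded N m) eq
            (large-case a (b ∸ a) a≥3 (subst (6 ≤_) (sym eq) (≰⇒> b≰5)) (subst (_≤ 2 ^ a) (sym eq) b≤2^a)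
              (subst (λ z → 2 ^ a ≤ 2 * z) (sym eq) (minimal a mina)) (subst (λ z → m < 2 ^ 2 ^ z) (sym eq) m<)
              (subst (λ z → 2 ^ 2 ^ pred z ≤ m) (sym eq) (≮⇒≥ (min k ≤-refl))))
            where
            eq : a + (b ∸ a) ≡ b
            eq = m+[n∸m]≡n a≤b
            a≥3 : 3 ≤ a
            a≥3 = ≮⇒≥ λ lt → b≰5 (≤-trans b≤2^a (≤-trans (^-monoʳ-≤ 2 (s≤s⁻¹ lt)) (n≤1+n 4)))
            minimal : ∀ a → (∀ i → i < a → ¬ b ≤ 2 ^ i) → 2 ^ a ≤ 2 * b
            minimal zero    _ = s≤s z≤n
            minimal (suc a) h = *-monoʳ-≤ 2 (<⇒≤ (≰⇒> (h a ≤-refl)))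

  -- From Fin to ℕ

  extend : ∀ {n} → (Fin n → Fin n → Bool) → ℕ → ℕ → Bool
  extend {n} f i j with i <? n | j <? n
  ... | yes p | yes q = f (fromℕ< p) (fromℕ< q)
  ... | _     | _     = false

  extend-toℕ : ∀ {n} (f : Fin n → Fin n → Bool) i j → extend f (toℕ i) (toℕ j) ≡ f i j
  extend-toℕ {n} f i j with toℕ i <? n | toℕ j <? n
  ... | yes p | yes q = cong₂ f (fromℕ<-toℕ i p) (fromℕ<-toℕ j q)
  ... | no ¬p | _     = ⊥-elim (¬p (toℕ<n i))
  ... | yes _ | no ¬q = ⊥-elim (¬q (toℕ<n j))

  symmetrise : (ℕ → ℕ → Bool) → ℕ → ℕ → Bool
  symmetrise f i j = if i <ᵇ j then f i j else (if j <ᵇ i then f j i else false)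

  <ᵇ-false : ∀ {i j} → ¬ i < j → (i <ᵇ j) ≡ false
  <ᵇ-false {i} {j} h = not-false λ eq → h (<ᵇ-true⁻ {i} {j} eq)

  symmetrise-< : ∀ f {i j} → i < j → symmetrise f i j ≡ f i j
  symmetrise-< f lt = if-true (<ᵇ-true⁺ lt)

  symmetrise-> : ∀ f {i j} → j < i → symmetrise f i j ≡ f j i
  symmetrise-> f lt = ≡-trans (if-false (<ᵇ-false (<-asym lt))) (if-true (<ᵇ-true⁺ lt))

  symmetrise-irr : ∀ f i → symmetrise f i i ≡ false
  symmetrise-irr f i = ≡-trans (if-false (<ᵇ-false {i} {i} (<-irrefl refl))) (if-false (<ᵇ-false {i} {i} (<-irrefl refl)))

  symmetrise-sym : ∀ f i j → symmetrise f i j ≡ symmetrise f j i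
  symmetrise-sym f i j with <-cmp i j
  ... | tri< lt _ _   = ≡-trans (symmetrise-< f lt) (sym (symmetrise-> f lt))
  ... | tri≈ _ refl _ = refl
  ... | tri> _ _ gt   = ≡-trans (symmetrise-> f gt) (sym (symmetrise-< f gt))

  upTo-allFin : ∀ n → upTo n ≡ map toℕ (allFin n)
  upTo-allFin n = ≡-trans (go n (λ i → i)) (sym (map-tabulate (λ i → i) toℕ))
    where
    go : ∀ n (f : ℕ → ℕ) → applyUpTo f n ≡ tabulate {n = n} (f ∘ toℕ)
    go zero    f = refl
    go (suc n) f = cong (f 0 ∷_) (go n (f ∘ suc))

  count-map : {A B : Set} (p : B → Bool) (f : A → B) (xs : List A) → count p (map f xs) ≡ count (p ∘ f) xs
  count-map p f []       = refl
  count-map p f (x ∷ xs) = ≡-trans (count-∷ p (f x) (map f xs))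
    (≡-trans (cong (bit (p (f x)) +_) (count-map p f xs)) (sym (count-∷ (p ∘ f) x xs)))

  Σ-map : {A B : Set} (g : B → ℕ) (f : A → B) (xs : List A) → Σ[ map f xs ] g ≡ Σ[ xs ] (g ∘ f)
  Σ-map g f []       = refl
  Σ-map g f (x ∷ xs) = cong (g (f x) +_) (Σ-map g f xs)

  sum-map : {A : Set} (f : A → ℕ) (xs : List A) → sum (map f xs) ≡ Σ[ xs ] f
  sum-map f []       = refl
  sum-map f (x ∷ xs) = cong (f x +_) (sum-map f xs)

  module Convert (n : ℕ) (H : D.OrdGraph n) (N : ℕ) (col : D.Colouring N) where

    e χ : ℕ → ℕ → Bool
    e = symmetrise (extend H)
    χ = symmetrise (extend col)

    open Colouring χ (symmetrise-sym (extend col)) e (symmetrise-sym (extend H)) (symmetrise-irr (extend H))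

    above : Fin n → Fin n → Bool
    above i j = (toℕ i <ᵇ toℕ j) ∧ H i j

    e-above : ∀ i j → bit (e (toℕ i) (toℕ j)) ≡ bit (above i j) + bit (above j i)
    e-above i j with <-cmp (toℕ i) (toℕ j)
    ... | tri< lt _ _ rewrite symmetrise-< (extend H) lt | extend-toℕ H i j | <ᵇ-true⁺ lt | <ᵇ-false (<-asym lt) = sym (+-identityʳ _)
    ... | tri> _ _ gt rewrite symmetrise-> (extend H) gt | extend-toℕ H j i | <ᵇ-true⁺ gt | <ᵇ-false (<-asym gt) = refl
    ... | tri≈ _ eq _ rewrite eq | symmetrise-irr (extend H) (toℕ j) | <ᵇ-false (<-irrefl {toℕ j} refl) = refl

    ec-allFin : ec (upTo n) ≡ Σ[ allFin n ] (λ i → count (e (toℕ i) ∘ toℕ) (allFin n))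
    ec-allFin = ≡-trans (cong (λ I → Σ[ I ] (λ v → count (e v) I)) (upTo-allFin n))
      (≡-trans (Σ-map _ toℕ (allFin n)) (Σ-cong (allFin n) (λ i → count-map (e (toℕ i)) toℕ (allFin n))))

    edgeCount-Σ : D.edgeCount H ≡ Σ[ allFin n ] (λ i → count (above i) (allFin n))
    edgeCount-Σ = ≡-trans (sum-map _ (allFin n)) (Σ-cong (allFin n)
      (λ i → ≡-trans (sum-map _ (allFin n)) (sym (count-Σ (above i) (allFin n)))))

    ec≡ : ec (upTo n) ≡ 2 * D.edgeCount H
    ec≡ = begin
      ec (upTo n)                                                 ≡⟨ ec-allFin ⟩
      Σ[ F ] (λ i → count (e (toℕ i) ∘ toℕ) F)                    ≡⟨ Σ-cong F both ⟩
      Σ[ F ] (λ i → count (above i) F + count (λ j → above j i) F) ≡⟨ Σ-+ F _ _ ⟩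
      Σ[ F ] (λ i → count (above i) F) + Σ[ F ] (λ i → count (λ j → above j i) F)
        ≡⟨ cong (Σ[ F ] (λ i → count (above i) F) +_) (≡-trans (double-count (λ i j → above j i) F F) (sym (+-identityʳ _))) ⟩
      2 * Σ[ F ] (λ i → count (above i) F)                        ≡⟨ cong (2 *_) edgeCount-Σ ⟨
      2 * D.edgeCount H                                             ∎
      where
      open ≡-Reasoning
      F = allFin n
      both : ∀ i → count (e (toℕ i) ∘ toℕ) F ≡ count (above i) F + count (λ j → above j i) F
      both i = ≡-trans (count-Σ (e (toℕ i) ∘ toℕ) F) (≡-trans (Σ-cong F (e-above i)) (≡-trans (Σ-+ F _ _)
        (sym (cong₂ _+_ (count-Σ (above i) F) (count-Σ (λ j → above j i) F)))))

    edge⇒e : ∀ {i j} → D.Edge H i j → e (toℕ i) (toℕ j) ≡ true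
    edge⇒e {i} {j} (lt , h) = ≡-trans (symmetrise-< (extend H) lt) (≡-trans (extend-toℕ H i j) h)

    -- Every vertex adds at least 1 to the degree sum, so n ≤ 2m and bounds in terms of m alone
    -- suffice.
    n≤ec : D.NoIsolatedVertices H → n ≤ ec (upTo n)
    n≤ec conn = ≤-trans (≤-reflexive (≡-trans (sym (length-tabulate (λ i → i))) (≡-trans (sym (*-identityʳ _)) (sym (Σ-const 1 (allFin n))))))
      (≤-trans (Σ-mono (allFin n) (λ {v} _ → nbr v (conn v))) (≤-reflexive (sym ec-allFin)))
      where
      nbr : ∀ v → (∃ λ u → D.Adjacent H u v) → 1 ≤ count (e (toℕ v) ∘ toℕ) (allFin n)
      nbr v (u , inj₁ uv) = count-∈ _ (allFin n) (∈-allFin u) (≡-trans (symmetrise-sym (extend H) (toℕ v) (toℕ u)) (edge⇒e uv))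
      nbr v (u , inj₂ vu) = count-∈ _ (allFin n) (∈-allFin u) (edge⇒e vu)

    rel⇒col : ∀ b {x y} → rel b x y ≡ true → χ x y ≡ b
    rel⇒col true  h = h
    rel⇒col false h = not-true⁻ h

    mono-copy : ∀ b → Copy b (upTo n) (upTo N) → D.MonoCopy col b H
    mono-copy b k = φ , (λ i j lt → subst₂ _<_ (sym (toℕ-φ i)) (sym (toℕ-φ j)) (mono (∈I i) (∈I j) lt)) , colour
      where
      open Copy k renaming (φ to ψ; φ∈ to ψ∈)
      ∈I : ∀ i → toℕ i ∈ upTo n
      ∈I i = ∈-upTo⁺ (toℕ<n i)
      φ : Fin n → Fin N
      φ i = fromℕ< (∈-upTo⁻ (ψ∈ (∈I i)))
      toℕ-φ : ∀ i → toℕ (φ i) ≡ ψ (toℕ i)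
      toℕ-φ i = toℕ-fromℕ< (∈-upTo⁻ (ψ∈ (∈I i)))
      colour : ∀ i j → D.Edge H i j → col (φ i) (φ j) ≡ b
      colour i j ij@(lt , _) = begin
        col (φ i) (φ j)                       ≡⟨ extend-toℕ col (φ i) (φ j) ⟨
        extend col (toℕ (φ i)) (toℕ (φ j))    ≡⟨ cong₂ (extend col) (toℕ-φ i) (toℕ-φ j) ⟩
        extend col (ψ (toℕ i)) (ψ (toℕ j))    ≡⟨ symmetrise-< (extend col) (mono (∈I i) (∈I j) lt) ⟨
        χ (ψ (toℕ i)) (ψ (toℕ j))             ≡⟨ rel⇒col b {ψ (toℕ i)} {ψ (toℕ j)} (edge (∈I i) (∈I j) lt (edge⇒e ij)) ⟩
        b                                     ∎
        where open ≡-Reasoning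

    bound : D.NoIsolatedVertices H → 3 ≤ D.edgeCount H → (∀ b → ¬ D.MonoCopy col b H) →
            ∀ β → D.edgeCount H < 2 ^ 2 ^ β → ∃ λ E → suc N ≤ 2 ^ E × E * E ≤ D.edgeCount H * (β * β * β) * 100000000000
    bound conn m≥3 none = Sparsity.core χ (symmetrise-sym (extend col)) e (symmetrise-sym (extend H)) (symmetrise-irr (extend H))
      n N (D.edgeCount H) ec≡ m≥3 (n≤ec conn) (λ b k → none b (mono-copy b k))

-- Partial sums of the exponential series

module Exponential where

  open import Data.Nat as ℕ using (ℕ; zero; suc)
  import Data.Nat.Properties as ℕP
  import Data.Nat.Tactic.RingSolver as ℕSolver
  open import Data.Integer as ℤ using (-[1+_])
  import Data.Integer.Properties as ℤP
  open import Data.Rational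
  open import Data.Rational.Properties
  import Data.Rational.Unnormalised as ℚᵘ
  import Data.Rational.Unnormalised.Properties as ℚᵘP
  open import Data.Maybe using (nothing)
  open import Data.Product using (_,_; ∃)
  open import Relation.Binary.PropositionalEquality
  open import Tactic.RingSolver using (solve-∀)
  open import Tactic.RingSolver.Core.AlmostCommutativeRing using (AlmostCommutativeRing; fromCommutativeRing)
  open import Level using (0ℓ)
  open import Defs using (ℕtoℚ; expTerm; expPartial)

  ℚ-ring : AlmostCommutativeRing 0ℓ 0ℓ
  ℚ-ring = fromCommutativeRing +-*-commutativeRing (λ _ → nothing)

  inv : ℕ → ℚ
  inv i = ℤ.+ 1 / suc i

  toℚᵘ-ℕ : ∀ k → toℚᵘ (ℕtoℚ k) ℚᵘ.≃ ℚᵘ.mkℚᵘ (ℤ.+ k) 0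
  toℚᵘ-ℕ k = toℚᵘ-fromℚᵘ (ℚᵘ.mkℚᵘ (ℤ.+ k) 0)

  ℕtoℚ-+ : ∀ a b → ℕtoℚ (a ℕ.+ b) ≡ ℕtoℚ a + ℕtoℚ b
  ℕtoℚ-+ a b = toℚᵘ-injective (ℚᵘP.≃-trans (toℚᵘ-ℕ (a ℕ.+ b)) (ℚᵘP.≃-trans
    (ℚᵘ.*≡* (cong (ℤ._* ℤ.+ 1) (trans (ℤP.pos-+ a b) (sym (cong₂ ℤ._+_ (ℤP.*-identityʳ (ℤ.+ a)) (ℤP.*-identityʳ (ℤ.+ b)))))))
    (ℚᵘP.≃-sym (ℚᵘP.≃-trans (toℚᵘ-homo-+ (ℕtoℚ a) (ℕtoℚ b)) (ℚᵘP.+-cong (toℚᵘ-ℕ a) (toℚᵘ-ℕ b))))))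

  ℕtoℚ-* : ∀ a b → ℕtoℚ (a ℕ.* b) ≡ ℕtoℚ a * ℕtoℚ b
  ℕtoℚ-* a b = toℚᵘ-injective (ℚᵘP.≃-trans (toℚᵘ-ℕ (a ℕ.* b)) (ℚᵘP.≃-trans
    (ℚᵘ.*≡* (cong (ℤ._* ℤ.+ 1) (ℤP.pos-* a b)))
    (ℚᵘP.≃-sym (ℚᵘP.≃-trans (toℚᵘ-homo-* (ℕtoℚ a) (ℕtoℚ b)) (ℚᵘP.*-cong (toℚᵘ-ℕ a) (toℚᵘ-ℕ b))))))

  ℕtoℚ-mono : ∀ {a b} → a ℕ.≤ b → ℕtoℚ a ≤ ℕtoℚ b
  ℕtoℚ-mono {a} {b} le = toℚᵘ-cancel-≤ (ℚᵘP.≤-respʳ-≃ (ℚᵘP.≃-sym (toℚᵘ-ℕ b)) (ℚᵘP.≤-respˡ-≃ (ℚᵘP.≃-sym (toℚᵘ-ℕ a))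
    (ℚᵘ.*≤* (ℤP.*-monoʳ-≤-nonNeg (ℤ.+ 1) (ℤ.+≤+ le)))))

  ℕtoℚ-cancel-< : ∀ {a b} → ℕtoℚ a < ℕtoℚ b → a ℕ.< b
  ℕtoℚ-cancel-< lt = ℕP.≰⇒> λ le → <-irrefl refl (<-≤-trans lt (ℕtoℚ-mono le))

  ℕtoℚ≥0 : ∀ a → 0ℚ ≤ ℕtoℚ a
  ℕtoℚ≥0 a = ℕtoℚ-mono {0} {a} ℕ.z≤n

  inv≥0 : ∀ i → 0ℚ ≤ inv i
  inv≥0 i = nonNegative⁻¹ (inv i) {{normalize-nonNeg 1 (suc i)}}

  ℕtoℚ-inv : ∀ i → ℕtoℚ (suc i) * inv i ≡ 1ℚ
  ℕtoℚ-inv i = toℚᵘ-injective (ℚᵘP.≃-trans (toℚᵘ-homo-* (ℕtoℚ (suc i)) (inv i))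
    (ℚᵘP.≃-trans (ℚᵘP.*-cong (toℚᵘ-ℕ (suc i)) (toℚᵘ-fromℚᵘ (ℚᵘ.mkℚᵘ (ℤ.+ 1) i)))
      (ℚᵘ.*≡* (cong ℤ.+_ (trans (lem i) (sym (ℕP.+-identityʳ _)))))))
    where lem : ∀ i → suc i ℕ.* 1 ℕ.* 1 ≡ suc (i ℕ.+ 0)
          lem = ℕSolver.solve-∀

  archimedean : ∀ p → ∃ λ u → p ≤ ℕtoℚ u
  archimedean p@(mkℚ n d-1 _) = ℤ.∣ n ∣ , toℚᵘ-cancel-≤ (ℚᵘP.≤-respʳ-≃ (ℚᵘP.≃-sym (toℚᵘ-ℕ ℤ.∣ n ∣)) (ℚᵘ.*≤* (go n)))
    where
    go : ∀ n → n ℤ.* ℤ.+ 1 ℤ.≤ ℤ.+ ℤ.∣ n ∣ ℤ.* ℤ.+ suc d-1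
    go (ℤ.+ k) = subst₂ ℤ._≤_ (ℤP.pos-* k 1) (ℤP.pos-* k (suc d-1)) (ℤ.+≤+ (ℕP.*-monoʳ-≤ k (ℕ.s≤s ℕ.z≤n)))
    go -[1+ k ] = subst (-[1+ k ] ℤ.* ℤ.+ 1 ℤ.≤_) (ℤP.pos-* (suc k) (suc d-1)) ℤ.-≤+

  *-mono : ∀ {a b c d} → 0ℚ ≤ c → 0ℚ ≤ b → a ≤ b → c ≤ d → a * c ≤ b * d
  *-mono {a} {b} {c} {d} c≥0 b≥0 ab cd =
    ≤-trans (*-monoʳ-≤-nonNeg c {{nonNegative c≥0}} ab) (*-monoˡ-≤-nonNeg b {{nonNegative b≥0}} cd)

  *-nonneg : ∀ {a b} → 0ℚ ≤ a → 0ℚ ≤ b → 0ℚ ≤ a * b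
  *-nonneg {a} {b} a≥0 b≥0 = subst (_≤ a * b) (*-zeroˡ b) (*-monoʳ-≤-nonNeg b {{nonNegative b≥0}} a≥0)

  +-nonneg : ∀ {a b} → 0ℚ ≤ a → 0ℚ ≤ b → 0ℚ ≤ a + b
  +-nonneg = +-mono-≤

  ≤-+ʳ : ∀ {a b} → 0ℚ ≤ b → a ≤ a + b
  ≤-+ʳ {a} {b} b≥0 = subst (_≤ a + b) (+-identityʳ a) (+-monoʳ-≤ a b≥0)

  ≤-+ˡ : ∀ {a b} → 0ℚ ≤ b → a ≤ b + a
  ≤-+ˡ {a} {b} b≥0 = subst (_≤ b + a) (+-identityˡ a) (+-monoˡ-≤ a b≥0)

  1≥0 : 0ℚ ≤ 1ℚ
  1≥0 = ℕtoℚ≥0 1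

  term≥0 : ∀ {x} → 0ℚ ≤ x → ∀ i → 0ℚ ≤ expTerm x i
  term≥0 x≥0 zero    = 1≥0
  term≥0 x≥0 (suc i) = *-nonneg (*-nonneg (term≥0 x≥0 i) x≥0) (inv≥0 i)

  partial≥0 : ∀ {x} → 0ℚ ≤ x → ∀ j → 0ℚ ≤ expPartial x j
  partial≥0 x≥0 zero    = 1≥0
  partial≥0 x≥0 (suc j) = +-nonneg (partial≥0 x≥0 j) (term≥0 x≥0 (suc j))

  term≤partial : ∀ {x} → 0ℚ ≤ x → ∀ j → expTerm x j ≤ expPartial x j
  term≤partial x≥0 zero    = ≤-refl
  term≤partial x≥0 (suc j) = ≤-+ˡ (partial≥0 x≥0 j)

  term-mono : ∀ {x y} → 0ℚ ≤ x → x ≤ y → ∀ i → expTerm x i ≤ expTerm y i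
  term-mono x≥0 le zero    = ≤-refl
  term-mono x≥0 le (suc i) = *-mono (inv≥0 i) (*-nonneg (term≥0 y≥0 i) y≥0)
    (*-mono x≥0 (term≥0 y≥0 i) (term-mono x≥0 le i) le) ≤-refl
    where y≥0 = ≤-trans x≥0 le

  partial-mono : ∀ {x y} → 0ℚ ≤ x → x ≤ y → ∀ j → expPartial x j ≤ expPartial y j
  partial-mono x≥0 le zero    = ≤-refl
  partial-mono x≥0 le (suc j) = +-mono-≤ (partial-mono x≥0 le j) (term-mono x≥0 le (suc j))

  -- Each factor x / i with i ≤ E is at least 2. So for x ≥ 2E the single term of index E already
  -- reaches 2 ^ E, and no comparison of e with 2 is needed.
  term-lower : ∀ E {x} → ℕtoℚ (2 ℕ.* E) ≤ x → ∀ i → i ℕ.≤ E → ℕtoℚ (2 ℕ.^ i) ≤ expTerm x i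
  term-lower E x≥ zero    le = ≤-refl
  term-lower E {x} x≥ (suc i) le = ≤-trans (≤-reflexive eq)
    (*-monoʳ-≤-nonNeg (inv i) {{nonNegative (inv≥0 i)}}
      (*-mono (ℕtoℚ≥0 (2 ℕ.* suc i)) (term≥0 x≥0 i) (term-lower E x≥ i (ℕP.<⇒≤ le)) (≤-trans (ℕtoℚ-mono (ℕP.*-monoʳ-≤ 2 le)) x≥)))
    where
    x≥0 = ≤-trans (ℕtoℚ≥0 (2 ℕ.* E)) x≥
    eq : ℕtoℚ (2 ℕ.^ suc i) ≡ ℕtoℚ (2 ℕ.^ i) * ℕtoℚ (2 ℕ.* suc i) * inv i
    eq = begin
      ℕtoℚ (2 ℕ.* 2 ℕ.^ i)                            ≡⟨ ℕtoℚ-* 2 (2 ℕ.^ i) ⟩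
      ℕtoℚ 2 * ℕtoℚ (2 ℕ.^ i)                         ≡⟨ lem₁ (ℕtoℚ 2) (ℕtoℚ (2 ℕ.^ i)) ⟩
      ℕtoℚ (2 ℕ.^ i) * ℕtoℚ 2 * 1ℚ                    ≡⟨ cong (ℕtoℚ (2 ℕ.^ i) * ℕtoℚ 2 *_) (ℕtoℚ-inv i) ⟨
      ℕtoℚ (2 ℕ.^ i) * ℕtoℚ 2 * (ℕtoℚ (suc i) * inv i) ≡⟨ lem₂ (ℕtoℚ (2 ℕ.^ i)) (ℕtoℚ 2) (ℕtoℚ (suc i)) (inv i) ⟩
      ℕtoℚ (2 ℕ.^ i) * (ℕtoℚ 2 * ℕtoℚ (suc i)) * inv i ≡⟨ cong (λ z → ℕtoℚ (2 ℕ.^ i) * z * inv i) (ℕtoℚ-* 2 (suc i)) ⟨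
      ℕtoℚ (2 ℕ.^ i) * ℕtoℚ (2 ℕ.* suc i) * inv i     ∎
      where
      open ≡-Reasoning
      lem₁ : ∀ a b → a * b ≡ b * a * 1ℚ
      lem₁ a b = trans (*-comm a b) (sym (*-identityʳ (b * a)))
      lem₂ : ∀ a b c d → a * b * (c * d) ≡ a * (b * c) * d
      lem₂ = solve-∀ ℚ-ring

  module Shift (x y : ℚ) (x≥0 : 0ℚ ≤ x) (y≥0 : 0ℚ ≤ y) where

    z : ℚ
    z = x + y

    z≥0 : 0ℚ ≤ z
    z≥0 = +-nonneg x≥0 y≥0

    -- zⁱ − i y zⁱ⁻¹ ≤ (z − y)ⁱ, divided by i!.
    term-shift : ∀ i → expTerm z (suc i) ≤ expTerm x (suc i) + y * expTerm z i
    term-shift zero = ≤-reflexive (begin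
      1ℚ * (x + y) * inv 0          ≡⟨ lem 1ℚ x y (inv 0) ⟩
      1ℚ * x * inv 0 + y * (1ℚ * inv 0) ≡⟨ cong (λ w → 1ℚ * x * inv 0 + y * w) (ℕtoℚ-inv 0) ⟩
      1ℚ * x * inv 0 + y * 1ℚ       ∎)
      where
      open ≡-Reasoning
      lem : ∀ o x y i → o * (x + y) * i ≡ o * x * i + y * (o * i)
      lem = solve-∀ ℚ-ring
    term-shift (suc i) = begin
      Tz * (x + y) * q                                ≡⟨ lem₁ Tz x y q ⟩
      Tz * x * q + y * (Tz * q)                       ≤⟨ +-monoˡ-≤ (y * (Tz * q)) (*-monoʳ-≤-nonNeg q {{nonNegative (inv≥0 (suc i))}}
                                                          (*-monoʳ-≤-nonNeg x {{nonNegative x≥0}} (term-shift i))) ⟩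
      (Tx + y * Tz₀) * x * q + y * (Tz * q)           ≡⟨ lem₂ Tx y Tz₀ x q Tz ⟩
      Tx * x * q + y * (Tz₀ * x * q + Tz * q)         ≤⟨ +-monoʳ-≤ (Tx * x * q) (*-monoˡ-≤-nonNeg y {{nonNegative y≥0}} (+-monoˡ-≤ (Tz * q)
                                                          (*-monoʳ-≤-nonNeg q {{nonNegative (inv≥0 (suc i))}}
                                                            (*-monoˡ-≤-nonNeg Tz₀ {{nonNegative (term≥0 z≥0 i)}} (≤-+ʳ y≥0))))) ⟩
      Tx * x * q + y * (Tz₀ * z * q + Tz * q)         ≡⟨ cong (λ w → Tx * x * q + y * (w * q + Tz * q)) down ⟩
      Tx * x * q + y * (Tz * ℕtoℚ (suc i) * q + Tz * q) ≡⟨ cong (λ w → Tx * x * q + y * w) collect ⟩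
      Tx * x * q + y * Tz                             ∎
      where
      open ≤-Reasoning
      q = inv (suc i)
      Tz = expTerm z (suc i)
      Tz₀ = expTerm z i
      Tx = expTerm x (suc i)
      lem₁ : ∀ t x y q → t * (x + y) * q ≡ t * x * q + y * (t * q)
      lem₁ = solve-∀ ℚ-ring
      lem₂ : ∀ t y s x q u → (t + y * s) * x * q + y * (u * q) ≡ t * x * q + y * (s * x * q + u * q)
      lem₂ = solve-∀ ℚ-ring
      lem₃ : ∀ a b c → a * b * c ≡ a * (c * b)
      lem₃ = solve-∀ ℚ-ring
      down : Tz₀ * z ≡ Tz * ℕtoℚ (suc i)
      down = sym (trans (lem₃ (Tz₀ * z) (inv i) (ℕtoℚ (suc i))) (trans (cong (Tz₀ * z *_) (ℕtoℚ-inv i)) (*-identityʳ (Tz₀ * z))))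
      lem₄ : ∀ t a q o → t * a * q + t * q * o ≡ t * ((a + o) * q)
      lem₄ = solve-∀ ℚ-ring
      collect : Tz * ℕtoℚ (suc i) * q + Tz * q ≡ Tz
      collect = begin-equality
        Tz * ℕtoℚ (suc i) * q + Tz * q          ≡⟨ cong (λ w → Tz * ℕtoℚ (suc i) * q + w) (sym (*-identityʳ (Tz * q))) ⟩
        Tz * ℕtoℚ (suc i) * q + Tz * q * 1ℚ     ≡⟨ lem₄ Tz (ℕtoℚ (suc i)) q 1ℚ ⟩
        Tz * ((ℕtoℚ (suc i) + 1ℚ) * q)          ≡⟨ cong (λ w → Tz * (w * q)) (trans (sym (ℕtoℚ-+ (suc i) 1)) (cong ℕtoℚ (ℕP.+-comm (suc i) 1))) ⟩
        Tz * (ℕtoℚ (suc (suc i)) * q)           ≡⟨ cong (Tz *_) (ℕtoℚ-inv (suc i)) ⟩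
        Tz * 1ℚ                                 ≡⟨ *-identityʳ Tz ⟩
        Tz                                      ∎

    -- A form of (1 - y) e^z ≤ e^x with z = x + y that holds for truncated series, summed from
    -- `term-shift`.
    partial-shift : ∀ j → expPartial z j ≤ expPartial x j + y * expPartial z j
    partial-shift zero    = ≤-+ʳ (*-nonneg y≥0 1≥0)
    partial-shift (suc j) = begin
      expPartial z j + expTerm z (suc j)                 ≤⟨ +-mono-≤ (partial-shift′ j) (term-shift j) ⟩
      expPartial x j + y * below j + (expTerm x (suc j) + y * expTerm z j) ≡⟨ lem (expPartial x j) y (below j) (expTerm x (suc j)) (expTerm z j) ⟩
      expPartial x j + expTerm x (suc j) + y * (below j + expTerm z j) ≡⟨ cong (λ w → expPartial x (suc j) + y * w) (below-+ j) ⟩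
      expPartial x (suc j) + y * expPartial z j          ≤⟨ +-monoʳ-≤ (expPartial x (suc j)) (*-monoˡ-≤-nonNeg y {{nonNegative y≥0}} (≤-+ʳ (term≥0 z≥0 (suc j)))) ⟩
      expPartial x (suc j) + y * expPartial z (suc j)    ∎
      where
      open ≤-Reasoning
      below : ℕ → ℚ
      below zero    = 0ℚ
      below (suc j) = expPartial z j
      below-+ : ∀ j → below j + expTerm z j ≡ expPartial z j
      below-+ zero    = +-identityˡ 1ℚ
      below-+ (suc j) = refl
      lem : ∀ p y b t s → p + y * b + (t + y * s) ≡ p + t + y * (b + s)
      lem = solve-∀ ℚ-ring
      partial-shift′ : ∀ j → expPartial z j ≤ expPartial x j + y * below j
      partial-shift′ zero    = ≤-+ʳ (*-nonneg y≥0 ≤-refl)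
      partial-shift′ (suc j) = ≤-trans (+-mono-≤ (partial-shift′ j) (term-shift j))
        (≤-reflexive (trans (lem (expPartial x j) y (below j) (expTerm x (suc j)) (expTerm z j)) (cong (λ w → expPartial x (suc j) + y * w) (below-+ j))))

  partial-zero : ∀ j → expPartial 0ℚ j ≡ 1ℚ
  partial-zero zero    = refl
  partial-zero (suc j) = trans (cong₂ _+_ (partial-zero j) zero-term) (+-identityʳ 1ℚ)
    where
    zero-term : expTerm 0ℚ (suc j) ≡ 0ℚ
    zero-term = trans (cong (_* inv j) (*-zeroʳ (expTerm 0ℚ j))) (*-zeroˡ (inv j))

  -- e^{a/(q+1)} ≤ ((q+1)/q)^a.
  partial-upper : ∀ q a j → expPartial (ℕtoℚ a * inv q) j * ℕtoℚ (q ℕ.^ a) ≤ ℕtoℚ (suc q ℕ.^ a)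
  partial-upper q zero j = ≤-reflexive (trans (cong (_* 1ℚ) (trans (cong (λ w → expPartial w j) (*-zeroˡ (inv q))) (partial-zero j))) (*-identityʳ 1ℚ))
  partial-upper q (suc a) j = begin
    Pz′ * ℕtoℚ (q ℕ.* q ℕ.^ a)                      ≡⟨ cong₂ _*_ (cong (λ w → expPartial w j) z≡) (ℕtoℚ-* q (q ℕ.^ a)) ⟩
    Pz * (ℕtoℚ q * ℕtoℚ (q ℕ.^ a))                  ≡⟨ lem₁ Pz (ℕtoℚ q) (ℕtoℚ (q ℕ.^ a)) ⟩
    Pz * ℕtoℚ q * ℕtoℚ (q ℕ.^ a)                    ≤⟨ *-monoʳ-≤-nonNeg (ℕtoℚ (q ℕ.^ a)) {{nonNegative (ℕtoℚ≥0 (q ℕ.^ a))}} ratio ⟩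
    ℕtoℚ (suc q) * Px * ℕtoℚ (q ℕ.^ a)              ≡⟨ *-assoc (ℕtoℚ (suc q)) Px _ ⟩
    ℕtoℚ (suc q) * (Px * ℕtoℚ (q ℕ.^ a))            ≤⟨ *-monoˡ-≤-nonNeg (ℕtoℚ (suc q)) {{nonNegative (ℕtoℚ≥0 (suc q))}} (partial-upper q a j) ⟩
    ℕtoℚ (suc q) * ℕtoℚ (suc q ℕ.^ a)               ≡⟨ ℕtoℚ-* (suc q) (suc q ℕ.^ a) ⟨
    ℕtoℚ (suc q ℕ.^ suc a)                          ∎
    where
    open ≤-Reasoning
    x = ℕtoℚ a * inv q
    y = inv q
    x≥0 : 0ℚ ≤ x
    x≥0 = *-nonneg (ℕtoℚ≥0 a) (inv≥0 q)
    open Shift x y x≥0 (inv≥0 q)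
    Pz′ = expPartial (ℕtoℚ (suc a) * inv q) j
    Pz = expPartial z j
    Px = expPartial x j
    lem₁ : ∀ a b c → a * (b * c) ≡ a * b * c
    lem₁ = solve-∀ ℚ-ring
    lem₂ : ∀ a o y → (o + a) * y ≡ a * y + o * y
    lem₂ = solve-∀ ℚ-ring
    z≡ : ℕtoℚ (suc a) * inv q ≡ z
    z≡ = trans (cong (_* inv q) (ℕtoℚ-+ 1 a)) (trans (lem₂ (ℕtoℚ a) 1ℚ (inv q)) (cong (x +_) (*-identityˡ (inv q))))
    lem₃ : ∀ s p y w → s * (p + y * w) ≡ s * p + w * (s * y)
    lem₃ = solve-∀ ℚ-ring
    lem₄ : ∀ p q o → (o + q) * p ≡ p * q + p * o
    lem₄ = solve-∀ ℚ-ring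
    ratio : Pz * ℕtoℚ q ≤ ℕtoℚ (suc q) * Px
    ratio = +-cancelʳ (begin
      Pz * ℕtoℚ q + Pz * 1ℚ             ≡⟨ lem₄ Pz (ℕtoℚ q) 1ℚ ⟨
      (1ℚ + ℕtoℚ q) * Pz                ≡⟨ cong (_* Pz) (ℕtoℚ-+ 1 q) ⟨
      ℕtoℚ (suc q) * Pz                 ≤⟨ *-monoˡ-≤-nonNeg (ℕtoℚ (suc q)) {{nonNegative (ℕtoℚ≥0 (suc q))}} (partial-shift j) ⟩
      ℕtoℚ (suc q) * (Px + y * Pz)      ≡⟨ lem₃ (ℕtoℚ (suc q)) Px y Pz ⟩
      ℕtoℚ (suc q) * Px + Pz * (ℕtoℚ (suc q) * y) ≡⟨ cong (λ w → ℕtoℚ (suc q) * Px + Pz * w) (ℕtoℚ-inv q) ⟩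
      ℕtoℚ (suc q) * Px + Pz * 1ℚ       ∎)
      where
      lem₅ : ∀ a c → a + c + - c ≡ a
      lem₅ a c = trans (+-assoc a c (- c)) (trans (cong (a +_) (+-inverseʳ c)) (+-identityʳ a))
      +-cancelʳ : ∀ {a b c} → a + c ≤ b + c → a ≤ b
      +-cancelʳ {a} {b} {c} le = subst₂ _≤_ (lem₅ a c) (lem₅ b c) (+-monoˡ-≤ (- c) le)

-- From powers of two to the exponential bound

open import Defs
open import Data.Bool using (Bool)
open import Data.Nat using (ℕ; suc; _≤_)
open import Data.Rational using (ℚ; 0ℚ; _*_; _<_) renaming (_≤_ to _≤ℚ_)
open import Data.Product using (∃)
open import Relation.Nullary using (¬_)
open import Data.Nat as ℕ using (zero)
import Data.Nat.Properties as ℕP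
import Data.Nat.Tactic.RingSolver as ℕSolver
open import Data.Rational as ℚ using (1ℚ; _+_)
import Data.Rational.Properties as ℚP
open import Data.Product using (_×_; _,_)
open import Relation.Binary.PropositionalEquality using (_≡_; refl; sym; trans; cong; subst)
open import Tactic.RingSolver using (solve-∀)
open Exponential
open Combinatorics using (least; module Convert)

-- Everything rests on e^(1/2) ≤ 2: from ℓ ≤ b/2 follows k ≤ e^ℓ ≤ 2 ^ b, and e^k is at most e^(2 ^
-- (b + 1) / 2).
logarithm-bound : ∀ m (ℓ k : ℚ) b → 0ℚ ≤ℚ ℓ → 0ℚ ≤ℚ k → ℓ ≤ℚ ℕtoℚ b * inv 1 →
                  ∃ (λ j → k ≤ℚ expPartial ℓ j) → ∃ (λ j → ℕtoℚ m < expPartial k j) → m ℕ.< 2 ℕ.^ 2 ℕ.^ suc b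
logarithm-bound m ℓ k b ℓ≥0 k≥0 ℓ≤ (j , k≤) (j′ , m<) = ℕtoℚ-cancel-< (ℚP.<-≤-trans m< (begin
  expPartial k j′                                      ≤⟨ partial-mono k≥0 k≤b j′ ⟩
  expPartial (ℕtoℚ (2 ℕ.^ suc b) * inv 1) j′           ≤⟨ power-of-two (2 ℕ.^ suc b) j′ ⟩
  ℕtoℚ (2 ℕ.^ 2 ℕ.^ suc b)                             ∎))
  where
  open ℚP.≤-Reasoning
  power-of-two : ∀ a j → expPartial (ℕtoℚ a * inv 1) j ≤ℚ ℕtoℚ (2 ℕ.^ a)
  power-of-two a j = subst (_≤ℚ ℕtoℚ (2 ℕ.^ a)) (trans (cong (λ z → expPartial (ℕtoℚ a * inv 1) j * ℕtoℚ z) (ℕP.^-zeroˡ a)) (ℚP.*-identityʳ _)) (partial-upper 1 a j)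
  k≤b : k ≤ℚ ℕtoℚ (2 ℕ.^ suc b) * inv 1
  k≤b = begin
    k                                     ≤⟨ k≤ ⟩
    expPartial ℓ j                        ≤⟨ partial-mono ℓ≥0 ℓ≤ j ⟩
    expPartial (ℕtoℚ b * inv 1) j         ≤⟨ power-of-two b j ⟩
    ℕtoℚ (2 ℕ.^ b)                        ≡⟨ ℚP.*-identityˡ (ℕtoℚ (2 ℕ.^ b)) ⟨
    1ℚ * ℕtoℚ (2 ℕ.^ b)                   ≡⟨ cong (_* ℕtoℚ (2 ℕ.^ b)) (ℕtoℚ-inv 1) ⟨
    ℕtoℚ 2 * inv 1 * ℕtoℚ (2 ℕ.^ b)       ≡⟨ lem (ℕtoℚ 2) (inv 1) (ℕtoℚ (2 ℕ.^ b)) ⟩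
    ℕtoℚ 2 * ℕtoℚ (2 ℕ.^ b) * inv 1       ≡⟨ cong (_* inv 1) (ℕtoℚ-* 2 (2 ℕ.^ b)) ⟨
    ℕtoℚ (2 ℕ.^ suc b) * inv 1            ∎
    where
    lem : ∀ a i p → a * i * p ≡ a * p * i
    lem = solve-∀ ℚ-ring

below-ratio : ∀ (p : ℚ) m a b → 0 ℕ.< a → ℕtoℚ m < p → p * ℕtoℚ a ≤ℚ ℕtoℚ b → m ℕ.* a ℕ.< b
below-ratio p m a@(suc _) b _ m<p le = ℕtoℚ-cancel-< (subst (_< ℕtoℚ b) (sym (ℕtoℚ-* m a))
  (ℚP.<-≤-trans (ℚP.*-monoˡ-<-pos (ℕtoℚ a) {{ℚP.normalize-pos a 1}} m<p) le))

-- m ≥ 3 forces ℓ ≥ log log 3 > 1/20, because e^{1/20} ≤ 20/19 and e^{20/19} ≤ (19/18)^20 < 3.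
loglog-lower : ∀ m (ℓ k : ℚ) → 3 ℕ.≤ m → 0ℚ ≤ℚ ℓ → 0ℚ ≤ℚ k →
               ∃ (λ j → k ≤ℚ expPartial ℓ j) → ∃ (λ j → ℕtoℚ m < expPartial k j) → inv 19 < ℓ
loglog-lower m ℓ k m≥3 ℓ≥0 k≥0 (j , k≤) (j′ , m<) = ℚP.≰⇒> λ ℓ≤ →
  ℕP.<⇒≱ (below-ratio (expPartial (ℕtoℚ 20 * inv 18) j′) m (18 ℕ.^ 20) (19 ℕ.^ 20) (ℕP.m^n>0 18 20)
           (ℚP.<-≤-trans m< (partial-mono k≥0 (k≤20/19 ℓ≤) j′)) (partial-upper 18 20 j′))
    (ℕP.≤-trans (ℕP.≤ᵇ⇒≤ (19 ℕ.^ 20) (3 ℕ.* 18 ℕ.^ 20) _) (ℕP.*-monoˡ-≤ (18 ℕ.^ 20) m≥3))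
  where
  open ℚP.≤-Reasoning
  k≤20/19 : ℓ ≤ℚ inv 19 → k ≤ℚ ℕtoℚ 20 * inv 18
  k≤20/19 ℓ≤ = begin
    k                         ≡⟨ ℚP.*-identityʳ k ⟨
    k * 1ℚ                    ≡⟨ cong (k *_) (ℕtoℚ-inv 18) ⟨
    k * (ℕtoℚ 19 * inv 18)    ≡⟨ ℚP.*-assoc k (ℕtoℚ 19) (inv 18) ⟨
    k * ℕtoℚ 19 * inv 18      ≤⟨ ℚP.*-monoʳ-≤-nonNeg (inv 18) {{ℚ.nonNegative (inv≥0 18)}} k19 ⟩
    ℕtoℚ 20 * inv 18          ∎
    where
    k19 : k * ℕtoℚ 19 ≤ℚ ℕtoℚ 20
    k19 = begin
      k * ℕtoℚ 19                                  ≤⟨ ℚP.*-monoʳ-≤-nonNeg (ℕtoℚ 19) {{ℚ.nonNegative (ℕtoℚ≥0 19)}}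
                                                       (ℚP.≤-trans k≤ (partial-mono ℓ≥0 (ℚP.≤-trans ℓ≤ (ℚP.≤-reflexive (sym (ℚP.*-identityˡ (inv 19))))) j)) ⟩
      expPartial (ℕtoℚ 1 * inv 19) j * ℕtoℚ (19 ℕ.^ 1) ≤⟨ partial-upper 19 1 j ⟩
      ℕtoℚ 20                                      ∎

-- No root is extracted: x < 2E would give x² < (2E)² ≤ 4 C m (D ℓ)³ ≤ x².
square-root : ∀ E m β D C K (ℓ x : ℚ) → 0ℚ ≤ℚ x → 0ℚ ≤ℚ ℓ → ℕtoℚ β ≤ℚ ℕtoℚ D * ℓ →
              E ℕ.* E ℕ.≤ m ℕ.* (β ℕ.* β ℕ.* β) ℕ.* C → C ℕ.* 4 ℕ.* (D ℕ.* D ℕ.* D) ℕ.≤ K →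
              ℕtoℚ K * ℕtoℚ m * (ℓ * ℓ * ℓ) ≤ℚ x * x → ℕtoℚ (2 ℕ.* E) ≤ℚ x
square-root E m β D C K ℓ x x≥0 ℓ≥0 β≤ E²≤ ≤K hx = ℚP.≮⇒≥ λ x<y →
  ℚP.<-irrefl refl (ℚP.≤-<-trans (ℚP.*-monoˡ-≤-nonNeg x {{ℚ.nonNegative x≥0}} (ℚP.<⇒≤ x<y))
    (ℚP.<-≤-trans (ℚP.*-monoˡ-<-pos y {{ℚ.positive (ℚP.≤-<-trans x≥0 x<y)}} x<y) y²≤))
  where
  open ℚP.≤-Reasoning
  y = ℕtoℚ (2 ℕ.* E)
  B = ℕtoℚ β
  b≥0 = ℕtoℚ≥0 β
  c≥0 = ℕtoℚ≥0 (C ℕ.* 4)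
  Dℓ = ℕtoℚ D * ℓ
  Dℓ≥0 = *-nonneg (ℕtoℚ≥0 D) ℓ≥0
  4E² : 2 ℕ.* E ℕ.* (2 ℕ.* E) ℕ.≤ C ℕ.* 4 ℕ.* (m ℕ.* (β ℕ.* β ℕ.* β))
  4E² = ℕP.≤-trans (ℕP.≤-reflexive (lem₁ E)) (ℕP.≤-trans (ℕP.*-monoʳ-≤ 4 E²≤) (ℕP.≤-reflexive (lem₂ m (β ℕ.* β ℕ.* β) C)))
    where
    lem₁ : ∀ E → 2 ℕ.* E ℕ.* (2 ℕ.* E) ≡ 4 ℕ.* (E ℕ.* E)
    lem₁ = ℕSolver.solve-∀
    lem₂ : ∀ m b c → 4 ℕ.* (m ℕ.* b ℕ.* c) ≡ c ℕ.* 4 ℕ.* (m ℕ.* b)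
    lem₂ = ℕSolver.solve-∀
  lem₃ : ∀ c m d l → c * (m * (d * l * (d * l) * (d * l))) ≡ c * (d * d * d) * m * (l * l * l)
  lem₃ = solve-∀ ℚ-ring
  cubes : ∀ b → ℕtoℚ (b ℕ.* b ℕ.* b) ≡ ℕtoℚ b * ℕtoℚ b * ℕtoℚ b
  cubes b = trans (ℕtoℚ-* (b ℕ.* b) b) (cong (_* ℕtoℚ b) (ℕtoℚ-* b b))
  y²≤ : y * y ≤ℚ x * x
  y²≤ = begin
    y * y                                                  ≡⟨ ℕtoℚ-* (2 ℕ.* E) (2 ℕ.* E) ⟨
    ℕtoℚ (2 ℕ.* E ℕ.* (2 ℕ.* E))                           ≤⟨ ℕtoℚ-mono 4E² ⟩
    ℕtoℚ (C ℕ.* 4 ℕ.* (m ℕ.* (β ℕ.* β ℕ.* β)))             ≡⟨ trans (ℕtoℚ-* (C ℕ.* 4) _) (cong (ℕtoℚ (C ℕ.* 4) *_) (trans (ℕtoℚ-* m _) (cong (ℕtoℚ m *_) (cubes β)))) ⟩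
    ℕtoℚ (C ℕ.* 4) * (ℕtoℚ m * (B * B * B))                ≤⟨ ℚP.*-monoˡ-≤-nonNeg (ℕtoℚ (C ℕ.* 4)) {{ℚ.nonNegative c≥0}} (ℚP.*-monoˡ-≤-nonNeg (ℕtoℚ m) {{ℚ.nonNegative (ℕtoℚ≥0 m)}}
                                                                (*-mono b≥0 (*-nonneg Dℓ≥0 Dℓ≥0) (*-mono b≥0 Dℓ≥0 β≤ β≤) β≤)) ⟩
    ℕtoℚ (C ℕ.* 4) * (ℕtoℚ m * (Dℓ * Dℓ * Dℓ))             ≡⟨ lem₃ (ℕtoℚ (C ℕ.* 4)) (ℕtoℚ m) (ℕtoℚ D) ℓ ⟩
    ℕtoℚ (C ℕ.* 4) * (ℕtoℚ D * ℕtoℚ D * ℕtoℚ D) * ℕtoℚ m * (ℓ * ℓ * ℓ)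
      ≡⟨ cong (λ z → z * ℕtoℚ m * (ℓ * ℓ * ℓ)) (trans (cong (ℕtoℚ (C ℕ.* 4) *_) (sym (cubes D))) (sym (ℕtoℚ-* (C ℕ.* 4) (D ℕ.* D ℕ.* D)))) ⟩
    ℕtoℚ (C ℕ.* 4 ℕ.* (D ℕ.* D ℕ.* D)) * ℕtoℚ m * (ℓ * ℓ * ℓ)
      ≤⟨ ℚP.*-monoʳ-≤-nonNeg (ℓ * ℓ * ℓ) {{ℚ.nonNegative (*-nonneg (*-nonneg ℓ≥0 ℓ≥0) ℓ≥0)}}
           (ℚP.*-monoʳ-≤-nonNeg (ℕtoℚ m) {{ℚ.nonNegative (ℕtoℚ≥0 m)}} (ℕtoℚ-mono ≤K)) ⟩
    ℕtoℚ K * ℕtoℚ m * (ℓ * ℓ * ℓ)                          ≤⟨ hx ⟩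
    x * x                                                  ∎

-- Half-integers, because `logarithm-bound` trades every half unit of ℓ for one doubling.
half-ceiling : ∀ ℓ → ∃ λ b → (ℓ ≤ℚ ℕtoℚ b * inv 1) × (0ℚ ≤ℚ ℓ → ℕtoℚ (ℕ.pred b) ≤ℚ ℕtoℚ 2 * ℓ)
half-ceiling ℓ = result (archimedean ℓ)
  where
  open ℚP.≤-Reasoning
  cancel : ∀ p → ℕtoℚ 2 * (p * inv 1) ≡ p
  cancel p = trans (lem (ℕtoℚ 2) p (inv 1)) (trans (cong (p *_) (ℕtoℚ-inv 1)) (ℚP.*-identityʳ p))
    where lem : ∀ a p i → a * (p * i) ≡ p * (a * i)
          lem = solve-∀ ℚ-ring
  result : (∃ λ u → ℓ ≤ℚ ℕtoℚ u) → ∃ λ b → (ℓ ≤ℚ ℕtoℚ b * inv 1) × (0ℚ ≤ℚ ℓ → ℕtoℚ (ℕ.pred b) ≤ℚ ℕtoℚ 2 * ℓ)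
  result (u , ℓ≤u) = minimal (least (λ b → ℓ ℚP.≤? ℕtoℚ b * inv 1) (2 ℕ.* u) (ℚP.≤-trans ℓ≤u (ℚP.≤-reflexive (sym
      (trans (cong (_* inv 1) (ℕtoℚ-* 2 u)) (trans (ℚP.*-assoc (ℕtoℚ 2) (ℕtoℚ u) (inv 1)) (cancel (ℕtoℚ u))))))))
    where
    minimal : (∃ λ b → (b ℕ.≤ 2 ℕ.* u) × (ℓ ≤ℚ ℕtoℚ b * inv 1) × (∀ i → i ℕ.< b → ¬ (ℓ ≤ℚ ℕtoℚ i * inv 1))) →
              ∃ λ b → (ℓ ≤ℚ ℕtoℚ b * inv 1) × (0ℚ ≤ℚ ℓ → ℕtoℚ (ℕ.pred b) ≤ℚ ℕtoℚ 2 * ℓ)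
    minimal (zero , _ , le , _) = zero , le , λ ℓ≥0 → *-nonneg (ℕtoℚ≥0 2) ℓ≥0
    minimal (suc b , _ , le , min) = suc b , le , λ _ → subst (_≤ℚ ℕtoℚ 2 * ℓ) (cancel (ℕtoℚ b))
      (ℚP.*-monoˡ-≤-nonNeg (ℕtoℚ 2) {{ℚ.nonNegative (ℕtoℚ≥0 2)}} (ℚP.<⇒≤ (ℚP.≰⇒> (min b ℕP.≤-refl))))

-- The reals occur through rational upper bounds: ℓ for log log m, k for log m, and x for 10⁹ √m
-- ℓ^(3/2). Letting ℓ and x approach the real values gives N + 1 ≤ e^(10⁹ √m (log log m)^(3/2)) for
-- every N that admits a colouring without a monochromatic copy. For m ≥ 3 the iterated logarithm is
-- positive.
theorem1p2 : (n : ℕ) (H : OrdGraph n) → NoIsolatedVertices H →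
    3 ≤ edgeCount H →
    (N : ℕ) (c : Colouring N) → ((b : Bool) → ¬ MonoCopy c b H) →
    (ℓ k x : ℚ) → 0ℚ ≤ℚ ℓ → 0ℚ ≤ℚ k → 0ℚ ≤ℚ x →
    ∃ (λ j → k ≤ℚ expPartial ℓ j) →
    ∃ (λ j → ℕtoℚ (edgeCount H) < expPartial k j) →
    ℕtoℚ 1000000000000000000 * ℕtoℚ (edgeCount H) * (ℓ * ℓ * ℓ) ≤ℚ x * x →
    ∃ (λ j → ℕtoℚ (suc N) ≤ℚ expPartial x j)
theorem1p2 n H conn m≥3 N c none ℓ k x ℓ≥0 k≥0 x≥0 k≤ m< hx = conclude (half-ceiling ℓ)
  where
  m = edgeCount H
  conclude : (∃ λ b → (ℓ ≤ℚ ℕtoℚ b * inv 1) × (0ℚ ≤ℚ ℓ → ℕtoℚ (ℕ.pred b) ≤ℚ ℕtoℚ 2 * ℓ)) → ∃ (λ j → ℕtoℚ (suc N) ≤ℚ expPartial x j)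
  conclude (b , ℓ≤ , b≤) = finish (Convert.bound n H N c conn m≥3 none (suc b) (logarithm-bound m ℓ k b ℓ≥0 k≥0 ℓ≤ k≤ m<))
    where
    open ℚP.≤-Reasoning
    1≤20ℓ : 1ℚ ≤ℚ ℕtoℚ 20 * ℓ
    1≤20ℓ = subst (_≤ℚ ℕtoℚ 20 * ℓ) (ℕtoℚ-inv 19)
      (ℚP.*-monoˡ-≤-nonNeg (ℕtoℚ 20) {{ℚ.nonNegative (ℕtoℚ≥0 20)}} (ℚP.<⇒≤ (loglog-lower m ℓ k m≥3 ℓ≥0 k≥0 k≤ m<)))
    -- Rounding costs an additive 2, and 1 ≤ 20 ℓ makes it multiplicative: 42 = 2 + 20 + 20.
    β≤ : ℕtoℚ (suc b) ≤ℚ ℕtoℚ 42 * ℓ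
    β≤ = begin
      ℕtoℚ (suc b)                                      ≤⟨ ℕtoℚ-mono (pred+2 b) ⟩
      ℕtoℚ (ℕ.pred b ℕ.+ 2)                             ≡⟨ ℕtoℚ-+ (ℕ.pred b) 2 ⟩
      ℕtoℚ (ℕ.pred b) + (1ℚ + 1ℚ)                       ≤⟨ ℚP.+-mono-≤ (b≤ ℓ≥0) (ℚP.+-mono-≤ 1≤20ℓ 1≤20ℓ) ⟩
      ℕtoℚ 2 * ℓ + (ℕtoℚ 20 * ℓ + ℕtoℚ 20 * ℓ)          ≡⟨ lem (ℕtoℚ 2) (ℕtoℚ 20) ℓ ⟩
      (ℕtoℚ 2 + (ℕtoℚ 20 + ℕtoℚ 20)) * ℓ                ≡⟨ cong (_* ℓ) (trans (ℕtoℚ-+ 2 40) (cong (λ z → ℕtoℚ 2 + z) (ℕtoℚ-+ 20 20))) ⟨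
      ℕtoℚ 42 * ℓ                                       ∎
      where
      pred+2 : ∀ b → suc b ℕ.≤ ℕ.pred b ℕ.+ 2
      pred+2 zero    = ℕ.s≤s ℕ.z≤n
      pred+2 (suc b) = ℕP.≤-reflexive (ℕP.+-comm 2 b)
      lem : ∀ a d l → a * l + (d * l + d * l) ≡ (a + (d + d)) * l
      lem = solve-∀ ℚ-ring
    finish : (∃ λ E → suc N ℕ.≤ 2 ℕ.^ E × E ℕ.* E ℕ.≤ m ℕ.* (suc b ℕ.* suc b ℕ.* suc b) ℕ.* 100000000000) → ∃ (λ j → ℕtoℚ (suc N) ≤ℚ expPartial x j)
    -- The constant closes because 4 · 10¹¹ · 42³ is about 3 · 10¹⁶, below 10¹⁸ = (10⁹)².
    finish (E , N< , E²≤) = E , (begin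
      ℕtoℚ (suc N)      ≤⟨ ℕtoℚ-mono N< ⟩
      ℕtoℚ (2 ℕ.^ E)    ≤⟨ term-lower E (square-root E m (suc b) 42 100000000000 1000000000000000000 ℓ x x≥0 ℓ≥0 β≤ E²≤
                              (ℕP.≤ᵇ⇒≤ (100000000000 ℕ.* 4 ℕ.* (42 ℕ.* 42 ℕ.* 42)) 1000000000000000000 _) hx) E ℕP.≤-refl ⟩
      expTerm x E       ≤⟨ term≤partial x≥0 E ⟩
      expPartial x E    ∎)
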